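{- Let $G=(V,E)$ be any connected finite simple graph and let $\varepsilon\in(0,1)$. Then a controller of the $\varepsilon$-biased random walk can increase the stationary probability of any vertex from $p$ to $p^{1-\varepsilon+\delta}$, where $\delta=\ln(16\cdot t_{\mathsf{mix}})/|\ln p|$. That is, for every $v\in V$, with $p=\pi(v)$ the stationary probability of $v$ under the simple random walk, there is an unchanging strategy for the $\varepsilon$-biased random walk under which the stationary probability of $v$ is at least $p^{1-\varepsilon+\delta}$.
   Context: Let $\mathbf P$ be the transition matrix of the simple random walk on $G$ (move to a uniformly random neighbour), with stationary distribution $\pi(v)=d(v)/\sum_w d(w)$, and $\tilde{\mathbf P}=(\mathbf I+\mathbf P)/2$ the lazy random walk, with $t$-step transition probabilities $\tilde p^{(t)}_{x,y}$. The total variation mixing time is $t_{\mathsf{mix}}=\min\{t\ge1:\max_{x\in V}\frac12\sum_{y\in V}|\tilde p^{(t)}_{x,y}-\pi(y)|\le 1/4\}$. The $\varepsilon$-biased random walk ($\varepsilon$-BRW) with unchanging strategy $\mathbf B$ is the Markov chain with transition matrix $\mathbf Q=(1-\varepsilon)\mathbf P+\varepsilon\mathbf B$, where $\mathbf B$ is an arbitrary stochastic matrix, chosen by a controller, supported on the edges of $G$. Its stationary distribution is denoted $\pi_{\mathbf Q}$. -}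

module Defs where

open import Algebra.Bundles.Raw using (RawMonoid)
import Algebra.Definitions.RawMonoid as RawMonoidDefinitions
open import Data.Bool.Base using (if_then_else_)
open import Data.Fin.Base using (Fin)
import Data.Fin.Properties as Fin
open import Data.Integer.Base as ℤ using (+_; -[1+_])
import Data.Integer.Properties as ℤₚ
open import Data.List.Base as List using (allFin; filter)
open import Data.Nat.Base as ℕ using (ℕ; zero; suc)
import Data.Nat.Properties as ℕₚ
open import Data.Product.Base using (∃; _×_; _,_; proj₁; proj₂)
open import Data.Rational.Base as Rat
  using (ℚ; 0ℚ; 1ℚ; ½; mkℚ; *≤*; Positive)
import Data.Rational.Properties as ℚₚ
import Data.Rational.Unnormalised.Base as ℚᵘ
import Data.Rational.Unnormalised.Properties as ℚᵘₚ
open import Data.Rational.Solver using (module +-*-Solver)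
open import Data.Sum.Base using (inj₁; inj₂)
import Data.Vec.Functional as Vector
open import Level using (0ℓ)
open import Relation.Binary.Construct.Closure.ReflexiveTransitive using (Star)
open import Relation.Binary.Core using (Rel)
open import Relation.Binary.Definitions
  using (Decidable; Irreflexive; Symmetric)
open import Relation.Binary.PropositionalEquality
  using (_≡_; refl; sym; trans; cong; cong₂; subst)
open import Relation.Nullary using (¬_; does)

-- Opaque because normalising the gcd computation behind Rat._/_
-- with an open denominator makes type checking very slow.
opaque
  fromℕ : ℕ → ℚ
  fromℕ n = + n Rat./ 1

  recip : ℕ → ℚ
  recip k = + 1 Rat./ suc k

module ℚ-Lemmas where
  open Rat hiding (ℚ; mkℚ; 0ℚ; 1ℚ; ½; *≤*; Positive)
  open ℚₚ.≤-Reasoning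
  open +-*-Solver

  opaque
    *-mono-≤ : ∀ {a b c d} → 0ℚ ≤ a → a ≤ b → 0ℚ ≤ c → c ≤ d → a * c ≤ b * d
    *-mono-≤ {a} {b} {c} {d} 0≤a a≤b 0≤c c≤d = begin
      a * c ≤⟨ ℚₚ.*-monoˡ-≤-nonNeg a {{nonNegative 0≤a}} c≤d ⟩
      a * d ≤⟨ ℚₚ.*-monoʳ-≤-nonNeg d {{nonNegative (ℚₚ.≤-trans 0≤c c≤d)}} a≤b ⟩
      b * d ∎

    *-nonneg : ∀ {a b} → 0ℚ ≤ a → 0ℚ ≤ b → 0ℚ ≤ a * b
    *-nonneg {a} {b} 0≤a 0≤b =
      subst (_≤ a * b) (ℚₚ.*-zeroˡ 0ℚ) (*-mono-≤ ℚₚ.≤-refl 0≤a ℚₚ.≤-refl 0≤b)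

    *-pos : ∀ {a b} → 0ℚ < a → 0ℚ < b → 0ℚ < a * b
    *-pos {a} {b} 0<a 0<b = ℚₚ.positive⁻¹ (a * b)
      {{ℚₚ.pos*pos⇒pos a {{positive 0<a}} b {{positive 0<b}}}}

    0≤1 : 0ℚ ≤ 1ℚ
    0≤1 = ℚₚ.nonNegative⁻¹ 1ℚ

    0<1 : 0ℚ < 1ℚ
    0<1 = ℚₚ.positive⁻¹ 1ℚ

    0<½ : 0ℚ < ½
    0<½ = ℚₚ.positive⁻¹ ½

    p≤q+p : ∀ {p q} → 0ℚ ≤ q → p ≤ q + p
    p≤q+p {p} {q} 0≤q = begin
      p      ≡⟨ ℚₚ.+-identityˡ p ⟨
      0ℚ + p ≤⟨ ℚₚ.+-monoˡ-≤ p 0≤q ⟩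
      q + p  ∎

    p≤p+q : ∀ {p q} → 0ℚ ≤ q → p ≤ p + q
    p≤p+q {p} {q} 0≤q = subst (p ≤_) (ℚₚ.+-comm q p) (p≤q+p 0≤q)

    half+half : ∀ e → ½ * e + ½ * e ≡ e
    half+half e = begin-equality
      ½ * e + ½ * e ≡⟨ ℚₚ.*-distribʳ-+ e ½ ½ ⟨
      1ℚ * e        ≡⟨ ℚₚ.*-identityˡ e ⟩
      e             ∎

    half-pos : ∀ {e} → 0ℚ < e → 0ℚ < ½ * e
    half-pos = *-pos 0<½

    shrink : ∀ {c} → 0ℚ < c → ∀ {e} → 0ℚ < e → ∃ λ d → 0ℚ < d × c * d ≡ e
    shrink {c} 0<c {e} 0<e = r * e , *-pos 0<r 0<e , (begin-equality
        c * (r * e) ≡⟨ ℚₚ.*-assoc c r e ⟨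
        (c * r) * e ≡⟨ cong (_* e) (ℚₚ.*-inverseʳ c) ⟩
        1ℚ * e      ≡⟨ ℚₚ.*-identityˡ e ⟩
        e           ∎)
      where
      instance
        pos-c : Positive c
        pos-c = positive 0<c
        nz-c : NonZero c
        nz-c = ℚₚ.pos⇒nonZero c
      r : Rat.ℚ
      r = 1/ c
      0<r : 0ℚ < r
      0<r = ℚₚ.positive⁻¹ r {{ℚₚ.1/pos⇒pos c}}

    ∣-∣-sym : ∀ p q → ∣ p - q ∣ ≡ ∣ q - p ∣
    ∣-∣-sym p q = begin-equality
      ∣ p - q ∣     ≡⟨ cong ∣_∣ (solve 2 (λ p q → p :- q := :- (q :- p)) refl p q) ⟩
      ∣ - (q - p) ∣ ≡⟨ ℚₚ.∣-p∣≡∣p∣ (q - p) ⟩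
      ∣ q - p ∣     ∎

    triangle : ∀ p q r → ∣ p - r ∣ ≤ ∣ p - q ∣ + ∣ q - r ∣
    triangle p q r = begin
      ∣ p - r ∣
        ≡⟨ cong ∣_∣ (solve 3 (λ p q r → p :- r := (p :- q) :+ (q :- r)) refl p q r) ⟩
      ∣ (p - q) + (q - r) ∣ ≤⟨ ℚₚ.∣p+q∣≤∣p∣+∣q∣ (p - q) (q - r) ⟩
      ∣ p - q ∣ + ∣ q - r ∣ ∎

    p≤∣p∣ : ∀ p → p ≤ ∣ p ∣
    p≤∣p∣ p with ℚₚ.≤-total 0ℚ p
    ... | inj₁ 0≤p = ℚₚ.≤-reflexive (sym (ℚₚ.0≤p⇒∣p∣≡p 0≤p))
    ... | inj₂ p≤0 = ℚₚ.≤-trans p≤0 (ℚₚ.0≤∣p∣ p)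

    ∣∣-≤ : ∀ {p b} → p ≤ b → - p ≤ b → ∣ p ∣ ≤ b
    ∣∣-≤ {p} {b} p≤b -p≤b with ℚₚ.∣p∣≡p∨∣p∣≡-p p
    ... | inj₁ eq = subst (_≤ b) (sym eq) p≤b
    ... | inj₂ eq = subst (_≤ b) (sym eq) -p≤b

    ∣∣-lower : ∀ p q → ∣ p ∣ ≤ ∣ q ∣ + ∣ p - q ∣
    ∣∣-lower p q = begin
      ∣ p ∣
        ≡⟨ cong ∣_∣ (solve 2 (λ p q → p := q :+ (p :- q)) refl p q) ⟩
      ∣ q + (p - q) ∣   ≤⟨ ℚₚ.∣p+q∣≤∣p∣+∣q∣ q (p - q) ⟩
      ∣ q ∣ + ∣ p - q ∣ ∎

    ≤-move : ∀ {p q r} → p ≤ q + r → p - q ≤ r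
    ≤-move {p} {q} {r} h = begin
      p - q       ≤⟨ ℚₚ.+-monoˡ-≤ (- q) h ⟩
      (q + r) - q ≡⟨ solve 2 (λ q r → (q :+ r) :- q := r) refl q r ⟩
      r           ∎

    ∣∣-contract : ∀ p q → ∣ ∣ p ∣ - ∣ q ∣ ∣ ≤ ∣ p - q ∣
    ∣∣-contract p q = ∣∣-≤ (≤-move (∣∣-lower p q)) (begin
      - (∣ p ∣ - ∣ q ∣)
        ≡⟨ solve 2 (λ a b → :- (a :- b) := b :- a) refl ∣ p ∣ ∣ q ∣ ⟩
      ∣ q ∣ - ∣ p ∣ ≤⟨ ≤-move (∣∣-lower q p) ⟩
      ∣ q - p ∣     ≡⟨ ∣-∣-sym q p ⟩
      ∣ p - q ∣     ∎)

  opaque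
    unfolding fromℕ recip

    fromℕ-suc : ∀ n → fromℕ (suc n) ≡ 1ℚ + fromℕ n
    fromℕ-suc n = ℚₚ.toℚᵘ-injective (R.begin-equality
        toℚᵘ (fromℕ (suc n))        R.≃⟨ ℚₚ.toℚᵘ-fromℚᵘ (ℚᵘ.mkℚᵘ (+ suc n) 0) ⟩
        ℚᵘ.mkℚᵘ (+ suc n) 0         R.≃⟨ ℚᵘ.*≡* eq ⟩
        ℚᵘ.mkℚᵘ (+ 1) 0 ℚᵘ.+ ℚᵘ.mkℚᵘ (+ n) 0
          R.≃⟨ ℚᵘₚ.+-congʳ (ℚᵘ.mkℚᵘ (+ 1) 0) (ℚₚ.toℚᵘ-fromℚᵘ (ℚᵘ.mkℚᵘ (+ n) 0)) ⟨
        toℚᵘ 1ℚ ℚᵘ.+ toℚᵘ (fromℕ n) R.≃⟨ ℚₚ.toℚᵘ-homo-+ 1ℚ (fromℕ n) ⟨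
        toℚᵘ (1ℚ + fromℕ n)         R.∎)
      where
      module R = ℚᵘₚ.≤-Reasoning
      eq : + suc n ℤ.* + 1 ≡ (+ 1 ℤ.* + 1 ℤ.+ + n ℤ.* + 1) ℤ.* + 1
      eq rewrite ℤₚ.*-identityʳ (+ n) = refl

    recip-inverse : ∀ k → fromℕ (suc k) * recip k ≡ 1ℚ
    recip-inverse k = ℚₚ.toℚᵘ-injective (R.begin-equality
        toℚᵘ (fromℕ (suc k) * recip k)           R.≃⟨ ℚₚ.toℚᵘ-homo-* (fromℕ (suc k)) (recip k) ⟩
        toℚᵘ (fromℕ (suc k)) ℚᵘ.* toℚᵘ (recip k)
          R.≃⟨ ℚᵘₚ.*-cong (ℚₚ.toℚᵘ-fromℚᵘ (ℚᵘ.mkℚᵘ (+ suc k) 0))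
                          (ℚₚ.toℚᵘ-fromℚᵘ (ℚᵘ.mkℚᵘ (+ 1) k)) ⟩
        ℚᵘ.mkℚᵘ (+ suc k) 0 ℚᵘ.* ℚᵘ.mkℚᵘ (+ 1) k R.≃⟨ ℚᵘ.*≡* eq ⟩
        toℚᵘ 1ℚ                                  R.∎)
      where
      module R = ℚᵘₚ.≤-Reasoning
      eq : (+ suc k ℤ.* + 1) ℤ.* + 1 ≡ + 1 ℤ.* + (1 ℕ.* suc k)
      eq = cong (λ j → + suc j)
        (trans (trans (ℕₚ.*-identityʳ (k ℕ.* 1)) (ℕₚ.*-identityʳ k))
          (sym (trans (ℕₚ.+-identityʳ (k ℕ.+ 0)) (ℕₚ.+-identityʳ k))))

    0<recip : ∀ k → 0ℚ < recip k
    0<recip k = ℚₚ.positive⁻¹ (recip k) {{ℚₚ.normalize-pos 1 (suc k)}}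

    0≤fromℕ : ∀ n → 0ℚ ≤ fromℕ n
    0≤fromℕ n = ℚₚ.nonNegative⁻¹ (fromℕ n) {{ℚₚ.normalize-nonNeg n 1}}

    archimedean : ∀ q → ∃ λ n → q ≤ fromℕ n
    archimedean q with ℚₚ.≤-total q 0ℚ
    ... | inj₁ q≤0 = 0 , q≤0
    archimedean q@(mkℚ -[1+ _ ] _ _) | inj₂ (*≤* ())
    archimedean q@(mkℚ (+ n) d _) | inj₂ _ = n , ℚₚ.toℚᵘ-cancel-≤ (R.begin
        ℚᵘ.mkℚᵘ (+ n) d R.≤⟨ ℚᵘ.*≤* le ⟩
        ℚᵘ.mkℚᵘ (+ n) 0 R.≃⟨ ℚₚ.toℚᵘ-fromℚᵘ (ℚᵘ.mkℚᵘ (+ n) 0) ⟨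
        toℚᵘ (fromℕ n)  R.∎)
      where
      module R = ℚᵘₚ.≤-Reasoning
      le : + n ℤ.* + 1 ℤ.≤ + n ℤ.* + suc d
      le = ℤₚ.*-monoˡ-≤-nonNeg (+ n) (ℤ.+≤+ (ℕ.s≤s ℕ.z≤n))

    fromℕ-zero : fromℕ 0 ≡ 0ℚ
    fromℕ-zero = refl

    recip-zero : recip 0 ≡ 1ℚ
    recip-zero = refl

  opaque

    fromℕ-mono : ∀ {m n} → m ℕ.≤ n → fromℕ m ≤ fromℕ n
    fromℕ-mono {n = n} ℕ.z≤n = subst (_≤ fromℕ n) (sym fromℕ-zero) (0≤fromℕ n)
    fromℕ-mono {suc m} {suc n} (ℕ.s≤s m≤n) = begin
      fromℕ (suc m) ≡⟨ fromℕ-suc m ⟩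
      1ℚ + fromℕ m  ≤⟨ ℚₚ.+-monoʳ-≤ 1ℚ (fromℕ-mono m≤n) ⟩
      1ℚ + fromℕ n  ≡⟨ fromℕ-suc n ⟨
      fromℕ (suc n) ∎

    recip-small : ∀ {e} → 0ℚ < e → ∃ λ N → ∀ k → N ℕ.≤ k → recip k ≤ e
    recip-small {e} 0<e with shrink 0<e 0<1
    ... | d , _ , ed≡1 with archimedean d
    ... | N , d≤N = N , λ k N≤k → begin
      recip k                       ≡⟨ ℚₚ.*-identityˡ (recip k) ⟨
      1ℚ * recip k                  ≡⟨ cong (_* recip k) ed≡1 ⟨
      (e * d) * recip k
        ≤⟨ ℚₚ.*-monoʳ-≤-nonNeg (recip k) {{nonNegative (ℚₚ.<⇒≤ (0<recip k))}}
             (ℚₚ.*-monoˡ-≤-nonNeg e {{nonNegative (ℚₚ.<⇒≤ 0<e)}}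
               (ℚₚ.≤-trans d≤N (fromℕ-mono (ℕₚ.m≤n⇒m≤1+n N≤k)))) ⟩
      (e * fromℕ (suc k)) * recip k ≡⟨ ℚₚ.*-assoc e (fromℕ (suc k)) (recip k) ⟩
      e * (fromℕ (suc k) * recip k) ≡⟨ cong (e *_) (recip-inverse k) ⟩
      e * 1ℚ                        ≡⟨ ℚₚ.*-identityʳ e ⟩
      e                             ∎

module ExpSeries where
  open Rat using (_≤_; _<_; _+_; _*_; _-_; -_; ∣_∣; nonNegative)
  open ℚₚ.≤-Reasoning
  open +-*-Solver
  open ℚ-Lemmas

  -- expTerm x k is x^k / k!
  expTerm : ℚ → ℕ → ℚ
  expTerm x zero    = 1ℚ
  expTerm x (suc k) = expTerm x k * (x * recip k)

  expSum : ℚ → ℕ → ℚ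
  expSum x zero    = 0ℚ
  expSum x (suc n) = expSum x n + expTerm x n

  private
    unit : ∀ x → expTerm x 1 ≡ x
    unit x = trans (ℚₚ.*-identityˡ (x * recip 0))
      (trans (cong (x *_) recip-zero) (ℚₚ.*-identityʳ x))

    telescope : ∀ a b x y r →
      a * (x * r) - b * (y * r) ≡ ((a - b) * x + b * (x - y)) * r
    telescope = solve 5 (λ a b x y r →
      a :* (x :* r) :- b :* (y :* r) :=
      ((a :- b) :* x :+ b :* (x :- y)) :* r) refl

    collect : ∀ d t u f r →
      ((d * t) * (f * u) + (t * u) * d) * r ≡ (d * (t * u)) * ((1ℚ + f) * r)
    collect d t u f r = trans
      (solve 5 (λ d t u f r →
        ((d :* t) :* (f :* u) :+ (t :* u) :* d) :* r :=
        (d :* (t :* u)) :* (f :* r) :+ (d :* (t :* u)) :* r) refl d t u f r)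
      (begin-equality
        w * (f * r) + w * r          ≡⟨ ℚₚ.+-comm (w * (f * r)) (w * r) ⟩
        w * r + w * (f * r)          ≡⟨ ℚₚ.*-distribˡ-+ w r (f * r) ⟨
        w * (r + f * r)
          ≡⟨ cong (λ v → w * (v + f * r)) (ℚₚ.*-identityˡ r) ⟨
        w * (1ℚ * r + f * r)         ≡⟨ cong (w *_) (ℚₚ.*-distribʳ-+ r 1ℚ f) ⟨
        w * ((1ℚ + f) * r)           ∎)
      where w = d * (t * u)

  module _ {K : ℚ} (0<K : 0ℚ < K) where

    0≤K : 0ℚ ≤ K
    0≤K = ℚₚ.<⇒≤ 0<K

    t S : ℕ → ℚ
    t = expTerm K
    S = expSum K

    0≤Kr : ∀ k → 0ℚ ≤ K * recip k
    0≤Kr k = *-nonneg 0≤K (ℚₚ.<⇒≤ (0<recip k))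

    0≤t : ∀ k → 0ℚ ≤ t k
    0≤t zero    = 0≤1
    0≤t (suc k) = *-nonneg (0≤t k) (0≤Kr k)

    0≤S : ∀ n → 0ℚ ≤ S n
    0≤S zero    = ℚₚ.≤-refl
    0≤S (suc n) = ℚₚ.≤-trans (0≤S n) (p≤p+q (0≤t n))

    S-mono : ∀ {m n} → m ℕ.≤′ n → S m ≤ S n
    S-mono ℕ.≤′-refl               = ℚₚ.≤-refl
    S-mono (ℕ.≤′-step {n = n} m≤n) = ℚₚ.≤-trans (S-mono m≤n) (p≤p+q (0≤t n))

    term-bound : ∀ {x} → ∣ x ∣ ≤ K → ∀ k → ∣ expTerm x k ∣ ≤ t k
    term-bound x≤K zero = ℚₚ.≤-refl
    term-bound {x} x≤K (suc k) = begin
      ∣ expTerm x k * (x * recip k) ∣ ≡⟨ ℚₚ.∣p*q∣≡∣p∣*∣q∣ (expTerm x k) (x * recip k) ⟩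
      ∣ expTerm x k ∣ * ∣ x * recip k ∣
        ≤⟨ *-mono-≤ (ℚₚ.0≤∣p∣ _) (term-bound x≤K k) (ℚₚ.0≤∣p∣ _) (begin
             ∣ x * recip k ∣     ≡⟨ ℚₚ.∣p*q∣≡∣p∣*∣q∣ x (recip k) ⟩
             ∣ x ∣ * ∣ recip k ∣ ≡⟨ cong (∣ x ∣ *_) (ℚₚ.0≤p⇒∣p∣≡p (ℚₚ.<⇒≤ (0<recip k))) ⟩
             ∣ x ∣ * recip k
               ≤⟨ ℚₚ.*-monoʳ-≤-nonNeg (recip k) {{nonNegative (ℚₚ.<⇒≤ (0<recip k))}} x≤K ⟩
             K * recip k         ∎) ⟩
      t k * (K * recip k) ∎

    sum-gap : ∀ {x} → ∣ x ∣ ≤ K → ∀ {m n} → m ℕ.≤′ n →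
              ∣ expSum x n - expSum x m ∣ ≤ S n - S m
    sum-gap {x} x≤K {m} ℕ.≤′-refl = ℚₚ.≤-reflexive
      (trans (cong ∣_∣ (ℚₚ.+-inverseʳ (expSum x m))) (sym (ℚₚ.+-inverseʳ (S m))))
    sum-gap {x} x≤K {m} (ℕ.≤′-step {n = n} m≤n) = begin
      ∣ (expSum x n + expTerm x n) - expSum x m ∣
        ≡⟨ cong ∣_∣ (solve 3 (λ a b c → (a :+ b) :- c := (a :- c) :+ b) refl
             (expSum x n) (expTerm x n) (expSum x m)) ⟩
      ∣ (expSum x n - expSum x m) + expTerm x n ∣
        ≤⟨ ℚₚ.∣p+q∣≤∣p∣+∣q∣ (expSum x n - expSum x m) (expTerm x n) ⟩
      ∣ expSum x n - expSum x m ∣ + ∣ expTerm x n ∣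
        ≤⟨ ℚₚ.+-mono-≤ (sum-gap x≤K m≤n) (term-bound x≤K n) ⟩
      (S n - S m) + t n
        ≡⟨ solve 3 (λ a b c → (a :- c) :+ b := (a :+ b) :- c) refl (S n) (t n) (S m) ⟩
      (S n + t n) - S m ∎

    -- |x^(k+1) - y^(k+1)| / (k+1)! ≤ |x - y| K^k / k!
    term-lipschitz : ∀ {x y} → ∣ x ∣ ≤ K → ∣ y ∣ ≤ K → ∀ k →
      ∣ expTerm x (suc k) - expTerm y (suc k) ∣ ≤ ∣ x - y ∣ * t k
    term-lipschitz {x} {y} x≤K y≤K zero = ℚₚ.≤-reflexive (begin-equality
      ∣ expTerm x 1 - expTerm y 1 ∣
        ≡⟨ cong ∣_∣ (cong₂ _-_ (unit x) (unit y)) ⟩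
      ∣ x - y ∣      ≡⟨ ℚₚ.*-identityʳ ∣ x - y ∣ ⟨
      ∣ x - y ∣ * 1ℚ ∎)
    term-lipschitz {x} {y} x≤K y≤K (suc k) = begin
      ∣ expTerm x (suc k) * (x * r) - expTerm y (suc k) * (y * r) ∣
        ≡⟨ cong ∣_∣ (telescope (expTerm x (suc k)) (expTerm y (suc k)) x y r) ⟩
      ∣ (Δ * x + b * (x - y)) * r ∣
        ≡⟨ ℚₚ.∣p*q∣≡∣p∣*∣q∣ (Δ * x + b * (x - y)) r ⟩
      ∣ Δ * x + b * (x - y) ∣ * ∣ r ∣
        ≡⟨ cong (∣ Δ * x + b * (x - y) ∣ *_) (ℚₚ.0≤p⇒∣p∣≡p 0≤r) ⟩
      ∣ Δ * x + b * (x - y) ∣ * r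
        ≤⟨ ℚₚ.*-monoʳ-≤-nonNeg r {{nonNegative 0≤r}} (begin
             ∣ Δ * x + b * (x - y) ∣
               ≤⟨ ℚₚ.∣p+q∣≤∣p∣+∣q∣ (Δ * x) (b * (x - y)) ⟩
             ∣ Δ * x ∣ + ∣ b * (x - y) ∣
               ≡⟨ cong₂ _+_ (ℚₚ.∣p*q∣≡∣p∣*∣q∣ Δ x) (ℚₚ.∣p*q∣≡∣p∣*∣q∣ b (x - y)) ⟩
             ∣ Δ ∣ * ∣ x ∣ + ∣ b ∣ * d
               ≤⟨ ℚₚ.+-mono-≤
                    (*-mono-≤ (ℚₚ.0≤∣p∣ Δ) (term-lipschitz x≤K y≤K k) (ℚₚ.0≤∣p∣ x) x≤K)
                    (ℚₚ.*-monoʳ-≤-nonNeg d {{nonNegative (ℚₚ.0≤∣p∣ (x - y))}}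
                      (term-bound y≤K (suc k))) ⟩
             (d * t k) * K + (t k * (K * recip k)) * d ∎) ⟩
      ((d * t k) * K + (t k * (K * recip k)) * d) * r
        ≡⟨ cong (λ u → ((d * t k) * u + (t k * (K * recip k)) * d) * r) K≡ ⟩
      ((d * t k) * (fromℕ (suc k) * (K * recip k)) + (t k * (K * recip k)) * d) * r
        ≡⟨ collect d (t k) (K * recip k) (fromℕ (suc k)) r ⟩
      (d * t (suc k)) * ((1ℚ + fromℕ (suc k)) * r)
        ≡⟨ cong (λ u → (d * t (suc k)) * (u * r)) (fromℕ-suc (suc k)) ⟨
      (d * t (suc k)) * (fromℕ (suc (suc k)) * r)
        ≡⟨ cong ((d * t (suc k)) *_) (recip-inverse (suc k)) ⟩
      (d * t (suc k)) * 1ℚ ≡⟨ ℚₚ.*-identityʳ (d * t (suc k)) ⟩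
      d * t (suc k)        ∎
      where
      r = recip (suc k)
      0≤r = ℚₚ.<⇒≤ (0<recip (suc k))
      d = ∣ x - y ∣
      b = expTerm y (suc k)
      Δ = expTerm x (suc k) - expTerm y (suc k)
      K≡ : K ≡ fromℕ (suc k) * (K * recip k)
      K≡ = begin-equality
        K                               ≡⟨ ℚₚ.*-identityʳ K ⟨
        K * 1ℚ                          ≡⟨ cong (K *_) (recip-inverse k) ⟨
        K * (fromℕ (suc k) * recip k)
          ≡⟨ solve 3 (λ K f r → K :* (f :* r) := f :* (K :* r)) refl
               K (fromℕ (suc k)) (recip k) ⟩
        fromℕ (suc k) * (K * recip k)   ∎

    sum-lipschitz : ∀ {x y} → ∣ x ∣ ≤ K → ∣ y ∣ ≤ K → ∀ n →
      ∣ expSum x n - expSum y n ∣ ≤ ∣ x - y ∣ * S n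
    sum-lipschitz {x} {y} x≤K y≤K zero =
      ℚₚ.≤-reflexive (sym (ℚₚ.*-zeroʳ ∣ x - y ∣))
    sum-lipschitz {x} {y} x≤K y≤K (suc n) = ℚₚ.≤-trans (shifted n)
      (ℚₚ.*-monoˡ-≤-nonNeg ∣ x - y ∣ {{nonNegative (ℚₚ.0≤∣p∣ (x - y))}} (p≤p+q (0≤t n)))
      where
      shifted : ∀ n → ∣ expSum x (suc n) - expSum y (suc n) ∣ ≤ ∣ x - y ∣ * S n
      shifted zero = ℚₚ.≤-reflexive (sym (ℚₚ.*-zeroʳ ∣ x - y ∣))
      shifted (suc n) = begin
        ∣ (a + a′) - (b + b′) ∣
          ≡⟨ cong ∣_∣ (solve 4 (λ a a′ b b′ →
               (a :+ a′) :- (b :+ b′) := (a :- b) :+ (a′ :- b′)) refl a a′ b b′) ⟩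
        ∣ (a - b) + (a′ - b′) ∣   ≤⟨ ℚₚ.∣p+q∣≤∣p∣+∣q∣ (a - b) (a′ - b′) ⟩
        ∣ a - b ∣ + ∣ a′ - b′ ∣
          ≤⟨ ℚₚ.+-mono-≤ (shifted n) (term-lipschitz x≤K y≤K n) ⟩
        ∣ x - y ∣ * S n + ∣ x - y ∣ * t n ≡⟨ ℚₚ.*-distribˡ-+ ∣ x - y ∣ (S n) (t n) ⟨
        ∣ x - y ∣ * (S n + t n) ∎
        where
        a = expSum x (suc n)
        a′ = expTerm x (suc n)
        b = expSum y (suc n)
        b′ = expTerm y (suc n)

    opaque
      halving-from : ∃ λ N → ∀ k → N ℕ.≤ k → t (suc k) ≤ ½ * t k
      halving-from = proj₁ small , λ k N≤k → begin
        t k * (K * recip k)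
          ≤⟨ ℚₚ.*-monoˡ-≤-nonNeg (t k) {{nonNegative (0≤t k)}}
               (ℚₚ.*-monoˡ-≤-nonNeg K {{nonNegative 0≤K}} (proj₂ small k N≤k)) ⟩
        t k * (K * d) ≡⟨ cong (t k *_) (proj₂ (proj₂ ratio)) ⟩
        t k * ½       ≡⟨ ℚₚ.*-comm (t k) ½ ⟩
        ½ * t k       ∎
        where
        ratio : ∃ λ d → 0ℚ < d × K * d ≡ ½
        ratio = shrink 0<K 0<½
        d : ℚ
        d = proj₁ ratio
        small : ∃ λ N → ∀ k → N ℕ.≤ k → recip k ≤ d
        small = recip-small (proj₁ (proj₂ ratio))

      k₀ : ℕ
      k₀ = proj₁ halving-from

      φ : ℕ → ℚ
      φ n = S n + (t n + t n)

      φ-anti : ∀ {m n} → k₀ ℕ.≤ m → m ℕ.≤′ n → φ n ≤ φ m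
      φ-anti k₀≤m ℕ.≤′-refl = ℚₚ.≤-refl
      φ-anti {m} k₀≤m (ℕ.≤′-step {n = n} m≤n) = ℚₚ.≤-trans (begin
          (S n + t n) + (t (suc n) + t (suc n))
            ≤⟨ ℚₚ.+-monoʳ-≤ (S n + t n) (ℚₚ.+-mono-≤ halve halve) ⟩
          (S n + t n) + (½ * t n + ½ * t n)
            ≡⟨ cong (λ u → (S n + t n) + u) (half+half (t n)) ⟩
          (S n + t n) + t n ≡⟨ ℚₚ.+-assoc (S n) (t n) (t n) ⟩
          S n + (t n + t n) ∎)
        (φ-anti k₀≤m m≤n)
        where
        halve : t (suc n) ≤ ½ * t n
        halve = proj₂ halving-from n (ℕₚ.≤-trans k₀≤m (ℕₚ.≤′⇒≤ m≤n))

      S≤φ : ∀ n → S n ≤ φ n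
      S≤φ n = p≤p+q (ℚₚ.≤-trans (0≤t n) (p≤p+q (0≤t n)))

      E : ℚ
      E = φ k₀ + 1ℚ

      0<E : 0ℚ < E
      0<E = ℚₚ.<-≤-trans 0<1 (p≤q+p (ℚₚ.≤-trans (0≤S k₀) (S≤φ k₀)))

      S≤E : ∀ n → S n ≤ E
      S≤E n = ℚₚ.≤-trans S≤φk₀ (p≤p+q 0≤1)
        where
        S≤φk₀ : S n ≤ φ k₀
        S≤φk₀ with ℕₚ.≤-total n k₀
        ... | inj₁ n≤k₀ = ℚₚ.≤-trans (S-mono (ℕₚ.≤⇒≤′ n≤k₀)) (S≤φ k₀)
        ... | inj₂ k₀≤n = ℚₚ.≤-trans (S≤φ n) (φ-anti ℕₚ.≤-refl (ℕₚ.≤⇒≤′ k₀≤n))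

      t≤E : ∀ n → t n ≤ E
      t≤E n = ℚₚ.≤-trans (p≤q+p (0≤S n)) (S≤E (suc n))

      t-small : ∀ {e} → 0ℚ < e → ∃ λ N → ∀ n → N ℕ.≤ n → t n ≤ e
      t-small {e} 0<e with shrink (*-pos 0<E 0<K) 0<e
      ... | d , 0<d , EKd≡e with recip-small 0<d
      ... | N , small = suc N , bound
        where
        bound : ∀ n → suc N ℕ.≤ n → t n ≤ e
        bound (suc n) (ℕ.s≤s N≤n) = begin
          t n * (K * recip n)
            ≤⟨ *-mono-≤ (0≤t n) (t≤E n) (0≤Kr n)
                 (ℚₚ.*-monoˡ-≤-nonNeg K {{nonNegative 0≤K}} (small n N≤n)) ⟩
          E * (K * d) ≡⟨ ℚₚ.*-assoc E K d ⟨
          (E * K) * d ≡⟨ EKd≡e ⟩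
          e           ∎

      tail-small : ∀ {e} → 0ℚ < e →
        ∃ λ N → ∀ {m n} → N ℕ.≤ m → m ℕ.≤ n → S n - S m ≤ e
      tail-small {e} 0<e with t-small (half-pos 0<e)
      ... | N , small = N ℕ.⊔ k₀ , λ {m} {n} N≤m m≤n → begin
          S n - S m ≤⟨ ≤-move (ℚₚ.≤-trans (S≤φ n)
                         (φ-anti (ℕₚ.≤-trans (ℕₚ.m≤n⊔m N k₀) N≤m) (ℕₚ.≤⇒≤′ m≤n))) ⟩
          t m + t m ≤⟨ ℚₚ.+-mono-≤ (small m (ℕₚ.≤-trans (ℕₚ.m≤m⊔n N k₀) N≤m))
                                   (small m (ℕₚ.≤-trans (ℕₚ.m≤m⊔n N k₀) N≤m)) ⟩
          ½ * e + ½ * e ≡⟨ half+half e ⟩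
          e ∎

    expSum-cauchy : (x : ℕ → ℚ) → (∀ n → ∣ x n ∣ ≤ K) →
      (∀ {e} → 0ℚ < e → ∃ λ N → ∀ {m n} → N ℕ.≤ m → N ℕ.≤ n → ∣ x m - x n ∣ ≤ e) →
      ∀ {e} → 0ℚ < e → ∃ λ N → ∀ {m n} → N ℕ.≤ m → N ℕ.≤ n →
      ∣ expSum (x m) m - expSum (x n) n ∣ ≤ e
    expSum-cauchy x x≤K cauchy {e} 0<e with shrink 0<E (half-pos 0<e)
    ... | d , 0<d , Ed≡½e with cauchy 0<d | tail-small (half-pos 0<e)
    ... | N₁ , close | N₂ , tail = N₁ ℕ.⊔ N₂ , both
      where
      ordered : ∀ {m n} → N₁ ℕ.⊔ N₂ ℕ.≤ m → m ℕ.≤ n →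
                ∣ expSum (x n) n - expSum (x m) m ∣ ≤ e
      ordered {m} {n} N≤m m≤n = begin
        ∣ expSum (x n) n - expSum (x m) m ∣
          ≤⟨ triangle (expSum (x n) n) (expSum (x m) n) (expSum (x m) m) ⟩
        ∣ expSum (x n) n - expSum (x m) n ∣ + ∣ expSum (x m) n - expSum (x m) m ∣
          ≤⟨ ℚₚ.+-mono-≤
               (begin
                 ∣ expSum (x n) n - expSum (x m) n ∣ ≤⟨ sum-lipschitz (x≤K n) (x≤K m) n ⟩
                 ∣ x n - x m ∣ * S n
                   ≤⟨ *-mono-≤ (ℚₚ.0≤∣p∣ (x n - x m)) (close (ℕₚ.≤-trans N₁≤m m≤n) N₁≤m)
                        (0≤S n) (S≤E n) ⟩
                 d * E ≡⟨ ℚₚ.*-comm d E ⟩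
                 E * d ≡⟨ Ed≡½e ⟩
                 ½ * e ∎)
               (ℚₚ.≤-trans (sum-gap (x≤K m) (ℕₚ.≤⇒≤′ m≤n))
                 (tail (ℕₚ.≤-trans (ℕₚ.m≤n⊔m N₁ N₂) N≤m) m≤n)) ⟩
        ½ * e + ½ * e ≡⟨ half+half e ⟩
        e             ∎
        where
        N₁≤m = ℕₚ.≤-trans (ℕₚ.m≤m⊔n N₁ N₂) N≤m

      both : ∀ {m n} → N₁ ℕ.⊔ N₂ ℕ.≤ m → N₁ ℕ.⊔ N₂ ℕ.≤ n →
             ∣ expSum (x m) m - expSum (x n) n ∣ ≤ e
      both {m} {n} N≤m N≤n with ℕₚ.≤-total m n
      ... | inj₂ n≤m = ordered N≤n n≤m
      ... | inj₁ m≤n =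
        subst (_≤ e) (∣-∣-sym (expSum (x n) n) (expSum (x m) m)) (ordered N≤m m≤n)

record ℝ : Set where
  field
    seq    : ℕ → ℚ
    cauchy : ∀ {e} → 0ℚ Rat.< e → ∃ λ N → ∀ {m n} → N ℕ.≤ m → N ℕ.≤ n →
             Rat.∣ seq m Rat.- seq n ∣ Rat.≤ e

open ℝ public

infix 4 _≈_ _≤_ _<_

-- Equality of reals is this relation, not _≡_.
_≈_ : Rel ℝ 0ℓ
x ≈ y = ∀ {e} → 0ℚ Rat.< e → ∃ λ N → ∀ {n} → N ℕ.≤ n →
        Rat.∣ seq x n Rat.- seq y n ∣ Rat.≤ e

_≤_ : Rel ℝ 0ℓ
x ≤ y = ∀ {e} → 0ℚ Rat.< e → ∃ λ N → ∀ {n} → N ℕ.≤ n →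
        seq x n Rat.≤ seq y n Rat.+ e

_<_ : Rel ℝ 0ℓ
x < y = ∃ λ e → 0ℚ Rat.< e × ∃ λ N → ∀ {n} → N ℕ.≤ n →
        seq x n Rat.+ e Rat.≤ seq y n

fromℚ : ℚ → ℝ
fromℚ q = record
  { seq    = λ _ → q
  ; cauchy = λ {e} 0<e → 0 , λ _ _ →
      subst (Rat._≤ e) (sym (cong Rat.∣_∣ (ℚₚ.+-inverseʳ q))) (ℚₚ.<⇒≤ 0<e)
  }

0ℝ 1ℝ : ℝ
0ℝ = fromℚ 0ℚ
1ℝ = fromℚ 1ℚ

module ℝ-Bounds where
  open Rat using (_+_; _-_; ∣_∣)
  open ℚ-Lemmas

  prefixBound : (ℕ → ℚ) → ℕ → ℚ
  prefixBound x zero    = 1ℚ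
  prefixBound x (suc N) = ∣ x N ∣ + prefixBound x N

  0<prefixBound : ∀ x N → 0ℚ Rat.< prefixBound x N
  0<prefixBound x zero    = 0<1
  0<prefixBound x (suc N) = ℚₚ.<-≤-trans (0<prefixBound x N) (p≤q+p (ℚₚ.0≤∣p∣ (x N)))

  ≤prefixBound : ∀ x {n N} → suc n ℕ.≤′ N → ∣ x n ∣ Rat.≤ prefixBound x N
  ≤prefixBound x {n} ℕ.≤′-refl = p≤p+q (ℚₚ.<⇒≤ (0<prefixBound x n))
  ≤prefixBound x (ℕ.≤′-step {n = N} n<N) =
    ℚₚ.≤-trans (≤prefixBound x n<N) (p≤q+p (ℚₚ.0≤∣p∣ (x N)))

  opaque
    bounded : ∀ x → ∃ λ B → 0ℚ Rat.< B × ∀ n → ∣ seq x n ∣ Rat.≤ B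
    bounded x with cauchy x 0<1
    ... | N , close = b + 1ℚ , ℚₚ.<-≤-trans (0<prefixBound (seq x) (suc N)) (p≤p+q 0≤1) , bound
      where
      b : ℚ
      b = prefixBound (seq x) (suc N)
      bound : ∀ n → ∣ seq x n ∣ Rat.≤ b + 1ℚ
      bound n with ℕₚ.≤-total n N
      ... | inj₁ n≤N = ℚₚ.≤-trans
        (≤prefixBound (seq x) (ℕₚ.≤⇒≤′ (ℕ.s≤s n≤N))) (p≤p+q 0≤1)
      ... | inj₂ N≤n = ℚₚ.≤-trans (∣∣-lower (seq x n) (seq x N))
        (ℚₚ.+-mono-≤ (≤prefixBound (seq x) (ℕₚ.≤⇒≤′ (ℕₚ.≤-refl {suc N})))
                     (close N≤n ℕₚ.≤-refl))

module ℝ-Operations where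
  open Rat using (_+_; _*_; _-_; -_; ∣_∣; nonNegative)
  open ℚₚ.≤-Reasoning
  open +-*-Solver
  open ℚ-Lemmas
  open ℝ-Bounds

  private
    Cauchy : (ℕ → ℚ) → Set
    Cauchy x = ∀ {e} → 0ℚ Rat.< e → ∃ λ N → ∀ {m n} → N ℕ.≤ m → N ℕ.≤ n →
               ∣ x m - x n ∣ Rat.≤ e

  +-cauchy : ∀ x y → Cauchy (λ n → seq x n + seq y n)
  +-cauchy x y {e} 0<e with cauchy x (half-pos 0<e) | cauchy y (half-pos 0<e)
  ... | M , closeˣ | N , closeʸ = M ℕ.⊔ N , λ {m} {n} ≤m ≤n → begin
    ∣ (seq x m + seq y m) - (seq x n + seq y n) ∣
      ≡⟨ cong ∣_∣ (solve 4 (λ a b c d → (a :+ b) :- (c :+ d) := (a :- c) :+ (b :- d)) refl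
           (seq x m) (seq y m) (seq x n) (seq y n)) ⟩
    ∣ (seq x m - seq x n) + (seq y m - seq y n) ∣
      ≤⟨ ℚₚ.∣p+q∣≤∣p∣+∣q∣ (seq x m - seq x n) (seq y m - seq y n) ⟩
    ∣ seq x m - seq x n ∣ + ∣ seq y m - seq y n ∣
      ≤⟨ ℚₚ.+-mono-≤ (closeˣ (ℕₚ.m⊔n≤o⇒m≤o M N ≤m) (ℕₚ.m⊔n≤o⇒m≤o M N ≤n))
                     (closeʸ (ℕₚ.m⊔n≤o⇒n≤o M N ≤m) (ℕₚ.m⊔n≤o⇒n≤o M N ≤n)) ⟩
    ½ * e + ½ * e ≡⟨ half+half e ⟩
    e             ∎

  neg-cauchy : ∀ x → Cauchy (λ n → - seq x n)
  neg-cauchy x {e} 0<e with cauchy x 0<e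
  ... | N , close = N , λ {m} {n} ≤m ≤n → begin
    ∣ - seq x m - - seq x n ∣
      ≡⟨ cong ∣_∣ (solve 2 (λ a b → :- a :- (:- b) := b :- a) refl (seq x m) (seq x n)) ⟩
    ∣ seq x n - seq x m ∣ ≤⟨ close ≤n ≤m ⟩
    e                     ∎

  *-cauchy : ∀ x y → Cauchy (λ n → seq x n * seq y n)
  *-cauchy x y {e} 0<e with bounded x | bounded y
  ... | A , 0<A , x≤A | B , 0<B , y≤B with shrink 0<A (half-pos 0<e) | shrink 0<B (half-pos 0<e)
  ... | a , 0<a , Aa≡ | b , 0<b , Bb≡ with cauchy y 0<a | cauchy x 0<b
  ... | M , closeʸ | N , closeˣ = M ℕ.⊔ N , λ {m} {n} ≤m ≤n → begin
    ∣ seq x m * seq y m - seq x n * seq y n ∣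
      ≡⟨ cong ∣_∣ (solve 4 (λ x y x′ y′ → x :* y :- x′ :* y′
                                    := x :* (y :- y′) :+ y′ :* (x :- x′)) refl
           (seq x m) (seq y m) (seq x n) (seq y n)) ⟩
    ∣ seq x m * (seq y m - seq y n) + seq y n * (seq x m - seq x n) ∣
      ≤⟨ ℚₚ.∣p+q∣≤∣p∣+∣q∣ (seq x m * (seq y m - seq y n)) (seq y n * (seq x m - seq x n)) ⟩
    ∣ seq x m * (seq y m - seq y n) ∣ + ∣ seq y n * (seq x m - seq x n) ∣
      ≡⟨ cong₂ _+_ (ℚₚ.∣p*q∣≡∣p∣*∣q∣ (seq x m) (seq y m - seq y n))
                   (ℚₚ.∣p*q∣≡∣p∣*∣q∣ (seq y n) (seq x m - seq x n)) ⟩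
    ∣ seq x m ∣ * ∣ seq y m - seq y n ∣ + ∣ seq y n ∣ * ∣ seq x m - seq x n ∣
      ≤⟨ ℚₚ.+-mono-≤
           (*-mono-≤ (ℚₚ.0≤∣p∣ (seq x m)) (x≤A m) (ℚₚ.0≤∣p∣ (seq y m - seq y n))
             (closeʸ (ℕₚ.m⊔n≤o⇒m≤o M N ≤m) (ℕₚ.m⊔n≤o⇒m≤o M N ≤n)))
           (*-mono-≤ (ℚₚ.0≤∣p∣ (seq y n)) (y≤B n) (ℚₚ.0≤∣p∣ (seq x m - seq x n))
             (closeˣ (ℕₚ.m⊔n≤o⇒n≤o M N ≤m) (ℕₚ.m⊔n≤o⇒n≤o M N ≤n))) ⟩
    A * a + B * b ≡⟨ cong₂ _+_ Aa≡ Bb≡ ⟩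
    ½ * e + ½ * e ≡⟨ half+half e ⟩
    e             ∎

  abs-cauchy : ∀ x → Cauchy (λ n → ∣ seq x n ∣)
  abs-cauchy x 0<e with cauchy x 0<e
  ... | N , close = N , λ {m} {n} ≤m ≤n →
    ℚₚ.≤-trans (∣∣-contract (seq x m) (seq x n)) (close ≤m ≤n)

  exp-cauchy : ∀ x → Cauchy (λ n → ExpSeries.expSum (seq x n) n)
  exp-cauchy x with bounded x
  ... | K , 0<K , x≤K = ExpSeries.expSum-cauchy 0<K (seq x) x≤K (cauchy x)

open ℝ-Operations

infix  8 -_
infixl 7 _*_
infixl 6 _+_ _-_

_+_ _*_ : ℝ → ℝ → ℝ
x + y = record { seq = λ n → seq x n Rat.+ seq y n ; cauchy = +-cauchy x y }
x * y = record { seq = λ n → seq x n Rat.* seq y n ; cauchy = *-cauchy x y }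

-_ : ℝ → ℝ
- x = record { seq = λ n → Rat.- seq x n ; cauchy = neg-cauchy x }

∣_∣ : ℝ → ℝ
∣ x ∣ = record { seq = λ n → Rat.∣ seq x n ∣ ; cauchy = abs-cauchy x }

_-_ : ℝ → ℝ → ℝ
x - y = x + - y

-- The diagonal of the partial sums: n ↦ Σ_{k<n} x_n^k / k!, where x_n is
-- the n-th rational approximation of x.
exp : ℝ → ℝ
exp x = record
  { seq = λ n → ExpSeries.expSum (seq x n) n ; cauchy = exp-cauchy x }

-- ℓ = ln y.  Since exp is a strictly increasing bijection onto the positive
-- reals, such an ℓ exists and is unique (up to ≈) for each y > 0.
IsLn : ℝ → ℝ → Set
IsLn y ℓ = exp ℓ ≈ y

Matrix : Set → ℕ → Set
Matrix A n = Fin n → Fin n → A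

sumℚ : ∀ {n} → (Fin n → ℚ) → ℚ
sumℚ = RawMonoidDefinitions.sum Rat.+-0-rawMonoid

+-0-rawMonoidℝ : RawMonoid 0ℓ 0ℓ
+-0-rawMonoidℝ = record { Carrier = ℝ ; _≈_ = _≈_ ; _∙_ = _+_ ; ε = 0ℝ }

sumℝ : ∀ {n} → (Fin n → ℝ) → ℝ
sumℝ = RawMonoidDefinitions.sum +-0-rawMonoidℝ

record SimpleGraph (n : ℕ) : Set₁ where
  field
    _~_    : Rel (Fin n) 0ℓ
    _~?_   : Decidable _~_
    symm   : Symmetric _~_
    irrefl : Irreflexive _≡_ _~_

  Connected : Set
  Connected = ∀ u v → Star _~_ u v

  degree : Fin n → ℕ
  degree v = List.length (filter (v ~?_) (allFin n))

-- a/b with the convention a/0 = 0.  In a connected graph with at least two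
-- vertices every denominator below is positive; on a single vertex the simple
-- random walk is not defined.
_over_ : ℕ → ℕ → ℚ
a over zero  = 0ℚ
a over suc b = + a Rat./ suc b

identity : ∀ {n} → Matrix ℚ n
identity x y = if does (x Fin.≟ y) then 1ℚ else 0ℚ

module RandomWalk {n : ℕ} (G : SimpleGraph n) where
  open SimpleGraph G

  P : Matrix ℚ n
  P x y = if does (x ~? y) then 1 over degree x else 0ℚ

  π : Fin n → ℚ
  π v = degree v over RawMonoidDefinitions.sum ℕ.+-0-rawMonoid degree

  lazyP : Matrix ℚ n
  lazyP x y = ½ Rat.* (identity x y Rat.+ P x y)

  lazyStep : ℕ → Matrix ℚ n
  lazyStep zero    = identity
  lazyStep (suc t) x y = sumℚ λ z → lazyP x z Rat.* lazyStep t z y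

  tvFrom : ℕ → Fin n → ℚ
  tvFrom t x = ½ Rat.* sumℚ λ y → Rat.∣ lazyStep t x y Rat.- π y ∣

  -- The maximum over x; the values are nonnegative, so starting at 0 is harmless.
  maxTV : ℕ → ℚ
  maxTV t = Vector.foldr Rat._⊔_ 0ℚ (tvFrom t)

  Mixed : ℕ → Set
  Mixed t = 1 ℕ.≤ t × maxTV t Rat.≤ + 1 Rat./ 4

  IsMixingTime : ℕ → Set
  IsMixingTime t = Mixed t × (∀ s → Mixed s → t ℕ.≤ s)

record IsStrategy {n} (G : SimpleGraph n) (B : Matrix ℝ n) : Set where
  open SimpleGraph G
  field
    nonneg    : ∀ x y → 0ℝ ≤ B x y
    rowSum    : ∀ x → sumℝ (B x) ≈ 1ℝ
    supported : ∀ x y → ¬ (x ~ y) → B x y ≈ 0ℝ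

biasedWalk : ∀ {n} → SimpleGraph n → ℝ → Matrix ℝ n → Matrix ℝ n
biasedWalk G ε B x y = (1ℝ - ε) * fromℚ (RandomWalk.P G x y) + ε * B x y

record IsStationary {n} (Q : Matrix ℝ n) (μ : Fin n → ℝ) : Set where
  field
    nonneg  : ∀ x → 0ℝ ≤ μ x
    total   : sumℝ μ ≈ 1ℝ
    balance : ∀ y → sumℝ (λ x → μ x * Q x y) ≈ μ y

IsStationaryDistribution : ∀ {n} → Matrix ℝ n → (Fin n → ℝ) → Set
IsStationaryDistribution Q μ =
  IsStationary Q μ × (∀ ν → IsStationary Q ν → ∀ x → ν x ≈ μ x)

{-# OPTIONS --safe #-}
module Submission where

open import Algebra.Bundles using (CommutativeRing)
import Algebra.Definitions.RawMonoid as RawMonoidDefinitions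
import Algebra.Properties.Semiring.Sum as SemiringSum
import Algebra.Solver.Ring as RingSolver
import Algebra.Solver.Ring.AlmostCommutativeRing as ACR
open import Data.Bool.Base using (true; false; if_then_else_)
open import Data.Empty using (⊥; ⊥-elim)
open import Data.Fin.Base using (Fin; zero; suc)
import Data.Fin.Properties as Fin
import Data.Integer.Base as ℤ
import Data.Integer.Properties as ℤₚ
open import Data.List.Base using (filter; tabulate; length)
open import Data.Maybe.Base using (just; nothing)
open import Data.Nat.Base as ℕ using (ℕ; zero; suc)
import Data.Nat.Properties as ℕₚ
open import Data.Product.Base using (∃; _×_; _,_; proj₁; proj₂)
open import Data.Rational.Base as Rat using (ℚ; 0ℚ; 1ℚ; ½; _/_)
import Data.Rational.Properties as ℚₚ
open import Data.Rational.Solver using (module +-*-Solver)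
import Data.Rational.Unnormalised.Base as ℚᵘ
import Data.Rational.Unnormalised.Properties as ℚᵘₚ
open import Data.Sum.Base using (_⊎_; inj₁; inj₂)
import Data.Vec.Functional as Vector
open import Level using (0ℓ)
open import Relation.Binary.Bundles using (Poset)
open import Relation.Binary.Construct.Closure.ReflexiveTransitive as Star using (Star; _◅_) renaming (ε to [])
open import Relation.Binary.Core using (Rel)
open import Relation.Binary.Definitions using (WeaklyDecidable)
open import Relation.Binary.PropositionalEquality as ≡ using (_≡_)
import Relation.Binary.Reasoning.PartialOrder as PartialOrderReasoning
open import Relation.Binary.Structures using (IsEquivalence)
open import Relation.Nullary using (¬_; Dec; yes; no; does)
open import Relation.Unary using (Pred; Decidable)
open import Defs using
  ( fromℕ; recip; sumℚ; identity; _over_; SimpleGraph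
  ; module ℚ-Lemmas; module ExpSeries; module RandomWalk )

-- Write s = 1 - ε and t for the mixing time.  Total variation distance at most 1/4 gives
-- p̃⁽²ᵗ⁾(x,v) ≥ π(v)/2 for every x, by reversibility and ab ≥ c (a ⊓ c + b ⊓ c - c).  Hence for a rational
-- E > 1 the discounted hitting probability h(x) = E[E^(-τ) ; τ ≤ 2t] of v under the simple random walk
-- satisfies h ≥ E^(-2t) π(v)/2 everywhere and P h ≥ E h off v.  The controller always moves to the neighbour
-- with the largest h.  Convexity of exp (weighted AM-GM between the average of h and its maximum over the
-- neighbours) then gives Q g ≥ E^s g off v for g = h^s, so stationarity of μ forces
-- μ(v) ≥ (s ln E) min g ≥ s L (π(v)/2)^s e^(-2 s t L) with L = ln E.  With E chosen such that
-- 2/5 ≤ s t L ≤ 1/2, this is at least π(v)^s / (16 t).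

-- The order of the reals is undecidable, so a neighbour with the largest value of a real function
-- could not be selected by comparison. This is why `E` is rational: the hitting probability h,
-- truncated to finitely many steps, is then rational too, and the greedy choice is a decidable
-- comparison. In exchange L = ln E cannot be prescribed, only confined to an interval. Up to
-- factors that do not involve L, the final bound is x e^(-2x) with x = s t L. This is largest at x
-- = 1/2, where the bound becomes π(v)^s / (4 e t); since 4e < 11, the constant 16 leaves room for
-- the whole interval from 2/5 to 1/2. The conclusion also asks that the stationary distribution of
-- Q exist and be unique, although Q has real entries. Both come from eliminating states one at a
-- time, which divides only by quantities with a known positive rational lower bound. The walk
-- argument runs over an abstract ordered field with an exponential; completeness of the reals
-- enters only in the construction of exp and ln.

private module ℚS = +-*-Solver

-- Ordered fields

-- The interface to the reals for the walk argument. It contains no completeness: real logarithms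
-- are a separate hypothesis later on. `inverse` asks for a rational lower bound because that is the
-- data from which a reciprocal can be computed.
record ArchimedeanField : Set₁ where
  field
    commutativeRing : CommutativeRing 0ℓ 0ℓ
  open CommutativeRing commutativeRing public hiding (zero)
  infix 4 _≤_
  field
    _≤_         : Rel Carrier 0ℓ
    ≤-reflexive : ∀ {x y} → x ≈ y → x ≤ y
    ≤-trans     : ∀ {x y z} → x ≤ y → y ≤ z → x ≤ z
    ≤-antisym   : ∀ {x y} → x ≤ y → y ≤ x → x ≈ y
    +-mono-≤    : ∀ {x y u v} → x ≤ y → u ≤ v → x + u ≤ y + v
    *-nonneg    : ∀ {x y} → 0# ≤ x → 0# ≤ y → 0# ≤ x * y
    fromℚ       : ℚ → Carrier
    fromℚ-+     : ∀ p q → fromℚ (p Rat.+ q) ≈ fromℚ p + fromℚ q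
    fromℚ-*     : ∀ p q → fromℚ (p Rat.* q) ≈ fromℚ p * fromℚ q
    fromℚ-neg   : ∀ p → fromℚ (Rat.- p) ≈ - fromℚ p
    fromℚ-0     : fromℚ 0ℚ ≈ 0#
    fromℚ-1     : fromℚ 1ℚ ≈ 1#
    fromℚ-mono  : ∀ {p q} → p Rat.≤ q → fromℚ p ≤ fromℚ q
    fromℚ-cancel : ∀ {p q} → fromℚ p ≤ fromℚ q → p Rat.≤ q
    ≤-limit     : ∀ {x y} → (∀ {e} → 0ℚ Rat.< e → x ≤ y + fromℚ e) → x ≤ y
    approximate : ∀ x {e} → 0ℚ Rat.< e → ∃ λ q → fromℚ q ≤ x × x ≤ fromℚ (q Rat.+ e)
    inverse     : ∀ {x q} → 0ℚ Rat.< q → fromℚ q ≤ x → ∃ λ y → x * y ≈ 1#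

module FieldProperties (F : ArchimedeanField) where
  open ArchimedeanField F public
  open import Algebra.Properties.Semiring.Sum semiring public
    using (sum; sum-cong-≋; ∑-distrib-+; ∑-comm; *-distribˡ-sum; *-distribʳ-sum)

  -- fromℚ, adjusted so that the solver constants con 0ℚ and con 1ℚ denote 0# and 1#.
  ⟪_⟫ : ℚ → Carrier
  ⟪ q ⟫ with q ℚₚ.≟ 0ℚ | q ℚₚ.≟ 1ℚ
  ... | yes _ | _     = 0#
  ... | no _  | yes _ = 1#
  ... | no _  | no _  = fromℚ q

  ⟪⟫≈fromℚ : ∀ q → ⟪ q ⟫ ≈ fromℚ q
  ⟪⟫≈fromℚ q with q ℚₚ.≟ 0ℚ | q ℚₚ.≟ 1ℚ
  ... | yes ≡.refl | _          = sym fromℚ-0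
  ... | no _       | yes ≡.refl = sym fromℚ-1
  ... | no _       | no _       = refl

  ⟪⟫-homomorphism : CommutativeRing.rawRing ℚₚ.+-*-commutativeRing
    ACR.-Raw-AlmostCommutative⟶ ACR.fromCommutativeRing commutativeRing
  ⟪⟫-homomorphism = record
    { ⟦_⟧    = ⟪_⟫
    ; +-homo = λ p q → trans (⟪⟫≈fromℚ _) (trans (fromℚ-+ p q)
        (sym (+-cong (⟪⟫≈fromℚ p) (⟪⟫≈fromℚ q))))
    ; *-homo = λ p q → trans (⟪⟫≈fromℚ _) (trans (fromℚ-* p q)
        (sym (*-cong (⟪⟫≈fromℚ p) (⟪⟫≈fromℚ q))))
    ; -‿homo = λ p → trans (⟪⟫≈fromℚ _) (trans (fromℚ-neg p) (sym (-‿cong (⟪⟫≈fromℚ p))))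
    ; 0-homo = refl
    ; 1-homo = refl }

  ⟪⟫-≟ : WeaklyDecidable (ACR.Induced-equivalence ⟪⟫-homomorphism)
  ⟪⟫-≟ p q with p ℚₚ.≟ q
  ... | yes ≡.refl = just refl
  ... | no _       = nothing

  open RingSolver (CommutativeRing.rawRing ℚₚ.+-*-commutativeRing)
    (ACR.fromCommutativeRing commutativeRing) ⟪⟫-homomorphism ⟪⟫-≟ public
    using (solve; _:=_; _:+_; _:*_; _:-_; :-_; con)

  ≤-refl : ∀ {x} → x ≤ x
  ≤-refl = ≤-reflexive refl

  ≤-poset : Poset 0ℓ 0ℓ 0ℓ
  ≤-poset = record
    { Carrier = Carrier ; _≈_ = _≈_ ; _≤_ = _≤_
    ; isPartialOrder = record
      { isPreorder = record
        { isEquivalence = isEquivalence ; reflexive = ≤-reflexive ; trans = ≤-trans }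
      ; antisym = ≤-antisym } }

  module ≤-Reasoning = PartialOrderReasoning ≤-poset
  open ≤-Reasoning

  infix 4 _<_
  -- A strict inequality carries a rational gap. The gap is what `inverse` consumes and what sets
  -- the precision of the comparison in `<-cotrans`.
  _<_ : Rel Carrier 0ℓ
  x < y = ∃ λ q → 0ℚ Rat.< q × x + fromℚ q ≤ y

  opaque
    x≤y⇒0≤y-x : ∀ {x y} → x ≤ y → 0# ≤ y - x
    x≤y⇒0≤y-x {x} {y} x≤y = begin
      0#    ≈⟨ -‿inverseʳ x ⟨
      x - x ≤⟨ +-mono-≤ x≤y ≤-refl ⟩
      y - x ∎

    ≤-by : ∀ {x y d} → 0# ≤ d → x + d ≈ y → x ≤ y
    ≤-by {x} {y} {d} 0≤d x+d≈y = begin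
      x      ≈⟨ +-identityʳ x ⟨
      x + 0# ≤⟨ +-mono-≤ ≤-refl 0≤d ⟩
      x + d  ≈⟨ x+d≈y ⟩
      y      ∎

    *-monoˡ-≤ : ∀ {x y z} → 0# ≤ z → x ≤ y → z * x ≤ z * y
    *-monoˡ-≤ {x} {y} {z} 0≤z x≤y = ≤-by (*-nonneg 0≤z (x≤y⇒0≤y-x x≤y))
      (solve 3 (λ x y z → z :* x :+ z :* (y :- x) := z :* y) refl x y z)

    *-monoʳ-≤ : ∀ {x y z} → 0# ≤ z → x ≤ y → x * z ≤ y * z
    *-monoʳ-≤ {x} {y} {z} 0≤z x≤y = begin
      x * z ≈⟨ *-comm x z ⟩
      z * x ≤⟨ *-monoˡ-≤ 0≤z x≤y ⟩
      z * y ≈⟨ *-comm z y ⟩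
      y * z ∎

    *-mono-≤ : ∀ {a b c d} → 0# ≤ a → a ≤ b → 0# ≤ c → c ≤ d → a * c ≤ b * d
    *-mono-≤ 0≤a a≤b 0≤c c≤d =
      ≤-trans (*-monoˡ-≤ 0≤a c≤d) (*-monoʳ-≤ (≤-trans 0≤c c≤d) a≤b)

    neg-mono-≤ : ∀ {x y} → x ≤ y → - y ≤ - x
    neg-mono-≤ {x} {y} x≤y = ≤-by (x≤y⇒0≤y-x x≤y)
      (solve 2 (λ x y → :- y :+ (y :- x) := :- x) refl x y)

    +-cancelʳ-≤ : ∀ {x y} z → x + z ≤ y + z → x ≤ y
    +-cancelʳ-≤ {x} {y} z le = begin
      x           ≈⟨ solve 2 (λ x z → x := (x :+ z) :- z) refl x z ⟩
      (x + z) - z ≤⟨ +-mono-≤ le ≤-refl ⟩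
      (y + z) - z ≈⟨ solve 2 (λ x z → (x :+ z) :- z := x) refl y z ⟩
      y           ∎

    0≤fromℚ : ∀ {q} → 0ℚ Rat.≤ q → 0# ≤ fromℚ q
    0≤fromℚ 0≤q = ≤-trans (≤-reflexive (sym fromℚ-0)) (fromℚ-mono 0≤q)

    0≤1# : 0# ≤ 1#
    0≤1# = ≤-trans (0≤fromℚ ℚ-Lemmas.0≤1) (≤-reflexive fromℚ-1)

    <⇒≤ : ∀ {x y} → x < y → x ≤ y
    <⇒≤ (q , 0<q , le) = ≤-trans (≤-by (0≤fromℚ (ℚₚ.<⇒≤ 0<q)) refl) le

    <-≤-trans : ∀ {x y z} → x < y → y ≤ z → x < z
    <-≤-trans (q , 0<q , le) y≤z = q , 0<q , ≤-trans le y≤z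

    fromℚ-pos : ∀ {q} → 0ℚ Rat.< q → 0# < fromℚ q
    fromℚ-pos 0<q = _ , 0<q , ≤-reflexive (+-identityˡ _)

    0<1# : 0# < 1#
    0<1# = <-≤-trans (fromℚ-pos ℚ-Lemmas.0<1) (≤-reflexive fromℚ-1)

    <⇒≱ : ∀ {x y} → x < y → ¬ (y ≤ x)
    <⇒≱ {x} {y} (q , 0<q , le) y≤x =
      ℚₚ.<-irrefl ≡.refl (ℚₚ.<-≤-trans 0<q (fromℚ-cancel (begin
        fromℚ q           ≈⟨ solve 2 (λ x q → q := (x :+ q) :- x) refl x (fromℚ q) ⟩
        (x + fromℚ q) - x ≤⟨ +-mono-≤ (≤-trans le y≤x) ≤-refl ⟩
        x - x             ≈⟨ -‿inverseʳ x ⟩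
        0#                ≈⟨ fromℚ-0 ⟨
        fromℚ 0ℚ          ∎)))

    -- The constructive substitute for trichotomy. Both `x` and `z` are known up to a quarter `t` of
    -- the gap `q`. If the rational lower end of `z` exceeds that of `x` by at least 2t, then `z` is
    -- above `x` by `t`; otherwise `z` stays below `y` by `t`.
    <-cotrans : ∀ {x y} z → x < y → x < z ⊎ z < y
    <-cotrans {x} {y} z (q , 0<q , x+q≤y) = compare (approximate x 0<t) (approximate z 0<t)
      where
      t : ℚ
      t = ½ Rat.* (½ Rat.* q)
      0<t : 0ℚ Rat.< t
      0<t = ℚ-Lemmas.half-pos (ℚ-Lemmas.half-pos 0<q)
      four : ∀ a → (((a Rat.+ t) Rat.+ t) Rat.+ t) Rat.+ t ≡ a Rat.+ q
      four a = ℚS.solve 2 (λ a q →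
        (((a ℚS.:+ ℚS.con ½ ℚS.:* (ℚS.con ½ ℚS.:* q)) ℚS.:+ ℚS.con ½ ℚS.:* (ℚS.con ½ ℚS.:* q))
          ℚS.:+ ℚS.con ½ ℚS.:* (ℚS.con ½ ℚS.:* q)) ℚS.:+ ℚS.con ½ ℚS.:* (ℚS.con ½ ℚS.:* q)
        ℚS.:= a ℚS.:+ q) ≡.refl a q
      compare : (∃ λ a → fromℚ a ≤ x × x ≤ fromℚ (a Rat.+ t)) →
                (∃ λ b → fromℚ b ≤ z × z ≤ fromℚ (b Rat.+ t)) → x < z ⊎ z < y
      compare (a , a≤x , x≤a+t) (b , b≤z , z≤b+t) with (a Rat.+ t) Rat.+ t ℚₚ.≤? b
      ... | yes a+2t≤b = inj₁ (t , 0<t , (begin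
        x + fromℚ t                    ≤⟨ +-mono-≤ x≤a+t ≤-refl ⟩
        fromℚ (a Rat.+ t) + fromℚ t    ≈⟨ fromℚ-+ (a Rat.+ t) t ⟨
        fromℚ ((a Rat.+ t) Rat.+ t)    ≤⟨ fromℚ-mono a+2t≤b ⟩
        fromℚ b                        ≤⟨ b≤z ⟩
        z                              ∎))
      ... | no a+2t≰b = inj₂ (t , 0<t , (begin
        z + fromℚ t                 ≤⟨ +-mono-≤ z≤b+t ≤-refl ⟩
        fromℚ (b Rat.+ t) + fromℚ t ≈⟨ fromℚ-+ (b Rat.+ t) t ⟨
        fromℚ ((b Rat.+ t) Rat.+ t) ≤⟨ fromℚ-mono (ℚₚ.≤-trans
          (ℚₚ.+-monoˡ-≤ t (ℚₚ.+-monoˡ-≤ t (ℚₚ.<⇒≤ (ℚₚ.≰⇒> a+2t≰b))))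
          (ℚₚ.≤-reflexive (four a))) ⟩
        fromℚ (a Rat.+ q)           ≈⟨ fromℚ-+ a q ⟩
        fromℚ a + fromℚ q           ≤⟨ +-mono-≤ a≤x ≤-refl ⟩
        x + fromℚ q                 ≤⟨ x+q≤y ⟩
        y                           ∎))

    -- Comparing `y` with the pair `x` and `x + fromℚ e` leaves only the upper alternative, and
    -- `≤-limit` removes `e`. Weak inequalities may therefore be proved by contradiction, which
    -- replaces case distinctions on signs.
    ≮⇒≥ : ∀ {x y} → ¬ (x < y) → y ≤ x
    ≮⇒≥ {x} {y} x≮y = ≤-limit bound
      where
      bound : ∀ {e} → 0ℚ Rat.< e → y ≤ x + fromℚ e
      bound {e} 0<e with <-cotrans {x} {x + fromℚ e} y (e , 0<e , ≤-refl)
      ... | inj₁ x<y = ⊥-elim (x≮y x<y)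
      ... | inj₂ y<x+e = <⇒≤ y<x+e

    <-dense : ∀ {x y} → x < y → ∃ λ r → x ≤ fromℚ r × fromℚ r ≤ y
    <-dense {x} {y} (q , 0<q , x+q≤y) with approximate x 0<q
    ... | a , a≤x , x≤a+q = a Rat.+ q , x≤a+q , (begin
      fromℚ (a Rat.+ q) ≈⟨ fromℚ-+ a q ⟩
      fromℚ a + fromℚ q ≤⟨ +-mono-≤ a≤x ≤-refl ⟩
      x + fromℚ q       ≤⟨ x+q≤y ⟩
      y                 ∎)

    *-pos : ∀ {x y} → 0# < x → 0# < y → 0# < x * y
    *-pos {x} {y} (p , 0<p , 0+p≤x) (q , 0<q , 0+q≤y) = p Rat.* q , ℚ-Lemmas.*-pos 0<p 0<q , (begin
      0# + fromℚ (p Rat.* q) ≈⟨ +-identityˡ _ ⟩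
      fromℚ (p Rat.* q)      ≈⟨ fromℚ-* p q ⟩
      fromℚ p * fromℚ q      ≤⟨ *-mono-≤ (0≤fromℚ (ℚₚ.<⇒≤ 0<p)) (drop 0+p≤x)
                                          (0≤fromℚ (ℚₚ.<⇒≤ 0<q)) (drop 0+q≤y) ⟩
      x * y                  ∎)
      where
      drop : ∀ {a b} → 0# + a ≤ b → a ≤ b
      drop = ≤-trans (≤-reflexive (sym (+-identityˡ _)))

    +-pos-nonneg : ∀ {x y} → 0# < x → 0# ≤ y → 0# < x + y
    +-pos-nonneg 0<x 0≤y = <-≤-trans 0<x (≤-by 0≤y refl)

    x<y⇒0<y-x : ∀ {x y} → x < y → 0# < y - x
    x<y⇒0<y-x {x} {y} (q , 0<q , le) = q , 0<q , (begin
      0# + fromℚ q      ≈⟨ solve 2 (λ x q → con 0ℚ :+ q := (x :+ q) :- x) refl x (fromℚ q) ⟩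
      (x + fromℚ q) - x ≤⟨ +-mono-≤ le ≤-refl ⟩
      y - x             ∎)

    inverse-nonneg : ∀ {x y} → 0# < x → x * y ≈ 1# → 0# ≤ y
    inverse-nonneg {x} {y} 0<x xy≈1 = ≮⇒≥ λ y<0 → <⇒≱ 0<1# (begin
      1#               ≈⟨ xy≈1 ⟨
      x * y            ≈⟨ solve 2 (λ x y → x :* y := :- (x :* (con 0ℚ :- y))) refl x y ⟩
      - (x * (0# - y)) ≤⟨ neg-mono-≤ (<⇒≤ (*-pos 0<x (x<y⇒0<y-x y<0))) ⟩
      - 0#             ≈⟨ solve 0 (:- con 0ℚ := con 0ℚ) refl ⟩
      0#               ∎)

    inverse-lower : ∀ {x y b r} → 0# ≤ y → x * y ≈ 1# → x ≤ fromℚ b →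
      0ℚ Rat.< r → b Rat.* r ≡ 1ℚ → fromℚ r ≤ y
    inverse-lower {x} {y} {b} {r} 0≤y xy≈1 x≤b 0<r br≡1 = begin
      fromℚ r                 ≈⟨ *-identityˡ (fromℚ r) ⟨
      1# * fromℚ r            ≈⟨ *-congʳ xy≈1 ⟨
      (x * y) * fromℚ r       ≤⟨ *-monoʳ-≤ (0≤fromℚ (ℚₚ.<⇒≤ 0<r)) (*-monoʳ-≤ 0≤y x≤b) ⟩
      (fromℚ b * y) * fromℚ r
        ≈⟨ solve 3 (λ b y r → (b :* y) :* r := (b :* r) :* y) refl (fromℚ b) y (fromℚ r) ⟩
      (fromℚ b * fromℚ r) * y ≈⟨ *-congʳ (fromℚ-* b r) ⟨
      fromℚ (b Rat.* r) * y   ≈⟨ *-congʳ (trans (reflexive (≡.cong fromℚ br≡1)) fromℚ-1) ⟩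
      1# * y                  ≈⟨ *-identityˡ y ⟩
      y                       ∎

    -- `inverse` yields a reciprocal without a positive lower bound. A rational upper bound `b` of
    -- `x` supplies one, since 1/b then lies below the reciprocal.
    inverse-pos-bounded : ∀ {x} → 0# < x → (∃ λ y → x * y ≈ 1#) → (∃ λ b → 0ℚ Rat.< b × x ≤ fromℚ b) →
      ∃ λ y → 0# < y × x * y ≈ 1#
    inverse-pos-bounded 0<x (y , xy≈1) (b , 0<b , x≤b) with ℚ-Lemmas.shrink {b} 0<b {1ℚ} ℚ-Lemmas.0<1
    ... | r , 0<r , br≡1 = y , <-≤-trans (fromℚ-pos 0<r)
      (inverse-lower {b = b} {r = r} (inverse-nonneg 0<x xy≈1) xy≈1 x≤b 0<r br≡1) , xy≈1

    upper-bound : ∀ {x} → 0# < x → ∃ λ b → 0ℚ Rat.< b × x ≤ fromℚ b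
    upper-bound {x} (q , 0<q , 0+q≤x) with approximate x {q} 0<q
    ... | a , _ , x≤b = a Rat.+ q , ℚₚ.<-≤-trans 0<q (fromℚ-cancel {q} {a Rat.+ q}
      (≤-trans (≤-trans (≤-reflexive (sym (+-identityˡ (fromℚ q)))) 0+q≤x) x≤b)) , x≤b

    inverse-pos : ∀ {x} → 0# < x → ∃ λ y → 0# < y × x * y ≈ 1#
    inverse-pos {x} (q , 0<q , 0+q≤x) = inverse-pos-bounded (q , 0<q , 0+q≤x)
      (inverse {x} {q} 0<q (≤-trans (≤-reflexive (sym (+-identityˡ (fromℚ q)))) 0+q≤x))
      (upper-bound (q , 0<q , 0+q≤x))

    *-inverse-cancel : ∀ x {z w} → z * w ≈ 1# → x ≈ w * (z * x)
    *-inverse-cancel x {z} {w} zw≈1 = begin-equality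
      x           ≈⟨ *-identityˡ x ⟨
      1# * x      ≈⟨ *-congʳ zw≈1 ⟨
      (z * w) * x ≈⟨ solve 3 (λ x z w → (z :* w) :* x := w :* (z :* x)) refl x z w ⟩
      w * (z * x) ∎

    *-cancelˡ-≤ : ∀ {x y z} → 0# < z → z * x ≤ z * y → x ≤ y
    *-cancelˡ-≤ {x} {y} {z} 0<z zx≤zy = cancel (inverse-pos {z} 0<z)
      where
      cancel : (∃ λ w → 0# < w × z * w ≈ 1#) → x ≤ y
      cancel (w , 0<w , zw≈1) = begin
        x           ≈⟨ *-inverse-cancel x zw≈1 ⟩
        w * (z * x) ≤⟨ *-monoˡ-≤ {z * x} {z * y} {w} (<⇒≤ 0<w) zx≤zy ⟩
        w * (z * y) ≈⟨ *-inverse-cancel y zw≈1 ⟨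
        y           ∎

    sum-mono : ∀ {n} {f g : Fin n → Carrier} → (∀ i → f i ≤ g i) → sum f ≤ sum g
    sum-mono {zero}  f≤g = ≤-refl
    sum-mono {suc n} f≤g = +-mono-≤ (f≤g zero) (sum-mono (λ i → f≤g (suc i)))

    sum-zero : ∀ {n} {f : Fin n → Carrier} → (∀ i → f i ≈ 0#) → sum f ≈ 0#
    sum-zero {zero}  f≈0 = refl
    sum-zero {suc n} f≈0 = trans (+-cong (f≈0 zero) (sum-zero (λ i → f≈0 (suc i)))) (+-identityˡ 0#)

    sum-nonneg : ∀ {n} {f : Fin n → Carrier} → (∀ i → 0# ≤ f i) → 0# ≤ sum f
    sum-nonneg {n} 0≤f = ≤-trans (≤-reflexive (sym (sum-zero {n} (λ _ → refl)))) (sum-mono 0≤f)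

    term≤sum : ∀ {n} {f : Fin n → Carrier} → (∀ i → 0# ≤ f i) → ∀ i → f i ≤ sum f
    term≤sum 0≤f zero    = ≤-by (sum-nonneg (λ i → 0≤f (suc i))) refl
    term≤sum 0≤f (suc i) = ≤-trans (term≤sum (λ i → 0≤f (suc i)) i)
      (≤-by (0≤f zero) (+-comm _ _))

-- The exponential function

-- The functional equation and one tangent bound are the whole analytic input. The bound is asked
-- only strictly above -1, the range in which the partial sums of the series are shown to satisfy
-- it; halving the argument extends it to the rest of the line.
record Exponential (F : ArchimedeanField) : Set where
  open ArchimedeanField F
  field
    exp       : Carrier → Carrier
    exp-cong  : ∀ {x y} → x ≈ y → exp x ≈ exp y
    exp-+     : ∀ x y → exp (x + y) ≈ exp x * exp y
    1+x≤exp₀  : ∀ {x q} → 0ℚ Rat.< q → - 1# + fromℚ q ≤ x → 1# + x ≤ exp x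

module ExponentialProperties (F : ArchimedeanField) (X : Exponential F) where
  open FieldProperties F
  open Exponential X public
  open ≤-Reasoning

  half : Carrier
  half = ⟪ ½ ⟫

  quarter : Carrier
  quarter = ⟪ ½ Rat.* ½ ⟫

  opaque
    -- The sign of `x` is undecidable, so the claim is proved by contradiction: if the square were
    -- negative, then `x` could not be negative, hence would be nonnegative, and so would its
    -- square.
    square-nonneg : ∀ x → 0# ≤ x * x
    square-nonneg x = ≮⇒≥ λ x²<0 →
      let 0≤x = ≮⇒≥ {x} {0#} λ x<0 → <⇒≱ x²<0 (≤-trans (<⇒≤ (*-pos (x<y⇒0<y-x x<0) (x<y⇒0<y-x x<0)))
                  (≤-reflexive (solve 1 (λ x → (con 0ℚ :- x) :* (con 0ℚ :- x) := x :* x) refl x)))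
      in <⇒≱ x²<0 (*-nonneg 0≤x 0≤x)

    exp-halves : ∀ x → exp x ≈ exp (half * x) * exp (half * x)
    exp-halves x = trans
      (exp-cong (solve 1 (λ x → x := con ½ :* x :+ con ½ :* x) refl x)) (exp-+ _ _)

    exp-nonneg : ∀ x → 0# ≤ exp x
    exp-nonneg x = ≤-trans (square-nonneg (exp (half * x))) (≤-reflexive (sym (exp-halves x)))

    0≤half : 0# ≤ half
    0≤half = 0≤fromℚ (ℚₚ.<⇒≤ ℚ-Lemmas.0<½)

    0≤quarter : 0# ≤ quarter
    0≤quarter = 0≤fromℚ (ℚₚ.<⇒≤ (ℚ-Lemmas.*-pos ℚ-Lemmas.0<½ ℚ-Lemmas.0<½))

    private
      -2<-1 : - (1# + 1#) < - 1#
      -2<-1 = <-≤-trans (_ , ℚ-Lemmas.0<1 , ≤-refl)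
        (≤-reflexive (trans (+-congˡ fromℚ-1) (solve 0 (:- (con 1ℚ :+ con 1ℚ) :+ con 1ℚ := :- con 1ℚ) refl)))

    -- For x ≥ -2 the bound at x/2 ≥ -1 is squared; for x ≤ -1 it is trivial.
    1+x≤exp : ∀ x → 1# + x ≤ exp x
    1+x≤exp x with <-cotrans x -2<-1
    ... | inj₂ x<-1 = ≤-trans (begin
      1# + x      ≤⟨ +-mono-≤ ≤-refl (<⇒≤ x<-1) ⟩
      1# + (- 1#) ≈⟨ -‿inverseʳ 1# ⟩
      0#          ∎) (exp-nonneg x)
    ... | inj₁ (q , 0<q , -2+q≤x) = begin
      1# + x
        ≤⟨ ≤-by (*-nonneg 0≤quarter (square-nonneg x))
             (solve 1 (λ x → (con 1ℚ :+ x) :+ con (½ Rat.* ½) :* (x :* x)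
                := (con 1ℚ :+ con ½ :* x) :* (con 1ℚ :+ con ½ :* x)) refl x) ⟩
      (1# + half * x) * (1# + half * x)
        ≤⟨ *-mono-≤ 0≤1+y 1+y≤exp 0≤1+y 1+y≤exp ⟩
      exp (half * x) * exp (half * x) ≈⟨ exp-halves x ⟨
      exp x ∎
      where
      -1+½q≤y : - 1# + fromℚ (½ Rat.* q) ≤ half * x
      -1+½q≤y = begin
        - 1# + fromℚ (½ Rat.* q)        ≈⟨ +-congˡ (fromℚ-* ½ q) ⟩
        - 1# + half * fromℚ q
          ≈⟨ solve 1 (λ q → :- con 1ℚ :+ con ½ :* q := con ½ :* (:- (con 1ℚ :+ con 1ℚ) :+ q)) refl (fromℚ q) ⟩
        half * (- (1# + 1#) + fromℚ q)  ≤⟨ *-monoˡ-≤ 0≤half -2+q≤x ⟩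
        half * x                        ∎
      1+y≤exp : 1# + half * x ≤ exp (half * x)
      1+y≤exp = 1+x≤exp₀ (ℚ-Lemmas.half-pos 0<q) -1+½q≤y
      0≤1+y : 0# ≤ 1# + half * x
      0≤1+y = ≤-trans (≤-reflexive (sym (-‿inverseʳ 1#))) (+-mono-≤ ≤-refl
        (≤-trans (≤-by (0≤fromℚ (ℚₚ.<⇒≤ (ℚ-Lemmas.half-pos 0<q))) refl) -1+½q≤y))

    exp-0 : exp 0# ≈ 1#
    exp-0 = ≤-antisym (*-cancelˡ-≤ 0<e (begin
        exp 0# * exp 0# ≈⟨ exp-+ 0# 0# ⟨
        exp (0# + 0#)   ≈⟨ exp-cong (+-identityˡ 0#) ⟩
        exp 0#          ≈⟨ *-identityʳ (exp 0#) ⟨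
        exp 0# * 1#     ∎))
      1≤e
      where
      1≤e : 1# ≤ exp 0#
      1≤e = ≤-trans (≤-reflexive (sym (+-identityʳ 1#))) (1+x≤exp 0#)
      0<e : 0# < exp 0#
      0<e = <-≤-trans 0<1# 1≤e

    exp-inverse : ∀ x → exp x * exp (- x) ≈ 1#
    exp-inverse x = trans (sym (exp-+ x (- x))) (trans (exp-cong (-‿inverseʳ x)) exp-0)

    exp-mono : ∀ {x y} → x ≤ y → exp x ≤ exp y
    exp-mono {x} {y} x≤y = begin
      exp x                  ≈⟨ *-identityʳ (exp x) ⟨
      exp x * 1#             ≤⟨ *-monoˡ-≤ (exp-nonneg x) (≤-by (x≤y⇒0≤y-x x≤y) refl) ⟩
      exp x * (1# + (y - x)) ≤⟨ *-monoˡ-≤ (exp-nonneg x) (1+x≤exp (y - x)) ⟩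
      exp x * exp (y - x)    ≈⟨ exp-+ x (y - x) ⟨
      exp (x + (y - x))      ≈⟨ exp-cong (solve 2 (λ x y → x :+ (y :- x) := y) refl x y) ⟩
      exp y                  ∎

    -- Positivity needs an explicit rational gap. A rational `b` above e^(-x) gives the gap 1/(b +
    -- 1); only `b` ≥ 0 is known, so 1 is added before inverting.
    exp-pos : ∀ x → 0# < exp x
    exp-pos x with approximate (exp (- x)) ℚ-Lemmas.0<1
    ... | a , _ , e≤b = bound (a Rat.+ 1ℚ) e≤b (ℚₚ.≮⇒≥ λ b<0 → <⇒≱ 0<1# (begin
        1#                           ≈⟨ exp-inverse x ⟨
        exp x * exp (- x)            ≤⟨ *-monoˡ-≤ (exp-nonneg x)
          (≤-trans e≤b (≤-trans (fromℚ-mono (ℚₚ.<⇒≤ b<0)) (≤-reflexive fromℚ-0))) ⟩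
        exp x * 0#                   ≈⟨ zeroʳ (exp x) ⟩
        0#                           ∎))
      where
      bound : ∀ b → exp (- x) ≤ fromℚ b → 0ℚ Rat.≤ b → 0# < exp x
      bound b e≤b 0≤b with ℚ-Lemmas.shrink {b Rat.+ 1ℚ}
          (ℚₚ.<-≤-trans ℚ-Lemmas.0<1 (ℚ-Lemmas.p≤q+p 0≤b)) {1ℚ} ℚ-Lemmas.0<1
      ... | r , 0<r , eq = <-≤-trans (fromℚ-pos 0<r)
        (inverse-lower {b = b Rat.+ 1ℚ} {r = r} (exp-nonneg x) (trans (*-comm _ _) (exp-inverse x))
          (≤-trans e≤b (fromℚ-mono (ℚ-Lemmas.p≤p+q ℚ-Lemmas.0≤1))) 0<r eq)

    +-pos-< : ∀ {x y d} → 0# < d → x + d ≤ y → x < y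
    +-pos-< {x} {y} {d} (q , 0<q , 0+q≤d) x+d≤y = q , 0<q , (begin
      x + fromℚ q        ≈⟨ +-congˡ (+-identityˡ (fromℚ q)) ⟨
      x + (0# + fromℚ q) ≤⟨ +-mono-≤ ≤-refl 0+q≤d ⟩
      x + d              ≤⟨ x+d≤y ⟩
      y                  ∎)

    exp-mono-< : ∀ {x y} → x < y → exp x < exp y
    exp-mono-< {x} {y} x<y = +-pos-< {d = exp x * (y - x)} (*-pos (exp-pos x) (x<y⇒0<y-x x<y)) (begin
      exp x + exp x * (y - x)
        ≈⟨ solve 2 (λ e d → e :+ e :* d := e :* (con 1ℚ :+ d)) refl (exp x) (y - x) ⟩
      exp x * (1# + (y - x)) ≤⟨ *-monoˡ-≤ (exp-nonneg x) (1+x≤exp (y - x)) ⟩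
      exp x * exp (y - x)    ≈⟨ exp-+ x (y - x) ⟨
      exp (x + (y - x))      ≈⟨ exp-cong (solve 2 (λ x y → x :+ (y :- x) := y) refl x y) ⟩
      exp y                  ∎)

    exp-cancel-≤ : ∀ {x y} → exp x ≤ exp y → x ≤ y
    exp-cancel-≤ {x} {y} le = ≮⇒≥ λ y<x → <⇒≱ (exp-mono-< y<x) le

    -- Both d and 0 are compared with the tangent of exp at s d.
    exp-convex : ∀ s d → 0# ≤ s → s ≤ 1# → exp (s * d) ≤ s * exp d + (1# - s)
    exp-convex s d 0≤s s≤1 = begin
      exp (s * d)
        ≈⟨ solve 3 (λ s d e → e := s :* (e :* (con 1ℚ :+ (con 1ℚ :- s) :* d))
             :+ (con 1ℚ :- s) :* (e :* (con 1ℚ :+ :- (s :* d)))) refl s d (exp (s * d)) ⟩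
      s * (exp (s * d) * (1# + (1# - s) * d)) + (1# - s) * (exp (s * d) * (1# + - (s * d)))
        ≤⟨ +-mono-≤
             (*-monoˡ-≤ 0≤s (≤-trans (*-monoˡ-≤ (exp-nonneg _) (1+x≤exp _)) (≤-reflexive toᵈ)))
             (*-monoˡ-≤ (x≤y⇒0≤y-x s≤1) (≤-trans (*-monoˡ-≤ (exp-nonneg _) (1+x≤exp _))
                 (≤-reflexive (exp-inverse (s * d))))) ⟩
      s * exp d + (1# - s) * 1# ≈⟨ +-congˡ (*-identityʳ (1# - s)) ⟩
      s * exp d + (1# - s) ∎
      where
      toᵈ : exp (s * d) * exp ((1# - s) * d) ≈ exp d
      toᵈ = trans (sym (exp-+ _ _))
        (exp-cong (solve 2 (λ s d → s :* d :+ (con 1ℚ :- s) :* d := d) refl s d))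

    -- The tangent bound at -1/4 gives 3/4, and squaring twice gives (3/4)⁴. The tangent bound at -1
    -- itself would give only 0.
    exp-neg-1-lower : fromℚ (ℤ.+ 81 Rat./ 256) ≤ exp (- 1#)
    exp-neg-1-lower = begin
      fromℚ (ℤ.+ 81 Rat./ 256)                      ≈⟨ fromℚ-* (ℤ.+ 9 Rat./ 16) (ℤ.+ 9 Rat./ 16) ⟩
      fromℚ (ℤ.+ 9 Rat./ 16) * fromℚ (ℤ.+ 9 Rat./ 16) ≤⟨ *-mono-≤ 0≤9/16 half-lower 0≤9/16 half-lower ⟩
      exp (half * - 1#) * exp (half * - 1#)       ≈⟨ exp-halves (- 1#) ⟨
      exp (- 1#)                                  ∎
      where
      q : Carrier
      q = half * (half * - 1#)
      0≤3/4 : 0# ≤ fromℚ (ℤ.+ 3 Rat./ 4)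
      0≤3/4 = 0≤fromℚ (ℚₚ.nonNegative⁻¹ (ℤ.+ 3 Rat./ 4))
      0≤9/16 : 0# ≤ fromℚ (ℤ.+ 9 Rat./ 16)
      0≤9/16 = 0≤fromℚ (ℚₚ.nonNegative⁻¹ (ℤ.+ 9 Rat./ 16))
      quarter-lower : fromℚ (ℤ.+ 3 Rat./ 4) ≤ exp q
      quarter-lower = ≤-trans (≤-reflexive
        (solve 0 (con (ℤ.+ 3 Rat./ 4) := con 1ℚ :+ con ½ :* (con ½ :* (:- con 1ℚ))) refl)) (1+x≤exp q)
      half-lower : fromℚ (ℤ.+ 9 Rat./ 16) ≤ exp (half * - 1#)
      half-lower = begin
        fromℚ (ℤ.+ 9 Rat./ 16)                      ≈⟨ fromℚ-* (ℤ.+ 3 Rat./ 4) (ℤ.+ 3 Rat./ 4) ⟩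
        fromℚ (ℤ.+ 3 Rat./ 4) * fromℚ (ℤ.+ 3 Rat./ 4) ≤⟨ *-mono-≤ 0≤3/4 quarter-lower 0≤3/4 quarter-lower ⟩
        exp q * exp q                             ≈⟨ exp-halves (half * - 1#) ⟨
        exp (half * - 1#)                         ∎

    exp-fromℚ-step : ∀ {r η} → 0ℚ Rat.< η → exp (fromℚ r) < exp (fromℚ (r Rat.+ η))
    exp-fromℚ-step {r} {η} 0<η = exp-mono-< (η , 0<η , ≤-reflexive (sym (fromℚ-+ r η)))

    -- A walk up the grid of mesh `η`, with at most `J` steps left. At each point, cotransitivity at
    -- r + η and r + 2η either accepts `r` or moves on. The two thresholds must differ, which is why
    -- the bracket has width 2η.
    log-search : ∀ {q η} → 0ℚ Rat.< η → ∀ J r → exp (fromℚ r) ≤ fromℚ q →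
      fromℚ q ≤ exp (fromℚ (r Rat.+ fromℕ J Rat.* η)) →
      ∃ λ r → exp (fromℚ r) ≤ fromℚ q × fromℚ q ≤ exp (fromℚ ((r Rat.+ η) Rat.+ η))
    log-search {q} {η} 0<η zero r lower upper = r , lower , ≤-trans upper (exp-mono (fromℚ-mono bound))
      where
      bound : r Rat.+ fromℕ 0 Rat.* η Rat.≤ (r Rat.+ η) Rat.+ η
      bound = ℚₚ.≤-trans
        (ℚₚ.≤-reflexive (≡.trans (≡.cong (λ z → r Rat.+ z Rat.* η) ℚ-Lemmas.fromℕ-zero)
          (≡.trans (≡.cong (r Rat.+_) (ℚₚ.*-zeroˡ η)) (ℚₚ.+-identityʳ r))))
        (ℚₚ.≤-trans (ℚ-Lemmas.p≤p+q (ℚₚ.<⇒≤ 0<η)) (ℚ-Lemmas.p≤p+q (ℚₚ.<⇒≤ 0<η)))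
    log-search {q} {η} 0<η (suc J) r lower upper =
      decide (<-cotrans (fromℚ q) (exp-fromℚ-step {r Rat.+ η} {η} 0<η))
      where
      shifted : ∀ r j → r Rat.+ (1ℚ Rat.+ j) Rat.* η ≡ (r Rat.+ η) Rat.+ j Rat.* η
      shifted r j = ℚS.solve 3 (λ r j η → r ℚS.:+ (ℚS.con 1ℚ ℚS.:+ j) ℚS.:* η ℚS.:= (r ℚS.:+ η) ℚS.:+ j ℚS.:* η)
        ≡.refl r j η
      upper′ : fromℚ q ≤ exp (fromℚ ((r Rat.+ η) Rat.+ fromℕ J Rat.* η))
      upper′ = ≡.subst (λ z → fromℚ q ≤ exp (fromℚ z))
        (≡.trans (≡.cong (λ z → r Rat.+ z Rat.* η) (ℚ-Lemmas.fromℕ-suc J)) (shifted r (fromℕ J))) upper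
      decide : exp (fromℚ (r Rat.+ η)) < fromℚ q ⊎ fromℚ q < exp (fromℚ ((r Rat.+ η) Rat.+ η)) →
        ∃ λ r → exp (fromℚ r) ≤ fromℚ q × fromℚ q ≤ exp (fromℚ ((r Rat.+ η) Rat.+ η))
      decide (inj₂ q<exp) = r , lower , <⇒≤ q<exp
      decide (inj₁ exp<q) = log-search 0<η J (r Rat.+ η) (<⇒≤ exp<q) upper′

    -- Since e^a ≥ a = 1/q.
    exp-neg≤ : ∀ {q a} → 0ℚ Rat.< q → q Rat.* a ≡ 1ℚ → exp (fromℚ (Rat.- a)) ≤ fromℚ q
    exp-neg≤ {q} {a} 0<q qa≡1 = begin
      exp (fromℚ (Rat.- a)) ≈⟨ exp-cong (fromℚ-neg a) ⟩
      exp (- fromℚ a)       ≈⟨ *-identityˡ _ ⟨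
      1# * exp (- fromℚ a)  ≈⟨ *-congʳ (trans (sym fromℚ-1)
          (trans (reflexive (≡.cong fromℚ (≡.sym qa≡1))) (fromℚ-* q a))) ⟩
      (fromℚ q * fromℚ a) * exp (- fromℚ a)
        ≤⟨ *-monoʳ-≤ (exp-nonneg _) (*-monoˡ-≤ (0≤fromℚ (ℚₚ.<⇒≤ 0<q)) a≤exp) ⟩
      (fromℚ q * exp (fromℚ a)) * exp (- fromℚ a) ≈⟨ *-assoc _ _ _ ⟩
      fromℚ q * (exp (fromℚ a) * exp (- fromℚ a)) ≈⟨ *-congˡ (exp-inverse (fromℚ a)) ⟩
      fromℚ q * 1#                                ≈⟨ *-identityʳ _ ⟩
      fromℚ q ∎
      where
      a≤exp : fromℚ a ≤ exp (fromℚ a)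
      a≤exp = ≤-trans (≤-by 0≤1# (+-comm (fromℚ a) 1#)) (1+x≤exp (fromℚ a))

    multiple-above : ∀ {h} → 0ℚ Rat.< h → ∀ z → ∃ λ J → z Rat.≤ fromℕ J Rat.* h
    multiple-above {h} 0<h z = above (ℚ-Lemmas.shrink {h} 0<h {1ℚ} ℚ-Lemmas.0<1)
      where
      unscale : ∀ z d → h Rat.* d ≡ 1ℚ → z ≡ (z Rat.* d) Rat.* h
      unscale z d hd≡1 = ≡.trans (≡.sym (ℚₚ.*-identityʳ z)) (≡.trans (≡.cong (z Rat.*_) (≡.sym hd≡1))
        (ℚS.solve 3 (λ z d h → z ℚS.:* (h ℚS.:* d) ℚS.:= (z ℚS.:* d) ℚS.:* h) ≡.refl z d h))
      above : (∃ λ d → 0ℚ Rat.< d × h Rat.* d ≡ 1ℚ) → ∃ λ J → z Rat.≤ fromℕ J Rat.* h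
      above (d , 0<d , hd≡1) = proj₁ (ℚ-Lemmas.archimedean (z Rat.* d)) ,
        ℚₚ.≤-trans (ℚₚ.≤-reflexive (unscale z d hd≡1))
          (ℚₚ.*-monoʳ-≤-nonNeg h {{Rat.nonNegative (ℚₚ.<⇒≤ 0<h)}} (proj₂ (ℚ-Lemmas.archimedean (z Rat.* d))))

    -- The search runs from -1/q, where e^(-1/q) ≤ q, up to q, where q ≤ 1 + q ≤ e^q. The interval
    -- has length q + 1/q, and `multiple-above` covers it by finitely many grid steps.
    log-approximation-half : ∀ {q h} → 0ℚ Rat.< q → 0ℚ Rat.< h →
      ∃ λ r → exp (fromℚ r) ≤ fromℚ q × fromℚ q ≤ exp (fromℚ ((r Rat.+ h) Rat.+ h))
    log-approximation-half {q} {h} 0<q 0<h = found (ℚ-Lemmas.shrink {q} 0<q {1ℚ} ℚ-Lemmas.0<1)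
      where
      move : ∀ q a z → q Rat.+ a Rat.≤ z → q Rat.≤ Rat.- a Rat.+ z
      move q a z le = ≡.subst (Rat._≤ Rat.- a Rat.+ z)
        (ℚS.solve 2 (λ q a → ℚS.:- a ℚS.:+ (q ℚS.:+ a) ℚS.:= q) ≡.refl q a) (ℚₚ.+-monoʳ-≤ (Rat.- a) le)
      search : ∀ a → q Rat.* a ≡ 1ℚ → (∃ λ J → q Rat.+ a Rat.≤ fromℕ J Rat.* h) →
        ∃ λ r → exp (fromℚ r) ≤ fromℚ q × fromℚ q ≤ exp (fromℚ ((r Rat.+ h) Rat.+ h))
      search a qa≡1 (J , q+a≤Jh) = log-search {q} {h} 0<h J (Rat.- a) (exp-neg≤ 0<q qa≡1)
        (≤-trans (≤-trans (≤-by 0≤1# (+-comm (fromℚ q) 1#)) (1+x≤exp (fromℚ q)))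
          (exp-mono (fromℚ-mono (move q a (fromℕ J Rat.* h) q+a≤Jh))))
      found : (∃ λ a → 0ℚ Rat.< a × q Rat.* a ≡ 1ℚ) →
        ∃ λ r → exp (fromℚ r) ≤ fromℚ q × fromℚ q ≤ exp (fromℚ ((r Rat.+ h) Rat.+ h))
      found (a , _ , qa≡1) = search a qa≡1 (multiple-above 0<h (q Rat.+ a))

    log-approximation : ∀ {q η} → 0ℚ Rat.< q → 0ℚ Rat.< η →
      ∃ λ r → exp (fromℚ r) ≤ fromℚ q × fromℚ q ≤ exp (fromℚ (r Rat.+ η))
    log-approximation {q} {η} 0<q 0<η = proj₁ approx , proj₁ (proj₂ approx) ,
      ≡.subst (λ z → fromℚ q ≤ exp (fromℚ z)) (rejoin (proj₁ approx)) (proj₂ (proj₂ approx))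
      where
      approx : ∃ λ r → exp (fromℚ r) ≤ fromℚ q × fromℚ q ≤ exp (fromℚ ((r Rat.+ ½ Rat.* η) Rat.+ ½ Rat.* η))
      approx = log-approximation-half {q} {½ Rat.* η} 0<q (ℚ-Lemmas.half-pos 0<η)
      rejoin : ∀ r → (r Rat.+ ½ Rat.* η) Rat.+ ½ Rat.* η ≡ r Rat.+ η
      rejoin r = ≡.trans (ℚₚ.+-assoc r (½ Rat.* η) (½ Rat.* η)) (≡.cong (r Rat.+_) (ℚ-Lemmas.half+half η))

    -- From 1 - η ≤ e^(-η) it follows that a (1 - η) ≤ a e^(-η) ≤ e^r ≤ c.
    shrink-by : ∀ {a c} → 0# ≤ a → ∀ η r → exp (fromℚ r) ≤ c → a ≤ exp (fromℚ (r Rat.+ η)) → a ≤ c + fromℚ η * a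
    shrink-by {a} {c} 0≤a η r lower upper = begin
      a                                  ≈⟨ solve 2 (λ a η → a := a :* (con 1ℚ :+ :- η) :+ η :* a) refl a (fromℚ η) ⟩
      a * (1# + - fromℚ η) + fromℚ η * a ≤⟨ +-mono-≤ (*-monoˡ-≤ 0≤a (1+x≤exp (- fromℚ η))) ≤-refl ⟩
      a * exp (- fromℚ η) + fromℚ η * a  ≤⟨ +-mono-≤ (*-monoʳ-≤ (exp-nonneg _) upper) ≤-refl ⟩
      exp (fromℚ (r Rat.+ η)) * exp (- fromℚ η) + fromℚ η * a ≈⟨ +-congʳ collapse ⟩
      exp (fromℚ r) + fromℚ η * a        ≤⟨ +-mono-≤ lower ≤-refl ⟩
      c + fromℚ η * a                    ∎
      where
      collapse : exp (fromℚ (r Rat.+ η)) * exp (- fromℚ η) ≈ exp (fromℚ r)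
      collapse = trans (sym (exp-+ _ _)) (exp-cong (trans (+-congʳ (fromℚ-+ r η))
        (solve 2 (λ r η → (r :+ η) :+ :- η := r) refl (fromℚ r) (fromℚ η))))

    -- Stands in for continuity of exp. Each `η` loses at most `fromℚ η * a`, and a rational bound
    -- for `a` makes this loss arbitrarily small. It is applied in both directions to identify e^(ln
    -- q) with q.
    exp-squeeze : ∀ {a c} → 0# ≤ a →
      (∀ {η} → 0ℚ Rat.< η → ∃ λ r → exp (fromℚ r) ≤ c × a ≤ exp (fromℚ (r Rat.+ η))) → a ≤ c
    exp-squeeze {a} {c} 0≤a h = ≤-limit λ {e} 0<e → bound 0<e (approximate a ℚ-Lemmas.0<1)
      where
      shrunk : ∀ {η} → 0ℚ Rat.< η → a ≤ c + fromℚ η * a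
      shrunk {η} 0<η = compare (h 0<η)
        where
        compare : (∃ λ r → exp (fromℚ r) ≤ c × a ≤ exp (fromℚ (r Rat.+ η))) → a ≤ c + fromℚ η * a
        compare (r , lower , upper) = shrink-by 0≤a η r lower upper
      bound : ∀ {e} → 0ℚ Rat.< e → (∃ λ q → fromℚ q ≤ a × a ≤ fromℚ (q Rat.+ 1ℚ)) → a ≤ c + fromℚ e
      bound {e} 0<e (q , _ , a≤q+1) = finish (ℚ-Lemmas.shrink {b} 0<b {e} 0<e)
        where
        b : ℚ
        b = Rat.∣ q Rat.+ 1ℚ ∣ Rat.+ 1ℚ
        0<b : 0ℚ Rat.< b
        0<b = ℚₚ.<-≤-trans ℚ-Lemmas.0<1 (ℚ-Lemmas.p≤q+p (ℚₚ.0≤∣p∣ (q Rat.+ 1ℚ)))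
        finish : (∃ λ d → 0ℚ Rat.< d × b Rat.* d ≡ e) → a ≤ c + fromℚ e
        finish (d , 0<d , bd≡e) = ≤-trans (shrunk 0<d) (+-mono-≤ ≤-refl (begin
          fromℚ d * a            ≤⟨ *-monoˡ-≤ (0≤fromℚ (ℚₚ.<⇒≤ 0<d)) (≤-trans a≤q+1 (fromℚ-mono
            (ℚₚ.≤-trans (ℚ-Lemmas.p≤∣p∣ (q Rat.+ 1ℚ)) (ℚ-Lemmas.p≤p+q ℚ-Lemmas.0≤1)))) ⟩
          fromℚ d * fromℚ b      ≈⟨ *-comm _ _ ⟩
          fromℚ b * fromℚ d      ≈⟨ fromℚ-* b d ⟨
          fromℚ (b Rat.* d)      ≈⟨ reflexive (≡.cong fromℚ bd≡e) ⟩
          fromℚ e                ∎))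

-- Stationary distributions

module StationaryDistributions (F : ArchimedeanField) where
  open FieldProperties F
  open ≤-Reasoning

  SquareMatrix : ℕ → Set
  SquareMatrix n = Fin n → Fin n → Carrier

  record IsStochastic {n} (Q : SquareMatrix n) : Set where
    field
      nonneg : ∀ x y → 0# ≤ Q x y
      rowSum : ∀ x → sum (Q x) ≈ 1#

  Irreducible : ∀ {n} → SquareMatrix n → Set
  Irreducible Q = ∀ x y → Star (λ x y → 0# < Q x y) x y

  IsInvariant : ∀ {n} → SquareMatrix n → (Fin n → Carrier) → Set
  IsInvariant Q μ = ∀ y → sum (λ x → μ x * Q x y) ≈ μ y

  -- Uniqueness is stated linearly, for invariant vectors of any sign and any total. The induction
  -- needs this form, because restricting an invariant vector to fewer states changes its total.
  record InvariantLine {n} (Q : SquareMatrix n) : Set where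
    field
      μ         : Fin n → Carrier
      nonneg    : ∀ x → 0# ≤ μ x
      total     : sum μ ≈ 1#
      invariant : IsInvariant Q μ
      unique    : ∀ ν → IsInvariant Q ν → ∀ x → ν x ≈ sum ν * μ x

  opaque
    sum-*ʳ : ∀ {n} (f : Fin n → Carrier) k → sum (λ i → f i * k) ≈ sum f * k
    sum-*ʳ f k = sym (*-distribʳ-sum k f)

    sum-*ˡ : ∀ {n} k (f : Fin n → Carrier) → sum (λ i → k * f i) ≈ k * sum f
    sum-*ˡ k f = sym (*-distribˡ-sum k f)

    sum-cong : ∀ {n} {f g : Fin n → Carrier} → (∀ i → f i ≈ g i) → sum f ≈ sum g
    sum-cong {n} {f} {g} = sum-cong-≋ {n} {f} {g}

    sum-+ : ∀ {n} (f g : Fin n → Carrier) → sum (λ i → f i + g i) ≈ sum f + sum g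
    sum-+ = ∑-distrib-+

  -- Censoring state zero: excursions through it are replaced by direct steps, with w = 1 / Σⱼ Q 0 (suc j).
  module Censored {n} (Q : SquareMatrix (suc (suc n))) (stochastic : IsStochastic Q)
      (irreducible : Irreducible Q) where
    open IsStochastic stochastic

    exit : Carrier
    exit = sum (λ j → Q zero (suc j))

    opaque
      exit-edge : ∀ {j} → Star (λ x y → 0# < Q x y) zero (suc j) → ∃ λ k → 0# < Q zero (suc k)
      exit-edge (_◅_ {j = zero}  _ path) = exit-edge path
      exit-edge (_◅_ {j = suc k} edge _) = k , edge

      0<exit : 0# < exit
      0<exit = <-≤-trans (proj₂ (exit-edge (irreducible zero (suc zero))))
        (term≤sum (λ j → nonneg zero (suc j)) (proj₁ (exit-edge (irreducible zero (suc zero)))))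

    w : Carrier
    w = proj₁ (inverse-pos 0<exit)

    censored : SquareMatrix (suc n)
    censored i j = Q (suc i) (suc j) + Q (suc i) zero * (w * Q zero (suc j))

    opaque
      0<w : 0# < w
      0<w = proj₁ (proj₂ (inverse-pos 0<exit))

      exit*w : exit * w ≈ 1#
      exit*w = proj₂ (proj₂ (inverse-pos 0<exit))

      censored-stochastic : IsStochastic censored
      censored-stochastic = record
        { nonneg = λ i j → ≤-trans (nonneg (suc i) (suc j))
            (≤-by (*-nonneg (nonneg (suc i) zero) (*-nonneg (<⇒≤ 0<w) (nonneg zero (suc j)))) refl)
        ; rowSum = λ i → begin-equality
            sum (censored i)
              ≈⟨ sum-+ (λ j → Q (suc i) (suc j)) (λ j → Q (suc i) zero * (w * Q zero (suc j))) ⟩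
            sum (λ j → Q (suc i) (suc j)) + sum (λ j → Q (suc i) zero * (w * Q zero (suc j)))
              ≈⟨ +-congˡ (trans (sum-*ˡ (Q (suc i) zero) (λ j → w * Q zero (suc j)))
                   (*-congˡ (trans (sum-*ˡ w (λ j → Q zero (suc j))) (trans (*-comm w exit) exit*w)))) ⟩
            sum (λ j → Q (suc i) (suc j)) + Q (suc i) zero * 1#
              ≈⟨ solve 2 (λ s q → s :+ q :* con 1ℚ := q :+ s) refl (sum (λ j → Q (suc i) (suc j))) (Q (suc i) zero) ⟩
            Q (suc i) zero + sum (λ j → Q (suc i) (suc j)) ≈⟨ rowSum (suc i) ⟩
            1# ∎ }

      direct-edge : ∀ {i k} → 0# < Q (suc i) (suc k) → 0# < censored i k
      direct-edge {i} {k} edge = +-pos-nonneg edge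
        (*-nonneg (nonneg (suc i) zero) (*-nonneg (<⇒≤ 0<w) (nonneg zero (suc k))))

      detour-edge : ∀ {i k} → 0# < Q (suc i) zero → 0# < Q zero (suc k) → 0# < censored i k
      detour-edge {i} {k} in-edge out-edge = <-≤-trans
        (+-pos-nonneg (*-pos in-edge (*-pos 0<w out-edge)) (nonneg (suc i) (suc k)))
        (≤-reflexive (+-comm (Q (suc i) zero * (w * Q zero (suc k))) (Q (suc i) (suc k))))

      -- The two functions follow the path inside and outside state zero. On entering zero the entry
      -- edge is remembered until the path leaves again, however long it loops there; entry and exit
      -- together form one censored edge.
      censored-path : ∀ {i j} → Star (λ x y → 0# < Q x y) (suc i) (suc j) → Star (λ x y → 0# < censored x y) i j
      censored-detour : ∀ {i j} → 0# < Q (suc i) zero → Star (λ x y → 0# < Q x y) zero (suc j) →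
        Star (λ x y → 0# < censored x y) i j
      censored-path []                               = []
      censored-path (_◅_ {j = zero} in-edge path)    = censored-detour in-edge path
      censored-path (_◅_ {j = suc k} edge path)      = direct-edge edge ◅ censored-path path
      censored-detour in-edge (_◅_ {j = zero} _ path)         = censored-detour in-edge path
      censored-detour in-edge (_◅_ {j = suc k} out-edge path) = detour-edge in-edge out-edge ◅ censored-path path

      censored-irreducible : Irreducible censored
      censored-irreducible i j = censored-path (irreducible (suc i) (suc j))

    inflow : (Fin (suc n) → Carrier) → Carrier
    inflow ν = sum (λ i → ν i * Q (suc i) zero)

    opaque
      sum-censored : ∀ ν j → sum (λ i → ν i * censored i j)
        ≈ inflow ν * w * Q zero (suc j) + sum (λ i → ν i * Q (suc i) (suc j))
      sum-censored ν j = begin-equality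
        sum (λ i → ν i * censored i j)
          ≈⟨ sum-cong (λ i → solve 5 (λ v a b w c → v :* (a :+ b :* (w :* c)) := v :* b :* (w :* c) :+ v :* a) refl
               (ν i) (Q (suc i) (suc j)) (Q (suc i) zero) w (Q zero (suc j))) ⟩
        sum (λ i → ν i * Q (suc i) zero * (w * Q zero (suc j)) + ν i * Q (suc i) (suc j))
          ≈⟨ sum-+ (λ i → ν i * Q (suc i) zero * (w * Q zero (suc j))) (λ i → ν i * Q (suc i) (suc j)) ⟩
        sum (λ i → ν i * Q (suc i) zero * (w * Q zero (suc j))) + sum (λ i → ν i * Q (suc i) (suc j))
          ≈⟨ +-congʳ (trans (sum-*ʳ (λ i → ν i * Q (suc i) zero) (w * Q zero (suc j)))
              (sym (*-assoc (inflow ν) w (Q zero (suc j))))) ⟩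
        inflow ν * w * Q zero (suc j) + sum (λ i → ν i * Q (suc i) (suc j)) ∎

      stay : Q zero zero ≈ 1# - exit
      stay = trans (solve 2 (λ q r → q := (q :+ r) :- r) refl (Q zero zero) exit) (+-congʳ (rowSum zero))

      -- Balance at state zero for inflow `c`: mass `c * w` loses `c * w * exit`, which equals `c`.
      stay-identity : ∀ c → (c * w) * Q zero zero + c ≈ c * w
      stay-identity c = begin-equality
        (c * w) * Q zero zero + c ≈⟨ +-cong (*-congˡ stay) (trans (sym (*-identityʳ c)) (*-congˡ (sym exit*w))) ⟩
        (c * w) * (1# - exit) + c * (exit * w)
          ≈⟨ solve 3 (λ c w r → (c :* w) :* (con 1ℚ :- r) :+ c :* (r :* w) := c :* w) refl c w exit ⟩
        c * w ∎

      -- The balance equation at zero says that ν(0) times the exit probability equals the inflow,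
      -- so the remaining coordinates determine ν(0).
      invariant-zero : ∀ ν → IsInvariant Q ν → ν zero ≈ inflow (λ i → ν (suc i)) * w
      invariant-zero ν inv = begin-equality
        a               ≈⟨ *-identityʳ a ⟨
        a * 1#          ≈⟨ *-congˡ exit*w ⟨
        a * (exit * w)
          ≈⟨ solve 3 (λ a r w → a :* (r :* w) := (a :- a :* (con 1ℚ :- r)) :* w) refl a exit w ⟩
        (a - a * (1# - exit)) * w
          ≈⟨ *-congʳ (+-cong (sym (inv zero)) (-‿cong (*-congˡ (sym stay)))) ⟩
        (a * Q zero zero + c - a * Q zero zero) * w
          ≈⟨ *-congʳ (solve 2 (λ x c → (x :+ c) :- x := c) refl (a * Q zero zero) c) ⟩
        c * w           ∎
        where
        a c : Carrier
        a = ν zero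
        c = inflow (λ i → ν (suc i))

      invariant-censored : ∀ ν → IsInvariant Q ν → IsInvariant censored (λ i → ν (suc i))
      invariant-censored ν inv j = begin-equality
        sum (λ i → ν (suc i) * censored i j) ≈⟨ sum-censored (λ i → ν (suc i)) j ⟩
        inflow (λ i → ν (suc i)) * w * Q zero (suc j) + sum (λ i → ν (suc i) * Q (suc i) (suc j))
          ≈⟨ +-congʳ (*-congʳ (sym (invariant-zero ν inv))) ⟩
        ν zero * Q zero (suc j) + sum (λ i → ν (suc i) * Q (suc i) (suc j)) ≈⟨ inv (suc j) ⟩
        ν (suc j) ∎

    -- By `invariant-zero`, the only possible extension of `μ′` puts mass `c * w` on state zero. Its
    -- total is `T`, and `v` = 1/T normalises it.
    module Extend (line : InvariantLine censored) where
      open InvariantLine line renaming (μ to μ′; nonneg to μ′-nonneg; total to μ′-total; invariant to μ′-invariant; unique to μ′-unique)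

      c T : Carrier
      c = inflow μ′
      T = 1# + c * w

      opaque
        0≤c : 0# ≤ c
        0≤c = sum-nonneg (λ i → *-nonneg (μ′-nonneg i) (nonneg (suc i) zero))

        0<T : 0# < T
        0<T = +-pos-nonneg 0<1# (*-nonneg 0≤c (<⇒≤ 0<w))

      v : Carrier
      v = proj₁ (inverse-pos 0<T)

      μ : Fin (suc (suc n)) → Carrier
      μ zero    = c * w * v
      μ (suc i) = μ′ i * v

      opaque
        0≤v : 0# ≤ v
        0≤v = <⇒≤ (proj₁ (proj₂ (inverse-pos 0<T)))

        T*v : T * v ≈ 1#
        T*v = proj₂ (proj₂ (inverse-pos 0<T))

        μ-nonneg : ∀ x → 0# ≤ μ x
        μ-nonneg zero    = *-nonneg (*-nonneg 0≤c (<⇒≤ 0<w)) 0≤v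
        μ-nonneg (suc i) = *-nonneg (μ′-nonneg i) 0≤v

        μ-total : sum μ ≈ 1#
        μ-total = begin-equality
          c * w * v + sum (λ i → μ′ i * v) ≈⟨ +-congˡ (trans (sum-*ʳ μ′ v) (*-congʳ μ′-total)) ⟩
          c * w * v + 1# * v               ≈⟨ solve 2
              (λ x v → x :* v :+ con 1ℚ :* v := (con 1ℚ :+ x) :* v) refl (c * w) v ⟩
          T * v                            ≈⟨ T*v ⟩
          1#                               ∎

        μ-invariant : IsInvariant Q μ
        μ-invariant zero = begin-equality
          c * w * v * Q zero zero + sum (λ i → μ′ i * v * Q (suc i) zero)
            ≈⟨ +-cong (solve 3 (λ x v q → x :* v :* q := x :* q :* v) refl (c * w) v (Q zero zero))
                 (trans (sum-cong (λ i → solve 3 (λ m v q → m :* v :* q := m :* q :* v) refl (μ′ i) v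
                     (Q (suc i) zero)))
                   (sum-*ʳ (λ i → μ′ i * Q (suc i) zero) v)) ⟩
          c * w * Q zero zero * v + c * v ≈⟨ distribʳ v (c * w * Q zero zero) c ⟨
          (c * w * Q zero zero + c) * v   ≈⟨ *-congʳ (stay-identity c) ⟩
          c * w * v                       ∎
        μ-invariant (suc j) = begin-equality
          c * w * v * Q zero (suc j) + sum (λ i → μ′ i * v * Q (suc i) (suc j))
            ≈⟨ +-cong (solve 3 (λ x v q → x :* v :* q := x :* q :* v) refl (c * w) v (Q zero (suc j)))
                 (trans (sum-cong (λ i → solve 3 (λ m v q → m :* v :* q := m :* q :* v) refl (μ′ i) v
                     (Q (suc i) (suc j))))
                   (sum-*ʳ (λ i → μ′ i * Q (suc i) (suc j)) v)) ⟩
          c * w * Q zero (suc j) * v + sum (λ i → μ′ i * Q (suc i) (suc j)) * v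
            ≈⟨ distribʳ v (c * w * Q zero (suc j)) (sum (λ i → μ′ i * Q (suc i) (suc j))) ⟨
          (c * w * Q zero (suc j) + sum (λ i → μ′ i * Q (suc i) (suc j))) * v ≈⟨ *-congʳ (sum-censored μ′ j) ⟨
          sum (λ i → μ′ i * censored i j) * v ≈⟨ *-congʳ (μ′-invariant j) ⟩
          μ′ j * v ∎

      module _ (ν : Fin (suc (suc n)) → Carrier) (inv : IsInvariant Q ν) where
        S : Carrier
        S = sum (λ i → ν (suc i))

        opaque
          ν-suc : ∀ i → ν (suc i) ≈ S * μ′ i
          ν-suc = μ′-unique (λ i → ν (suc i)) (invariant-censored ν inv)

          ν-zero : ν zero ≈ S * (c * w)
          ν-zero = begin-equality
            ν zero ≈⟨ invariant-zero ν inv ⟩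
            inflow (λ i → ν (suc i)) * w
              ≈⟨ *-congʳ (trans (sum-cong (λ i → trans (*-congʳ (ν-suc i)) (*-assoc S (μ′ i) (Q (suc i) zero))))
                   (sum-*ˡ S (λ i → μ′ i * Q (suc i) zero))) ⟩
            S * c * w   ≈⟨ *-assoc S c w ⟩
            S * (c * w) ∎

          -- The censored chain expresses ν through the partial total `S`; since the full total is
          -- `S * T`, the factor `v` converts one description into the other.
          scale : ∀ a → S * a ≈ sum ν * (a * v)
          scale a = begin-equality
            S * a ≈⟨ trans (*-congˡ (trans (sym (*-identityˡ a)) (*-congʳ (sym T*v))))
                (solve 4 (λ S x v a → S :* ((con 1ℚ :+ x) :* v :* a) := (S :* x :+ S) :* (a :* v)) refl S
                    (c * w) v a) ⟩
            (S * (c * w) + S) * (a * v) ≈⟨ *-congʳ (+-congʳ ν-zero) ⟨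
            sum ν * (a * v) ∎

          μ-unique : ∀ x → ν x ≈ sum ν * μ x
          μ-unique zero    = trans ν-zero (scale (c * w))
          μ-unique (suc i) = trans (ν-suc i) (scale (μ′ i))

      extended : InvariantLine Q
      extended = record { μ = μ ; nonneg = μ-nonneg ; total = μ-total ; invariant = μ-invariant ; unique = μ-unique }

  -- Gaussian elimination of one state at a time. The only pivots are exit probabilities, which
  -- irreducibility makes positive with a gap, so neither compactness nor a test of a real for zero
  -- is involved.
  invariant-line : ∀ {n} (Q : SquareMatrix (suc n)) → IsStochastic Q → Irreducible Q → InvariantLine Q
  invariant-line {zero} Q stochastic _ = record
    { μ = λ _ → 1#
    ; nonneg = λ _ → 0≤1#
    ; total = +-identityʳ 1#
    ; invariant = λ { zero → trans (+-congʳ (*-identityˡ (Q zero zero))) (IsStochastic.rowSum stochastic zero) }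
    ; unique = λ { ν _ zero → solve 1 (λ a → a := (a :+ con 0ℚ) :* con 1ℚ) refl (ν zero) } }
  invariant-line {suc n} Q stochastic irreducible =
    Extend.extended (invariant-line censored censored-stochastic censored-irreducible)
    where open Censored Q stochastic irreducible

-- The exponential series

module Convolution where
  open ≡ using (refl; sym; trans; cong; cong₂; subst; subst₂)
  open Rat using (_+_; _*_; _-_; -_; ∣_∣; _≤_; nonNegative)
  open ℚₚ.≤-Reasoning
  open +-*-Solver
  open ℚ-Lemmas

  partialSum : (ℕ → ℚ) → ℕ → ℚ
  partialSum f zero    = 0ℚ
  partialSum f (suc n) = partialSum f n + f n

  shift : (ℕ → ℚ) → ℕ → ℚ
  shift f k = f (suc k)

  conv : (ℕ → ℚ) → (ℕ → ℚ) → ℕ → ℚ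
  conv f g zero    = f 0 * g 0
  conv f g (suc k) = f 0 * g (suc k) + conv (shift f) g k

  opaque
    conv-congˡ : ∀ {f f′} g → (∀ k → f k ≡ f′ k) → ∀ k → conv f g k ≡ conv f′ g k
    conv-congˡ g eq zero    = cong (_* g 0) (eq 0)
    conv-congˡ g eq (suc k) = cong₂ _+_ (cong (_* g (suc k)) (eq 0)) (conv-congˡ g (λ i → eq (suc i)) k)

    conv-congʳ : ∀ f {g g′} → (∀ k → g k ≡ g′ k) → ∀ k → conv f g k ≡ conv f g′ k
    conv-congʳ f eq zero    = cong (f 0 *_) (eq 0)
    conv-congʳ f eq (suc k) = cong₂ _+_ (cong (f 0 *_) (eq (suc k))) (conv-congʳ (shift f) eq k)

    conv-+ˡ : ∀ f f′ g k → conv (λ i → f i + f′ i) g k ≡ conv f g k + conv f′ g k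
    conv-+ˡ f f′ g zero    = ℚₚ.*-distribʳ-+ (g 0) (f 0) (f′ 0)
    conv-+ˡ f f′ g (suc k) = trans
      (cong ((f 0 + f′ 0) * g (suc k) +_) (conv-+ˡ (shift f) (shift f′) g k))
      (solve 5 (λ a a′ b u v → (a :+ a′) :* b :+ (u :+ v) := (a :* b :+ u) :+ (a′ :* b :+ v)) refl
        (f 0) (f′ 0) (g (suc k)) (conv (shift f) g k) (conv (shift f′) g k))

    conv-*ˡ : ∀ a f g k → conv (λ i → a * f i) g k ≡ a * conv f g k
    conv-*ˡ a f g zero    = ℚₚ.*-assoc a (f 0) (g 0)
    conv-*ˡ a f g (suc k) = trans
      (cong ((a * f 0) * g (suc k) +_) (conv-*ˡ a (shift f) g k))
      (solve 4 (λ a f g u → (a :* f) :* g :+ a :* u := a :* (f :* g :+ u)) refl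
        a (f 0) (g (suc k)) (conv (shift f) g k))

    conv-*ʳ : ∀ b f g k → conv f (λ i → b * g i) k ≡ b * conv f g k
    conv-*ʳ b f g zero    = solve 3 (λ f b g → f :* (b :* g) := b :* (f :* g)) refl (f 0) b (g 0)
    conv-*ʳ b f g (suc k) = trans
      (cong (f 0 * (b * g (suc k)) +_) (conv-*ʳ b (shift f) g k))
      (solve 4 (λ b f g u → f :* (b :* g) :+ b :* u := b :* (f :* g :+ u)) refl
        b (f 0) (g (suc k)) (conv (shift f) g k))

    conv-sucʳ : ∀ f g k → conv f g (suc k) ≡ conv f (shift g) k + f (suc k) * g 0
    conv-sucʳ f g zero    = refl
    conv-sucʳ f g (suc k) = trans
      (cong (f 0 * g (suc (suc k)) +_) (conv-sucʳ (shift f) g k))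
      (sym (ℚₚ.+-assoc (f 0 * g (suc (suc k))) (conv (shift f) (shift g) k) (f (suc (suc k)) * g 0)))

  -- The Euler operator x d/dx on coefficient sequences.
  θ : (ℕ → ℚ) → ℕ → ℚ
  θ f k = fromℕ k * f k

  opaque
    conv-zero : ∀ f g → conv f g 0 ≡ f 0 * g 0
    conv-zero f g = refl

    conv-suc : ∀ f g k → conv f g (suc k) ≡ f 0 * g (suc k) + conv (shift f) g k
    conv-suc f g k = refl

    θ-def : ∀ f k → θ f k ≡ fromℕ k * f k
    θ-def f k = refl

    θ-zero : ∀ f → θ f 0 ≡ 0ℚ
    θ-zero f = trans (cong (_* f 0) fromℕ-zero) (ℚₚ.*-zeroˡ (f 0))

    θ-suc : ∀ f k → θ f (suc k) ≡ f (suc k) + θ (shift f) k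
    θ-suc f k = trans (cong (_* f (suc k)) (fromℕ-suc k))
      (trans (ℚₚ.*-distribʳ-+ (f (suc k)) 1ℚ (fromℕ k)) (cong (_+ θ (shift f) k) (ℚₚ.*-identityˡ (f (suc k)))))

    leibniz-step : ∀ N f g C C₁ C₂ → N * C ≡ C + (C₁ + C₂) →
      N * (f * g + C) ≡ (C + C₁) + (f * (N * g) + C₂)
    leibniz-step N f g C C₁ C₂ NC = trans
      (solve 4 (λ N f g C → N :* (f :* g :+ C) := f :* (N :* g) :+ N :* C) refl N f g C)
      (trans (cong (f * (N * g) +_) NC)
        (solve 4 (λ u C C₁ C₂ → u :+ (C :+ (C₁ :+ C₂)) := (C :+ C₁) :+ (u :+ C₂)) refl (f * (N * g)) C C₁ C₂))

    -- The product rule for x d/dx, that is, k = i + (k - i) in each term of the Cauchy product. It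
    -- takes the place of binomial coefficients in the addition theorem.
    conv-θ : ∀ f g k → θ (conv f g) k ≡ conv (θ f) g k + conv f (θ g) k
    conv-θ f g zero = trans (θ-zero (conv f g)) (sym (trans
      (cong₂ _+_ (trans (conv-zero (θ f) g) (trans (cong (_* g 0) (θ-zero f)) (ℚₚ.*-zeroˡ (g 0))))
                 (trans (conv-zero f (θ g)) (trans (cong (f 0 *_) (θ-zero g)) (ℚₚ.*-zeroʳ (f 0)))))
      (ℚₚ.+-identityˡ 0ℚ)))
    conv-θ f g (suc k) = trans (θ-def (conv f g) (suc k)) (trans (cong (fromℕ (suc k) *_) (conv-suc f g k))
      (trans (leibniz-step (fromℕ (suc k)) (f 0) (g (suc k)) _ _ _ step)
        (cong₂ _+_ (sym left) (sym right))))
      where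
      step : fromℕ (suc k) * conv (shift f) g k
        ≡ conv (shift f) g k + (conv (θ (shift f)) g k + conv (shift f) (θ g) k)
      step = trans (θ-suc′ (conv (shift f) g)) (cong (conv (shift f) g k +_) (conv-θ (shift f) g k))
        where
        θ-suc′ : ∀ c → fromℕ (suc k) * c k ≡ c k + θ c k
        θ-suc′ c = trans (cong (_* c k) (fromℕ-suc k)) (trans (ℚₚ.*-distribʳ-+ (c k) 1ℚ (fromℕ k))
          (cong₂ _+_ (ℚₚ.*-identityˡ (c k)) (sym (θ-def c k))))
      left : conv (θ f) g (suc k) ≡ conv (shift f) g k + conv (θ (shift f)) g k
      left = trans (conv-suc (θ f) g k) (trans
          (cong₂ _+_ (trans (cong (_* g (suc k)) (θ-zero f)) (ℚₚ.*-zeroˡ (g (suc k))))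
        (trans (conv-congˡ g (θ-suc f) k) (conv-+ˡ (shift f) (θ (shift f)) g k))) (ℚₚ.+-identityˡ _))
      right : conv f (θ g) (suc k) ≡ f 0 * (fromℕ (suc k) * g (suc k)) + conv (shift f) (θ g) k
      right = trans (conv-suc f (θ g) k) (cong (λ z → f 0 * z + conv (shift f) (θ g) k) (θ-def g (suc k)))

    partialSum-shift : ∀ f n → partialSum f (suc n) ≡ f 0 + partialSum (shift f) n
    partialSum-shift f zero    = ℚₚ.+-comm 0ℚ (f 0)
    partialSum-shift f (suc n) = trans (cong (_+ f (suc n)) (partialSum-shift f n))
      (ℚₚ.+-assoc (f 0) (partialSum (shift f) n) (f (suc n)))

    partialSum-conv : ∀ f g n → partialSum (conv f g) (suc n) ≡ f 0 * partialSum g (suc n) + partialSum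
        (conv (shift f) g) n
    partialSum-conv f g zero = solve 2 (λ f g → con 0ℚ :+ f :* g := f :* (con 0ℚ :+ g) :+ con 0ℚ) refl (f 0) (g 0)
    partialSum-conv f g (suc n) = trans (cong (_+ conv f g (suc n)) (partialSum-conv f g n))
      (solve 5 (λ f p q g c → (f :* p :+ q) :+ (f :* g :+ c) := f :* (p :+ g) :+ (q :+ c)) refl
        (f 0) (partialSum g (suc n)) (partialSum (conv (shift f) g) n) (g (suc n)) (conv (shift f) g n))

  -- For m ≤ n this is the sum of f(i) g(j) over i < m, j < n and i + j ≥ m: the part of a rectangle
  -- outside a triangle.
  defect : (f g : ℕ → ℚ) → ℕ → ℕ → ℚ
  defect f g m n = partialSum f m * partialSum g n - partialSum (conv f g) m

  opaque
    defect-suc : ∀ f g m n → defect f g (suc m) n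
      ≡ f 0 * (partialSum g n - partialSum g (suc m)) + defect (shift f) g m n
    defect-suc f g m n = trans
      (cong₂ (λ u v → u * partialSum g n - v) (partialSum-shift f m) (partialSum-conv f g m))
      (solve 5 (λ f p q r c → (f :+ p) :* q :- (f :* r :+ c) := f :* (q :- r) :+ (p :* q :- c)) refl
        (f 0) (partialSum (shift f) m) (partialSum g n) (partialSum g (suc m)) (partialSum (conv (shift f) g) m))

    partialSum-gap : ∀ {g G} → (∀ k → ∣ g k ∣ ≤ G k) → ∀ {m n} → m ℕ.≤′ n →
      ∣ partialSum g n - partialSum g m ∣ ≤ partialSum G n - partialSum G m
    partialSum-gap {g} {G} g≤G {m} ℕ.≤′-refl = ℚₚ.≤-reflexive
      (trans (cong ∣_∣ (ℚₚ.+-inverseʳ (partialSum g m))) (sym (ℚₚ.+-inverseʳ (partialSum G m))))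
    partialSum-gap {g} {G} g≤G {m} (ℕ.≤′-step {n = n} m≤n) = begin
      ∣ (partialSum g n + g n) - partialSum g m ∣
        ≡⟨ cong ∣_∣ (solve 3 (λ a b c → (a :+ b) :- c := (a :- c) :+ b) refl (partialSum g n) (g n)
            (partialSum g m)) ⟩
      ∣ (partialSum g n - partialSum g m) + g n ∣
        ≤⟨ ℚₚ.∣p+q∣≤∣p∣+∣q∣ (partialSum g n - partialSum g m) (g n) ⟩
      ∣ partialSum g n - partialSum g m ∣ + ∣ g n ∣
        ≤⟨ ℚₚ.+-mono-≤ (partialSum-gap g≤G m≤n) (g≤G n) ⟩
      (partialSum G n - partialSum G m) + G n
        ≡⟨ solve 3 (λ a b c → (a :- c) :+ b := (a :+ b) :- c) refl (partialSum G n) (G n) (partialSum G m) ⟩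
      (partialSum G n + G n) - partialSum G m ∎

    -- Because m ≤ n, the triangle lies inside the rectangle, so the defect is a sum of products
    -- f(i) g(j), each with coefficient 1, and may be dominated term by term.
    defect-bound : ∀ {f g F G} → (∀ k → ∣ f k ∣ ≤ F k) → (∀ k → ∣ g k ∣ ≤ G k) →
      ∀ {m n} → m ℕ.≤ n → ∣ defect f g m n ∣ ≤ defect F G m n
    defect-bound {f} {g} {F} {G} f≤F g≤G {zero} {n} _ = ℚₚ.≤-reflexive (trans
      (cong ∣_∣ (solve 1 (λ p → con 0ℚ :* p :- con 0ℚ := con 0ℚ) refl (partialSum g n)))
      (sym (solve 1 (λ p → con 0ℚ :* p :- con 0ℚ := con 0ℚ) refl (partialSum G n))))
    defect-bound {f} {g} {F} {G} f≤F g≤G {suc m} {n} m<n = begin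
      ∣ defect f g (suc m) n ∣ ≡⟨ cong ∣_∣ (defect-suc f g m n) ⟩
      ∣ f 0 * Δ + defect (shift f) g m n ∣ ≤⟨ ℚₚ.∣p+q∣≤∣p∣+∣q∣ (f 0 * Δ) (defect (shift f) g m n) ⟩
      ∣ f 0 * Δ ∣ + ∣ defect (shift f) g m n ∣
        ≤⟨ ℚₚ.+-mono-≤ (ℚₚ.≤-trans (ℚₚ.≤-reflexive (ℚₚ.∣p*q∣≡∣p∣*∣q∣ (f 0) Δ))
             (*-mono-≤ (ℚₚ.0≤∣p∣ (f 0)) (f≤F 0) (ℚₚ.0≤∣p∣ Δ) (partialSum-gap g≤G (ℕₚ.≤⇒≤′ m<n))))
             (defect-bound (λ k → f≤F (suc k)) g≤G (ℕₚ.<⇒≤ m<n)) ⟩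
      F 0 * (partialSum G n - partialSum G (suc m)) + defect (shift F) G m n ≡⟨ defect-suc F G m n ⟨
      defect F G (suc m) n ∎
      where
      Δ : ℚ
      Δ = partialSum g n - partialSum g (suc m)

    conv-nonneg : ∀ {f g} → (∀ k → 0ℚ ≤ f k) → (∀ k → 0ℚ ≤ g k) → ∀ k → 0ℚ ≤ conv f g k
    conv-nonneg 0≤f 0≤g zero    = *-nonneg (0≤f 0) (0≤g 0)
    conv-nonneg 0≤f 0≤g (suc k) = ℚₚ.≤-trans (*-nonneg (0≤f 0) (0≤g (suc k)))
      (p≤p+q (conv-nonneg (λ i → 0≤f (suc i)) 0≤g k))

    partialSum-nonneg : ∀ {f} → (∀ k → 0ℚ ≤ f k) → ∀ n → 0ℚ ≤ partialSum f n
    partialSum-nonneg 0≤f zero    = ℚₚ.≤-refl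
    partialSum-nonneg 0≤f (suc n) = ℚₚ.≤-trans (partialSum-nonneg 0≤f n) (p≤p+q (0≤f n))

    partialSum-mono : ∀ {f} → (∀ k → 0ℚ ≤ f k) → ∀ {m n} → m ℕ.≤′ n → partialSum f m ≤ partialSum f n
    partialSum-mono 0≤f ℕ.≤′-refl       = ℚₚ.≤-refl
    partialSum-mono 0≤f (ℕ.≤′-step m≤n) = ℚₚ.≤-trans (partialSum-mono 0≤f m≤n) (p≤p+q (0≤f _))

    -- The rectangle i < m, j < n lies inside the triangle i + j < m + n, and all terms are
    -- nonnegative.
    product≤partialSum-conv : ∀ {f g} → (∀ k → 0ℚ ≤ f k) → (∀ k → 0ℚ ≤ g k) →
      ∀ m n → partialSum f m * partialSum g n ≤ partialSum (conv f g) (m ℕ.+ n)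
    product≤partialSum-conv {f} {g} 0≤f 0≤g zero n = ℚₚ.≤-trans
      (ℚₚ.≤-reflexive (ℚₚ.*-zeroˡ (partialSum g n))) (partialSum-nonneg (conv-nonneg 0≤f 0≤g) n)
    product≤partialSum-conv {f} {g} 0≤f 0≤g (suc m) n = begin
      partialSum f (suc m) * partialSum g n ≡⟨ cong (_* partialSum g n) (partialSum-shift f m) ⟩
      (f 0 + partialSum (shift f) m) * partialSum g n
        ≡⟨ ℚₚ.*-distribʳ-+ (partialSum g n) (f 0) (partialSum (shift f) m) ⟩
      f 0 * partialSum g n + partialSum (shift f) m * partialSum g n
        ≤⟨ ℚₚ.+-mono-≤
             (ℚₚ.*-monoˡ-≤-nonNeg (f 0) {{nonNegative (0≤f 0)}} (partialSum-mono 0≤g (ℕₚ.≤⇒≤′ (ℕₚ.m≤n+m n (suc m)))))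
             (product≤partialSum-conv (λ k → 0≤f (suc k)) 0≤g m n) ⟩
      f 0 * partialSum g (suc (m ℕ.+ n)) + partialSum (conv (shift f) g) (m ℕ.+ n) ≡⟨ partialSum-conv f g (m ℕ.+ n) ⟨
      partialSum (conv f g) (suc m ℕ.+ n) ∎

-- Partial sums of the exponential series: addition theorem and tangent bound

module ExpSumProperties where
  open ≡ using (refl; sym; trans; cong; cong₂; subst; subst₂)
  open Rat using (_+_; _*_; _-_; -_; ∣_∣; _≤_; _<_; nonNegative)
  open ℚₚ.≤-Reasoning
  open +-*-Solver
  open ℚ-Lemmas
  open ExpSeries
  open Convolution

  opaque
    expSum≡partialSum : ∀ x n → expSum x n ≡ partialSum (expTerm x) n
    expSum≡partialSum x zero    = refl
    expSum≡partialSum x (suc n) = cong (_+ expTerm x n) (expSum≡partialSum x n)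

    θ-expTerm-zero : ∀ x → θ (expTerm x) 0 ≡ 0ℚ
    θ-expTerm-zero x = θ-zero (expTerm x)

    regroup-recip : ∀ N t x r → N * r ≡ 1ℚ → N * (t * (x * r)) ≡ x * t
    regroup-recip N t x r Nr≡1 = trans
      (solve 4 (λ N t x r → N :* (t :* (x :* r)) := (N :* r) :* (x :* t)) refl N t x r)
      (trans (cong (_* (x * t)) Nr≡1) (ℚₚ.*-identityˡ (x * t)))

    θ-expTerm-suc : ∀ x k → θ (expTerm x) (suc k) ≡ x * expTerm x k
    θ-expTerm-suc x k = trans (θ-def (expTerm x) (suc k))
      (regroup-recip (fromℕ (suc k)) (expTerm x k) x (recip k) (recip-inverse k))

    expTerm-step : ∀ N r a b c c₁ c₂ c′ → N * r ≡ 1ℚ → c₁ ≡ a * c → c₂ ≡ b * c → N * c′ ≡ c₁ + c₂ →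
      c′ ≡ c * ((a + b) * r)
    expTerm-step N r a b c _ _ c′ Nr≡1 refl refl eq = trans (sym (ℚₚ.*-identityˡ c′)) (trans (cong (_* c′) (sym Nr≡1))
      (trans (solve 3 (λ N r c → (N :* r) :* c := (N :* c) :* r) refl N r c′) (trans (cong (_* r) eq)
        (solve 4 (λ a b c r → (a :* c :+ b :* c) :* r := c :* ((a :+ b) :* r)) refl a b c r))))

    conv-θˡ-expTerm : ∀ a g k → conv (θ (expTerm a)) g (suc k) ≡ a * conv (expTerm a) g k
    conv-θˡ-expTerm a g k = trans (conv-suc (θ (expTerm a)) g k)
      (trans (cong₂ _+_ (trans (cong (_* g (suc k)) (θ-expTerm-zero a)) (ℚₚ.*-zeroˡ (g (suc k))))
          (trans (conv-congˡ g (θ-expTerm-suc a) k) (conv-*ˡ a (expTerm a) g k)))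
        (ℚₚ.+-identityˡ (a * conv (expTerm a) g k)))

    conv-θʳ-expTerm : ∀ b f k → conv f (θ (expTerm b)) (suc k) ≡ b * conv f (expTerm b) k
    conv-θʳ-expTerm b f k = trans (conv-sucʳ f (θ (expTerm b)) k)
      (trans (cong₂ _+_ (trans (conv-congʳ f (θ-expTerm-suc b) k) (conv-*ʳ b f (expTerm b) k))
          (trans (cong (f (suc k) *_) (θ-expTerm-zero b)) (ℚₚ.*-zeroʳ (f (suc k)))))
        (ℚₚ.+-identityʳ (b * conv f (expTerm b) k)))

    -- The binomial theorem divided by k!. By `conv-θ`, the Cauchy product satisfies (k + 1) c(k+1)
    -- = (a + b) c(k), which is the recursion of the terms for a + b.
    expTerm-+ : ∀ a b k → conv (expTerm a) (expTerm b) k ≡ expTerm (a + b) k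
    expTerm-+ a b zero    = ℚₚ.*-identityˡ 1ℚ
    expTerm-+ a b (suc k) = trans
      (expTerm-step (fromℕ (suc k)) (recip k) a b (conv (expTerm a) (expTerm b) k)
        (conv (θ (expTerm a)) (expTerm b) (suc k)) (conv (expTerm a) (θ (expTerm b)) (suc k))
        (conv (expTerm a) (expTerm b) (suc k)) (recip-inverse k)
        (conv-θˡ-expTerm a (expTerm b) k) (conv-θʳ-expTerm b (expTerm a) k)
        (conv-θ (expTerm a) (expTerm b) (suc k)))
      (cong (_* ((a + b) * recip k)) (expTerm-+ a b k))

    partialSum-cong : ∀ {f g} → (∀ k → f k ≡ g k) → ∀ n → partialSum f n ≡ partialSum g n
    partialSum-cong eq zero    = refl
    partialSum-cong eq (suc n) = cong₂ _+_ (partialSum-cong eq n) (eq n)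

    expSum-+ : ∀ a b n → partialSum (conv (expTerm a) (expTerm b)) n ≡ expSum (a + b) n
    expSum-+ a b n = trans (partialSum-cong (expTerm-+ a b) n) (sym (expSum≡partialSum (a + b) n))

    -- Domination replaces `a` and `b` by `K`; the defect for `K` is then at most a stretch, from n
    -- to 2n, of the series for e^(2K). This stretch tends to zero.
    expSum-product-gap : ∀ {K a b} → 0ℚ < K → ∣ a ∣ ≤ K → ∣ b ∣ ≤ K → ∀ n →
      ∣ expSum a n * expSum b n - expSum (a + b) n ∣ ≤ expSum (K + K) (n ℕ.+ n) - expSum (K + K) n
    expSum-product-gap {K} {a} {b} 0<K a≤K b≤K n = begin
      ∣ expSum a n * expSum b n - expSum (a + b) n ∣
        ≡⟨ cong ∣_∣ (cong₂ _-_ (cong₂ _*_ (expSum≡partialSum a n) (expSum≡partialSum b n)) (sym (expSum-+ a b n))) ⟩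
      ∣ defect (expTerm a) (expTerm b) n n ∣
        ≤⟨ defect-bound {expTerm a} {expTerm b} {expTerm K} {expTerm K}
             (term-bound 0<K a≤K) (term-bound 0<K b≤K) {n} {n} ℕₚ.≤-refl ⟩
      defect (expTerm K) (expTerm K) n n
        ≤⟨ ℚₚ.+-monoˡ-≤ (- partialSum (conv (expTerm K) (expTerm K)) n)
             (product≤partialSum-conv (0≤t 0<K) (0≤t 0<K) n n) ⟩
      partialSum (conv (expTerm K) (expTerm K)) (n ℕ.+ n) - partialSum (conv (expTerm K) (expTerm K)) n
        ≡⟨ cong₂ _-_ (expSum-+ K K (n ℕ.+ n)) (expSum-+ K K n) ⟩
      expSum (K + K) (n ℕ.+ n) - expSum (K + K) n ∎

    expTerm-nonneg : ∀ {x} → 0ℚ ≤ x → ∀ k → 0ℚ ≤ expTerm x k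
    expTerm-nonneg 0≤x zero    = 0≤1
    expTerm-nonneg 0≤x (suc k) = *-nonneg (expTerm-nonneg 0≤x k) (*-nonneg 0≤x (ℚₚ.<⇒≤ (0<recip k)))

    expTerm-1 : ∀ x → expTerm x 1 ≡ x
    expTerm-1 x = trans (ℚₚ.*-identityˡ (x * recip 0)) (trans (cong (x *_) recip-zero) (ℚₚ.*-identityʳ x))

    expSum-2 : ∀ x → expSum x 2 ≡ 1ℚ + x
    expSum-2 x = cong₂ _+_ (ℚₚ.+-identityˡ 1ℚ) (expTerm-1 x)

    expSum-lower-nonneg : ∀ {x} → 0ℚ ≤ x → ∀ n → 1ℚ + x ≤ expSum x (suc (suc n))
    expSum-lower-nonneg {x} 0≤x zero    = ℚₚ.≤-reflexive (sym (expSum-2 x))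
    expSum-lower-nonneg {x} 0≤x (suc n) =
      ℚₚ.≤-trans (expSum-lower-nonneg 0≤x n) (p≤p+q (expTerm-nonneg 0≤x (suc (suc n))))

    recip≤1 : ∀ k → recip k ≤ 1ℚ
    recip≤1 k = begin
      recip k                 ≡⟨ ℚₚ.*-identityˡ (recip k) ⟨
      1ℚ * recip k            ≤⟨ ℚₚ.*-monoʳ-≤-nonNeg (recip k) {{nonNegative (ℚₚ.<⇒≤ (0<recip k))}}
        (subst (1ℚ ≤_) (sym (fromℕ-suc k)) (p≤p+q (0≤fromℕ k))) ⟩
      fromℕ (suc k) * recip k ≡⟨ recip-inverse k ⟩
      1ℚ                      ∎

    neg-nonneg : ∀ {x} → x ≤ 0ℚ → 0ℚ ≤ - x
    neg-nonneg x≤0 = ℚₚ.neg-antimono-≤ x≤0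

    -- The new quantity is (R + u)(1 + x r) + R (-x r), and both weights are nonnegative because -1
    -- ≤ x r ≤ 0.
    alternating-step : ∀ {R u x r} → - 1ℚ ≤ x → x ≤ 0ℚ → 0ℚ ≤ r → r ≤ 1ℚ → 0ℚ ≤ R → 0ℚ ≤ R + u →
      0ℚ ≤ (R + u) + u * (x * r)
    alternating-step {R} {u} {x} {r} -1≤x x≤0 0≤r r≤1 0≤R 0≤R+u = subst (0ℚ ≤_)
      (solve 4 (λ R u x r → (R :+ u) :* ((con 1ℚ :- r) :+ (x :- (:- con 1ℚ)) :* r) :+ R :* (:- x :* r)
        := (R :+ u) :+ u :* (x :* r)) refl R u x r)
      (ℚₚ.≤-trans
        (*-nonneg 0≤R+u (ℚₚ.≤-trans (0≤-minus r≤1) (p≤p+q (*-nonneg (0≤-minus -1≤x) 0≤r))))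
        (p≤p+q (*-nonneg 0≤R (*-nonneg (neg-nonneg x≤0) 0≤r))))
      where
      0≤-minus : ∀ {p q} → p ≤ q → 0ℚ ≤ q - p
      0≤-minus {p} {q} p≤q = subst (_≤ q - p) (ℚₚ.+-inverseʳ p) (ℚₚ.+-monoˡ-≤ (- p) p≤q)

    -- The terms alternate and decrease, so both the remainder R and R plus the next term stay nonnegative.
    expSum-lower-alternating : ∀ {x} → - 1ℚ ≤ x → x ≤ 0ℚ → ∀ n → ∃ λ R →
      expSum x (suc (suc n)) ≡ (1ℚ + x) + R × 0ℚ ≤ R × 0ℚ ≤ R + expTerm x (suc (suc n))
    expSum-lower-alternating {x} -1≤x x≤0 zero = 0ℚ ,
      trans (expSum-2 x) (sym (ℚₚ.+-identityʳ (1ℚ + x))) , ℚₚ.≤-refl ,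
      subst (0ℚ ≤_) (trans (sym second) (sym (ℚₚ.+-identityˡ (expTerm x 2))))
        (*-nonneg (*-nonneg (neg-nonneg x≤0) (neg-nonneg x≤0)) (ℚₚ.<⇒≤ (0<recip 1)))
      where
      second : expTerm x 2 ≡ (- x * - x) * recip 1
      second = trans (cong (_* (x * recip 1)) (expTerm-1 x))
        (solve 2 (λ x r → x :* (x :* r) := (:- x :* :- x) :* r) refl x (recip 1))
    expSum-lower-alternating {x} -1≤x x≤0 (suc n) = next (expSum-lower-alternating -1≤x x≤0 n)
      where
      u : ℚ
      u = expTerm x (suc (suc n))
      next : (∃ λ R → expSum x (suc (suc n)) ≡ (1ℚ + x) + R × 0ℚ ≤ R × 0ℚ ≤ R + u) →
        ∃ λ R → expSum x (suc (suc n)) + u ≡ (1ℚ + x) + R × 0ℚ ≤ R × 0ℚ ≤ R + u * (x * recip (suc (suc n)))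
      next (R , eq , 0≤R , 0≤R+u) = R + u ,
        trans (cong (_+ u) eq) (ℚₚ.+-assoc (1ℚ + x) R u) , 0≤R+u ,
        alternating-step -1≤x x≤0 (ℚₚ.<⇒≤ (0<recip (suc (suc n)))) (recip≤1 (suc (suc n))) 0≤R 0≤R+u

    expSum-lower : ∀ {x} → - 1ℚ ≤ x → ∀ n → 1ℚ + x ≤ expSum x (suc (suc n))
    expSum-lower {x} -1≤x n with ℚₚ.≤-total 0ℚ x
    ... | inj₁ 0≤x = expSum-lower-nonneg 0≤x n
    ... | inj₂ x≤0 with expSum-lower-alternating -1≤x x≤0 n
    ... | R , eq , 0≤R , _ = subst (1ℚ + x ≤_) (sym eq) (p≤p+q 0≤R)

-- Simple random walk

module RationalSums where
  open ≡ using (refl; sym; trans; cong; cong₂; subst; subst₂)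
  open Rat using (_+_; _*_; _≤_)
  open ℚ-Lemmas
  open SemiringSum (CommutativeRing.semiring ℚₚ.+-*-commutativeRing) using
      (sum-cong-≗; ∑-distrib-+; ∑-comm; *-distribˡ-sum; *-distribʳ-sum)

  opaque
    sumℚ-cong : ∀ {n} {f g : Fin n → ℚ} → (∀ i → f i ≡ g i) → sumℚ f ≡ sumℚ g
    sumℚ-cong {n} {f} {g} = sum-cong-≗ {n} {f} {g}

    sumℚ-+ : ∀ {n} (f g : Fin n → ℚ) → sumℚ (λ i → f i + g i) ≡ sumℚ f + sumℚ g
    sumℚ-+ = ∑-distrib-+

    sumℚ-comm : ∀ {m n} (f : Fin m → Fin n → ℚ) → sumℚ (λ i → sumℚ (λ j → f i j)) ≡ sumℚ (λ j → sumℚ (λ i → f i j))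
    sumℚ-comm = ∑-comm

    sumℚ-*ˡ : ∀ {n} k (f : Fin n → ℚ) → sumℚ (λ i → k * f i) ≡ k * sumℚ f
    sumℚ-*ˡ k f = sym (*-distribˡ-sum k f)

    sumℚ-*ʳ : ∀ {n} (f : Fin n → ℚ) k → sumℚ (λ i → f i * k) ≡ sumℚ f * k
    sumℚ-*ʳ f k = sym (*-distribʳ-sum k f)

    sumℚ-mono : ∀ {n} {f g : Fin n → ℚ} → (∀ i → f i ≤ g i) → sumℚ f ≤ sumℚ g
    sumℚ-mono {zero}  f≤g = ℚₚ.≤-refl
    sumℚ-mono {suc n} f≤g = ℚₚ.+-mono-≤ (f≤g zero) (sumℚ-mono (λ i → f≤g (suc i)))

    sumℚ-zero : ∀ {n} {f : Fin n → ℚ} → (∀ i → f i ≡ 0ℚ) → sumℚ f ≡ 0ℚ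
    sumℚ-zero {zero}  f≡0 = refl
    sumℚ-zero {suc n} f≡0 = trans (cong₂ _+_ (f≡0 zero) (sumℚ-zero (λ i → f≡0 (suc i)))) (ℚₚ.+-identityˡ 0ℚ)

    sumℚ-nonneg : ∀ {n} {f : Fin n → ℚ} → (∀ i → 0ℚ ≤ f i) → 0ℚ ≤ sumℚ f
    sumℚ-nonneg {n} {f} 0≤f = subst (_≤ sumℚ f) (sumℚ-zero {n} (λ _ → refl)) (sumℚ-mono 0≤f)

    term≤sumℚ : ∀ {n} {f : Fin n → ℚ} → (∀ i → 0ℚ ≤ f i) → ∀ i → f i ≤ sumℚ f
    term≤sumℚ 0≤f zero    = p≤p+q (sumℚ-nonneg (λ i → 0≤f (suc i)))
    term≤sumℚ 0≤f (suc i) = ℚₚ.≤-trans (term≤sumℚ (λ i → 0≤f (suc i)) i) (p≤q+p (0≤f zero))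

    sumℚ-identityˡ : ∀ {n} x (f : Fin n → ℚ) → sumℚ (λ y → identity x y * f y) ≡ f x
    sumℚ-identityˡ zero    f = trans (cong₂ _+_ (ℚₚ.*-identityˡ (f zero)) (sumℚ-zero (λ i → ℚₚ.*-zeroˡ (f (suc i)))))
      (ℚₚ.+-identityʳ (f zero))
    sumℚ-identityˡ (suc x) f = trans (cong₂ _+_ (ℚₚ.*-zeroˡ (f zero)) (sumℚ-identityˡ x (λ i → f (suc i))))
      (ℚₚ.+-identityˡ (f (suc x)))

    identity-sym : ∀ {n} (x y : Fin n) → identity x y ≡ identity y x
    identity-sym zero    zero    = refl
    identity-sym zero    (suc y) = refl
    identity-sym (suc x) zero    = refl
    identity-sym (suc x) (suc y) = identity-sym x y

    identity-nonneg : ∀ {n} (x y : Fin n) → 0ℚ ≤ identity x y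
    identity-nonneg x y with does (x Fin.≟ y)
    ... | true  = 0≤1
    ... | false = ℚₚ.≤-refl

    identity-≡ : ∀ {n} (x : Fin n) → identity x x ≡ 1ℚ
    identity-≡ zero    = refl
    identity-≡ (suc x) = identity-≡ x

    identity-≢ : ∀ {n} {x y : Fin n} → ¬ (x ≡ y) → identity x y ≡ 0ℚ
    identity-≢ {x = x} {y} x≢y with x Fin.≟ y
    ... | yes x≡y = ⊥-elim (x≢y x≡y)
    ... | no _    = refl

    term≤foldr-⊔ : ∀ {n} (f : Fin n → ℚ) i → f i ≤ Vector.foldr Rat._⊔_ 0ℚ f
    term≤foldr-⊔ f zero    = ℚₚ.p≤p⊔q (f zero) _
    term≤foldr-⊔ f (suc i) = ℚₚ.≤-trans (term≤foldr-⊔ (λ i → f (suc i)) i) (ℚₚ.p≤q⊔p (f zero) _)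

module NaturalFractions where
  open ≡ using (refl; sym; trans; cong; cong₂; subst; subst₂)
  open Rat using (_+_; _*_; _≤_; _<_)
  open ℚ-Lemmas
  open RationalSums

  -- 1/n, with 1/0 = 0 as for _over_.
  inv : ℕ → ℚ
  inv zero    = 0ℚ
  inv (suc k) = recip k

  opaque
    unfolding fromℕ recip

    /-as-* : ∀ a k → ℤ.+ a Rat./ suc k ≡ fromℕ a * recip k
    /-as-* a k = ℚₚ.toℚᵘ-injective (R.begin-equality
      Rat.toℚᵘ (ℤ.+ a Rat./ suc k) R.≃⟨ ℚₚ.toℚᵘ-fromℚᵘ (ℚᵘ.mkℚᵘ (ℤ.+ a) k) ⟩
      ℚᵘ.mkℚᵘ (ℤ.+ a) k R.≃⟨ ℚᵘ.*≡* eq ⟩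
      ℚᵘ.mkℚᵘ (ℤ.+ a) 0 ℚᵘ.* ℚᵘ.mkℚᵘ (ℤ.+ 1) k
        R.≃⟨ ℚᵘₚ.*-cong (ℚₚ.toℚᵘ-fromℚᵘ (ℚᵘ.mkℚᵘ (ℤ.+ a) 0)) (ℚₚ.toℚᵘ-fromℚᵘ (ℚᵘ.mkℚᵘ (ℤ.+ 1) k)) ⟨
      Rat.toℚᵘ (fromℕ a) ℚᵘ.* Rat.toℚᵘ (recip k) R.≃⟨ ℚₚ.toℚᵘ-homo-* (fromℕ a) (recip k) ⟨
      Rat.toℚᵘ (fromℕ a * recip k) R.∎)
      where
      module R = ℚᵘₚ.≤-Reasoning
      eq : ℤ.+ a ℤ.* ℤ.+ (1 ℕ.* suc k) ≡ (ℤ.+ a ℤ.* ℤ.+ 1) ℤ.* ℤ.+ suc k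
      eq = cong₂ ℤ._*_ (sym (ℤₚ.*-identityʳ (ℤ.+ a))) (cong (λ j → ℤ.+ suc j) (ℕₚ.+-identityʳ k))

    /1≡fromℕ : ∀ a → ℤ.+ a Rat./ 1 ≡ fromℕ a
    /1≡fromℕ a = refl

  opaque
    over≡ : ∀ a b → a over b ≡ fromℕ a * inv b
    over≡ a zero    = sym (ℚₚ.*-zeroʳ (fromℕ a))
    over≡ a (suc k) = /-as-* a k

    fromℕ-1 : fromℕ 1 ≡ 1ℚ
    fromℕ-1 = trans (fromℕ-suc 0) (trans (cong (1ℚ +_) fromℕ-zero) (ℚₚ.+-identityʳ 1ℚ))

    1over≡ : ∀ b → 1 over b ≡ inv b
    1over≡ b = trans (over≡ 1 b) (trans (cong (_* inv b) fromℕ-1) (ℚₚ.*-identityˡ (inv b)))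

    inv-inverse : ∀ {b} → 0 ℕ.< b → fromℕ b * inv b ≡ 1ℚ
    inv-inverse {suc k} _ = recip-inverse k

    0≤inv : ∀ b → 0ℚ ≤ inv b
    0≤inv zero    = ℚₚ.≤-refl
    0≤inv (suc k) = ℚₚ.<⇒≤ (0<recip k)

    0<inv : ∀ {b} → 0 ℕ.< b → 0ℚ < inv b
    0<inv {suc k} _ = 0<recip k

    0<fromℕ : ∀ {b} → 0 ℕ.< b → 0ℚ < fromℕ b
    0<fromℕ {suc k} _ = ℚₚ.<-≤-trans 0<1 (subst (1ℚ ≤_) (sym (fromℕ-suc k)) (p≤p+q (0≤fromℕ k)))

    fromℕ-+ : ∀ m n → fromℕ (m ℕ.+ n) ≡ fromℕ m + fromℕ n
    fromℕ-+ zero    n = sym (trans (cong (_+ fromℕ n) fromℕ-zero) (ℚₚ.+-identityˡ (fromℕ n)))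
    fromℕ-+ (suc m) n = trans (fromℕ-suc (m ℕ.+ n)) (trans (cong (1ℚ +_) (fromℕ-+ m n))
      (trans (sym (ℚₚ.+-assoc 1ℚ (fromℕ m) (fromℕ n))) (cong (_+ fromℕ n) (sym (fromℕ-suc m)))))

    fromℕ-sum : ∀ {n} (f : Fin n → ℕ) → fromℕ (RawMonoidDefinitions.sum ℕ.+-0-rawMonoid f) ≡ sumℚ (λ i → fromℕ (f i))
    fromℕ-sum {zero}  f = fromℕ-zero
    fromℕ-sum {suc n} f = trans (fromℕ-+ (f zero) _) (cong (fromℕ (f zero) +_) (fromℕ-sum (λ i → f (suc i))))

    -- Turns the list length that defines `degree` into a row sum of the adjacency matrix, where
    -- sums can be interchanged and compared.
    fromℕ-length-filter : ∀ {A : Set} {P : Pred A 0ℓ} (P? : Decidable P) {m} (g : Fin m → A) →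
      fromℕ (length (filter P? (tabulate g))) ≡ sumℚ (λ i → if does (P? (g i)) then 1ℚ else 0ℚ)
    fromℕ-length-filter P? {zero}  g = fromℕ-zero
    fromℕ-length-filter P? {suc m} g with does (P? (g zero))
    ... | true  = trans (fromℕ-suc _) (cong (1ℚ +_) (fromℕ-length-filter P? (λ i → g (suc i))))
    ... | false = trans (fromℕ-length-filter P? (λ i → g (suc i))) (sym (ℚₚ.+-identityˡ _))

-- Reversibility, overlap with the stationary distribution and hitting probabilities

module WalkProperties {n : ℕ} (G : SimpleGraph n) where
  open ≡ using (refl; sym; trans; cong; cong₂; subst; subst₂)
  open SimpleGraph G
  open RandomWalk G
  open Rat using (_+_; _*_; _-_; -_; ∣_∣; _≤_; _<_; nonNegative)
  open ℚ-Lemmas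
  open RationalSums
  open NaturalFractions
  open +-*-Solver
  open ℚₚ.≤-Reasoning

  adjacency : Fin n → Fin n → ℚ
  adjacency x y = if does (x ~? y) then 1ℚ else 0ℚ

  degreeSum : ℕ
  degreeSum = RawMonoidDefinitions.sum ℕ.+-0-rawMonoid degree

  opaque
    adjacency-sym : ∀ x y → adjacency x y ≡ adjacency y x
    adjacency-sym x y with x ~? y | y ~? x
    ... | yes _   | yes _   = refl
    ... | no _    | no _    = refl
    ... | yes x~y | no y≁x  = ⊥-elim (y≁x (symm x~y))
    ... | no x≁y  | yes y~x = ⊥-elim (x≁y (symm y~x))

    adjacency-nonneg : ∀ x y → 0ℚ ≤ adjacency x y
    adjacency-nonneg x y with does (x ~? y)
    ... | true  = 0≤1
    ... | false = ℚₚ.≤-refl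

    adjacency-≁ : ∀ {x y} → ¬ (x ~ y) → adjacency x y ≡ 0ℚ
    adjacency-≁ {x} {y} x≁y with x ~? y
    ... | yes x~y = ⊥-elim (x≁y x~y)
    ... | no _    = refl

    adjacency-~ : ∀ {x y} → x ~ y → adjacency x y ≡ 1ℚ
    adjacency-~ {x} {y} x~y with x ~? y
    ... | yes _  = refl
    ... | no x≁y = ⊥-elim (x≁y x~y)

    degree-sum : ∀ x → sumℚ (adjacency x) ≡ fromℕ (degree x)
    degree-sum x = sym (fromℕ-length-filter (x ~?_) (λ y → y))

    P≡ : ∀ x y → P x y ≡ inv (degree x) * adjacency x y
    P≡ x y with does (x ~? y)
    ... | true  = trans (1over≡ (degree x)) (sym (ℚₚ.*-identityʳ (inv (degree x))))
    ... | false = sym (ℚₚ.*-zeroʳ (inv (degree x)))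

    π≡ : ∀ x → π x ≡ fromℕ (degree x) * inv degreeSum
    π≡ x = over≡ (degree x) degreeSum

    P-nonneg : ∀ x y → 0ℚ ≤ P x y
    P-nonneg x y = subst (0ℚ ≤_) (sym (P≡ x y)) (*-nonneg (0≤inv (degree x)) (adjacency-nonneg x y))

    P-≁ : ∀ {x y} → ¬ (x ~ y) → P x y ≡ 0ℚ
    P-≁ {x} {y} x≁y = trans (P≡ x y) (trans (cong (inv (degree x) *_) (adjacency-≁ x≁y))
        (ℚₚ.*-zeroʳ (inv (degree x))))

    lazyP-nonneg : ∀ x y → 0ℚ ≤ lazyP x y
    lazyP-nonneg x y = *-nonneg (ℚₚ.<⇒≤ 0<½) (ℚₚ.≤-trans (identity-nonneg x y) (p≤p+q (P-nonneg x y)))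

    lazyStep-nonneg : ∀ t x y → 0ℚ ≤ lazyStep t x y
    lazyStep-nonneg zero    x y = identity-nonneg x y
    lazyStep-nonneg (suc t) x y = sumℚ-nonneg (λ z → *-nonneg (lazyP-nonneg x z) (lazyStep-nonneg t z y))

    lazyP-apply : ∀ x (f : Fin n → ℚ) → sumℚ (λ z → lazyP x z * f z) ≡ ½ * (f x + sumℚ (λ z → P x z * f z))
    lazyP-apply x f = trans (sumℚ-cong (λ z → solve 4 (λ h i p f → h :* (i :+ p) :* f := h :* (i :* f :+ p :* f)) refl
          ½ (identity x z) (P x z) (f z)))
      (trans (sumℚ-*ˡ ½ (λ z → identity x z * f z + P x z * f z))
        (cong (½ *_) (trans (sumℚ-+ (λ z → identity x z * f z) (λ z → P x z * f z))
          (cong (_+ sumℚ (λ z → P x z * f z)) (sumℚ-identityˡ x f)))))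

    lazyStep-1 : ∀ x y → lazyStep 1 x y ≡ lazyP x y
    lazyStep-1 x y = trans (sumℚ-cong (λ z → trans (ℚₚ.*-comm (lazyP x z) (identity z y))
        (cong (_* lazyP x z) (identity-sym z y))))
      (sumℚ-identityˡ y (lazyP x))

    matrix-assoc : ∀ (A B C : Fin n → Fin n → ℚ) x y →
      sumℚ (λ w → A x w * sumℚ (λ z → B w z * C z y)) ≡ sumℚ (λ z → sumℚ (λ w → A x w * B w z) * C z y)
    matrix-assoc A B C x y = trans
      (sumℚ-cong (λ w → sym (sumℚ-*ˡ (A x w) (λ z → B w z * C z y))))
      (trans (sumℚ-comm (λ w z → A x w * (B w z * C z y)))
        (sumℚ-cong (λ z → trans (sumℚ-cong (λ w → sym (ℚₚ.*-assoc (A x w) (B w z) (C z y))))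
          (sumℚ-*ʳ (λ w → A x w * B w z) (C z y)))))

    lazyStep-+ : ∀ m k x y → lazyStep (m ℕ.+ k) x y ≡ sumℚ (λ z → lazyStep m x z * lazyStep k z y)
    lazyStep-+ zero    k x y = sym (sumℚ-identityˡ x (λ z → lazyStep k z y))
    lazyStep-+ (suc m) k x y = trans
      (sumℚ-cong (λ w → cong (lazyP x w *_) (lazyStep-+ m k w y)))
      (matrix-assoc lazyP (lazyStep m) (lazyStep k) x y)

    lazyStep-sucʳ : ∀ t x y → lazyStep (suc t) x y ≡ sumℚ (λ z → lazyStep t x z * lazyP z y)
    lazyStep-sucʳ t x y = trans (cong (λ k → lazyStep k x y) (ℕₚ.+-comm 1 t))
      (trans (lazyStep-+ t 1 x y) (sumℚ-cong (λ z → cong (lazyStep t x z *_) (lazyStep-1 z y))))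

    degree-pos : ∀ {x y} → x ~ y → 0 ℕ.< degree x
    degree-pos {x} {y} x~y = ℕₚ.≰⇒> λ d≤0 → ℚₚ.<-irrefl refl (ℚₚ.<-≤-trans 0<1
      (ℚₚ.≤-trans (ℚₚ.≤-reflexive (sym (adjacency-~ x~y))) (ℚₚ.≤-trans (term≤sumℚ (adjacency-nonneg x) y)
        (ℚₚ.≤-reflexive (trans (degree-sum x) (trans (cong fromℕ (ℕₚ.n≤0⇒n≡0 d≤0)) fromℕ-zero))))))

    π-pos⇒degree-pos : ∀ {v} → 0ℚ < π v → 0 ℕ.< degree v
    π-pos⇒degree-pos {v} 0<πv = ℕₚ.≰⇒> λ d≤0 → ℚₚ.<-irrefl (sym (trans (π≡ v)
      (trans (cong (_* inv degreeSum) (trans (cong fromℕ (ℕₚ.n≤0⇒n≡0 d≤0)) fromℕ-zero))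
          (ℚₚ.*-zeroˡ (inv degreeSum))))) 0<πv

    π-pos⇒degreeSum-pos : ∀ {v} → 0ℚ < π v → 0 ℕ.< degreeSum
    π-pos⇒degreeSum-pos {v} 0<πv = ℕₚ.≰⇒> λ D≤0 → ℚₚ.<-irrefl (sym (trans (π≡ v)
      (trans (cong (λ D → fromℕ (degree v) * inv D) (ℕₚ.n≤0⇒n≡0 D≤0)) (ℚₚ.*-zeroʳ (fromℕ (degree v)))))) 0<πv

    connected⇒degree-pos : Connected → ∀ {v} → 0 ℕ.< degree v → ∀ x → 0 ℕ.< degree x
    connected⇒degree-pos connected {v} 0<d x with connected x v
    ... | []         = 0<d
    ... | x~y ◅ _ = degree-pos x~y

    neighbour : ∀ {x} → 0 ℕ.< degree x → ∃ λ y → x ~ y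
    neighbour {x} 0<d = decide (Fin.any? (x ~?_))
      where
      decide : Dec (∃ λ y → x ~ y) → ∃ λ y → x ~ y
      decide (yes found) = found
      decide (no none)   = ⊥-elim (ℚₚ.<-irrefl
          (trans (sym (sumℚ-zero (λ y → adjacency-≁ (λ x~y → none (y , x~y))))) (degree-sum x)) (0<fromℕ 0<d))

  module Positive (0<degree : ∀ x → 0 ℕ.< degree x) (0<degreeSum : 0 ℕ.< degreeSum) where
    opaque
      P-rowSum : ∀ x → sumℚ (P x) ≡ 1ℚ
      P-rowSum x = trans (sumℚ-cong (P≡ x)) (trans (sumℚ-*ˡ (inv (degree x)) (adjacency x))
        (trans (cong (inv (degree x) *_) (degree-sum x)) (trans (ℚₚ.*-comm (inv (degree x)) (fromℕ (degree x)))
          (inv-inverse (0<degree x)))))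

      P-~ : ∀ {x y} → x ~ y → 0ℚ < P x y
      P-~ {x} {y} x~y = subst (0ℚ <_) (sym (P≡ x y))
          (*-pos (0<inv (0<degree x)) (subst (0ℚ <_) (sym (adjacency-~ x~y)) 0<1))

      P-average-const : ∀ x c → sumℚ (λ y → P x y * c) ≡ c
      P-average-const x c = trans (sumℚ-*ʳ (P x) c) (trans (cong (_* c) (P-rowSum x)) (ℚₚ.*-identityˡ c))

      0<π : ∀ x → 0ℚ < π x
      0<π x = subst (0ℚ <_) (sym (π≡ x)) (*-pos (0<fromℕ (0<degree x)) (0<inv 0<degreeSum))

      π-sum : sumℚ π ≡ 1ℚ
      π-sum = trans (sumℚ-cong π≡) (trans (sumℚ-*ʳ (λ x → fromℕ (degree x)) (inv degreeSum))
        (trans (cong (_* inv degreeSum) (sym (fromℕ-sum degree))) (inv-inverse 0<degreeSum)))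

      π*P : ∀ x y → π x * P x y ≡ inv degreeSum * adjacency x y
      π*P x y = trans (cong₂ _*_ (π≡ x) (P≡ x y))
        (trans (solve 4 (λ d D i a → (d :* D) :* (i :* a) := (d :* i) :* (D :* a)) refl
            (fromℕ (degree x)) (inv degreeSum) (inv (degree x)) (adjacency x y))
          (trans (cong (_* (inv degreeSum * adjacency x y)) (inv-inverse (0<degree x))) (ℚₚ.*-identityˡ _)))

      P-reversible : ∀ x y → π x * P x y ≡ π y * P y x
      P-reversible x y = trans (π*P x y) (trans (cong (inv degreeSum *_) (adjacency-sym x y)) (sym (π*P y x)))

      identity-reversible : ∀ x y → π x * identity x y ≡ π y * identity y x
      identity-reversible x y = transport (x Fin.≟ y)
        where
        transport : Dec (x ≡ y) → π x * identity x y ≡ π y * identity y x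
        transport (yes refl) = refl
        transport (no x≢y) = trans (cong (π x *_) (identity-≢ x≢y)) (trans (ℚₚ.*-zeroʳ (π x))
          (sym (trans (cong (π y *_) (identity-≢ (λ y≡x → x≢y (sym y≡x)))) (ℚₚ.*-zeroʳ (π y)))))

      lazyP-reversible : ∀ x y → π x * lazyP x y ≡ π y * lazyP y x
      lazyP-reversible x y = trans (spread (π x) (identity x y) (P x y))
        (trans (cong₂ (λ u v → ½ * (u + v)) (identity-reversible x y) (P-reversible x y))
          (sym (spread (π y) (identity y x) (P y x))))
        where
        spread : ∀ a i p → a * (½ * (i + p)) ≡ ½ * (a * i + a * p)
        spread a i p = solve 4 (λ h a i p → a :* (h :* (i :+ p)) := h :* (a :* i :+ a :* p)) refl ½ a i p

      -- Detailed balance reads a path backwards, so its first step becomes its last;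
      -- `lazyStep-sucʳ` brings the result back to the defining recursion.
      lazyStep-reversible : ∀ t x y → π x * lazyStep t x y ≡ π y * lazyStep t y x
      lazyStep-reversible zero    x y = identity-reversible x y
      lazyStep-reversible (suc t) x y = begin-equality
        π x * sumℚ (λ z → lazyP x z * lazyStep t z y) ≡⟨ sumℚ-*ˡ (π x) (λ z → lazyP x z * lazyStep t z y) ⟨
        sumℚ (λ z → π x * (lazyP x z * lazyStep t z y))
          ≡⟨ sumℚ-cong (λ z → exchange (π x) (π y) (π z) (lazyP x z) (lazyP z x) (lazyStep t z y) (lazyStep t y z)
               (lazyP-reversible x z) (lazyStep-reversible t z y)) ⟩
        sumℚ (λ z → π y * (lazyStep t y z * lazyP z x)) ≡⟨ sumℚ-*ˡ (π y) (λ z → lazyStep t y z * lazyP z x) ⟩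
        π y * sumℚ (λ z → lazyStep t y z * lazyP z x) ≡⟨ cong (π y *_) (lazyStep-sucʳ t y x) ⟨
        π y * lazyStep (suc t) y x ∎
        where
        exchange : ∀ a b c k k′ l l′ → a * k ≡ c * k′ → c * l ≡ b * l′ → a * (k * l) ≡ b * (l′ * k′)
        exchange a b c k k′ l l′ ak cl = trans (sym (ℚₚ.*-assoc a k l)) (trans (cong (_* l) ak)
          (trans (solve 3 (λ c k l → (c :* k) :* l := (c :* l) :* k) refl c k′ l)
              (trans (cong (_* k′) cl) (ℚₚ.*-assoc b l′ k′))))

      lazyStep-rowSum : ∀ t x → sumℚ (lazyStep t x) ≡ 1ℚ
      lazyStep-rowSum zero x = trans (sumℚ-cong (λ y → sym (ℚₚ.*-identityʳ (identity x y))))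
          (sumℚ-identityˡ x (λ _ → 1ℚ))
      lazyStep-rowSum (suc t) x = trans (sumℚ-comm (λ y z → lazyP x z * lazyStep t z y))
        (trans (sumℚ-cong (λ z → trans (sumℚ-*ˡ (lazyP x z) (lazyStep t z))
            (cong (lazyP x z *_) (lazyStep-rowSum t z))))
          (trans (lazyP-apply x (λ _ → 1ℚ)) (trans (cong (λ u → ½ * (1ℚ + u)) (P-average-const x 1ℚ)) refl)))

      lazyStep≤1 : ∀ t x y → lazyStep t x y ≤ 1ℚ
      lazyStep≤1 t x y = subst (lazyStep t x y ≤_) (lazyStep-rowSum t x) (term≤sumℚ (lazyStep-nonneg t x) y)

      -- min a c, in the form in which total variation controls its sum.
      meet : ℚ → ℚ → ℚ
      meet a c = ½ * ((a + c) - ∣ a - c ∣)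

      meet≤ˡ : ∀ a c → meet a c ≤ a
      meet≤ˡ a c = begin
        ½ * ((a + c) - ∣ a - c ∣) ≤⟨ ℚₚ.*-monoˡ-≤-nonNeg ½ (ℚₚ.+-monoʳ-≤ (a + c) (ℚₚ.neg-antimono-≤ c-a≤)) ⟩
        ½ * ((a + c) - (c - a))   ≡⟨ solve 2 (λ a c → con ½ :* ((a :+ c) :- (c :- a)) := a) refl a c ⟩
        a                         ∎
        where
        c-a≤ : c - a ≤ ∣ a - c ∣
        c-a≤ = subst (c - a ≤_) (∣-∣-sym c a) (p≤∣p∣ (c - a))

      meet≤ʳ : ∀ a c → meet a c ≤ c
      meet≤ʳ a c = begin
        ½ * ((a + c) - ∣ a - c ∣) ≤⟨ ℚₚ.*-monoˡ-≤-nonNeg ½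
            (ℚₚ.+-monoʳ-≤ (a + c) (ℚₚ.neg-antimono-≤ (p≤∣p∣ (a - c)))) ⟩
        ½ * ((a + c) - (a - c))   ≡⟨ solve 2 (λ a c → con ½ :* ((a :+ c) :- (a :- c)) := c) refl a c ⟩
        c                         ∎

      meet-nonneg : ∀ {a c} → 0ℚ ≤ a → 0ℚ ≤ c → 0ℚ ≤ meet a c
      meet-nonneg {a} {c} 0≤a 0≤c = *-nonneg (ℚₚ.<⇒≤ 0<½) (difference (∣∣-≤
        (ℚₚ.+-monoʳ-≤ a (ℚₚ.≤-trans (ℚₚ.neg-antimono-≤ 0≤c) 0≤c))
        (subst (_≤ a + c) (solve 2 (λ a c → :- a :+ c := :- (a :- c)) refl a c)
          (ℚₚ.+-monoˡ-≤ c (ℚₚ.≤-trans (ℚₚ.neg-antimono-≤ 0≤a) 0≤a)))))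
        where
        difference : ∀ {p q} → p ≤ q → 0ℚ ≤ q - p
        difference {p} {q} p≤q = subst (_≤ q - p) (ℚₚ.+-inverseʳ p) (ℚₚ.+-monoˡ-≤ (- p) p≤q)

      -- Expand (c - a)(c - b) ≥ 0.
      product-lower : ∀ {a b c} → a ≤ c → b ≤ c → c * ((a + b) - c) ≤ a * b
      product-lower {a} {b} {c} a≤c b≤c = begin
        c * ((a + b) - c) ≤⟨ p≤q+p (*-nonneg (difference a≤c) (difference b≤c)) ⟩
        (c - a) * (c - b) + c * ((a + b) - c)
          ≡⟨ solve 3 (λ a b c → (c :- a) :* (c :- b) :+ c :* ((a :+ b) :- c) := a :* b) refl a b c ⟩
        a * b ∎
        where
        difference : ∀ {p q} → p ≤ q → 0ℚ ≤ q - p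
        difference {p} {q} p≤q = subst (_≤ q - p) (ℚₚ.+-inverseʳ p) (ℚₚ.+-monoˡ-≤ (- p) p≤q)

      -- Cutting both factors off at `c` only decreases the product, and afterwards both lie below
      -- `c`, as `product-lower` requires.
      meet-product : ∀ {a b c} → 0ℚ ≤ a → 0ℚ ≤ b → 0ℚ ≤ c →
        c * ((meet a c + meet b c) - c) ≤ a * b
      meet-product {a} {b} {c} 0≤a 0≤b 0≤c = ℚₚ.≤-trans
        (product-lower {meet a c} {meet b c} {c} (meet≤ʳ a c) (meet≤ʳ b c))
        (*-mono-≤ (meet-nonneg 0≤a 0≤c) (meet≤ˡ a c) (meet-nonneg 0≤b 0≤c) (meet≤ˡ b c))

      *-cancelˡ : ∀ {a b} c → 0ℚ < c → c * a ≤ c * b → a ≤ b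
      *-cancelˡ c 0<c = ℚₚ.*-cancelˡ-≤-pos c {{Rat.positive 0<c}}

      -- One intermediate state z of a path from x to v: `a`, `b` and `l` are the t-step
      -- probabilities from x to z, from v to z and from z to v, while `c` = π(z) and `m` = π(v).
      -- Reversibility gives l = m b / c; multiplying through by `c` avoids the quotient.
      return-term : ∀ {a b c l m} → 0ℚ ≤ a → 0ℚ ≤ b → 0ℚ < c → 0ℚ ≤ m → c * l ≡ m * b →
        m * ((meet a c + meet b c) - c) ≤ a * l
      return-term {a} {b} {c} {l} {m} 0≤a 0≤b 0<c 0≤m cl≡mb = *-cancelˡ c 0<c (begin
        c * (m * o) ≡⟨ solve 3 (λ c m o → c :* (m :* o) := m :* (c :* o)) refl c m o ⟩
        m * (c * o) ≤⟨ ℚₚ.*-monoˡ-≤-nonNeg m {{nonNegative 0≤m}} (meet-product 0≤a 0≤b (ℚₚ.<⇒≤ 0<c)) ⟩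
        m * (a * b) ≡⟨ solve 3 (λ m a b → m :* (a :* b) := a :* (m :* b)) refl m a b ⟩
        a * (m * b) ≡⟨ cong (a *_) cl≡mb ⟨
        a * (c * l) ≡⟨ solve 3 (λ a c l → a :* (c :* l) := c :* (a :* l)) refl a c l ⟩
        c * (a * l) ∎)
        where
        o : ℚ
        o = (meet a c + meet b c) - c

      tv≤½ : ∀ {t} → Mixed t → ∀ x → sumℚ (λ y → ∣ lazyStep t x y - π y ∣) ≤ ½
      tv≤½ {t} (_ , tv) x = *-cancelˡ ½ 0<½ (ℚₚ.≤-trans (term≤foldr-⊔ (tvFrom t) x) tv)

      -- The overlap of two distributions is 1 minus their total variation distance, here at least
      -- 3/4. Two such overlaps with π, one from x and one from v, leave 3/4 + 3/4 - 1 = 1/2 in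
      -- `lazyStep-2t-lower`.
      meet-sum : ∀ {t} → Mixed t → ∀ x → ½ + ½ * ½ ≤ sumℚ (λ z → meet (lazyStep t x z) (π z))
      meet-sum {t} mixed x = begin
        ½ * ((1ℚ + 1ℚ) - ½)
          ≤⟨ ℚₚ.*-monoˡ-≤-nonNeg ½ (ℚₚ.+-monoʳ-≤ (1ℚ + 1ℚ) (ℚₚ.neg-antimono-≤ (tv≤½ {t} mixed x))) ⟩
        ½ * ((1ℚ + 1ℚ) - D)
          ≡⟨ cong (½ *_) (cong₂ _+_ (cong₂ _+_ (lazyStep-rowSum t x) π-sum) (minus-one D)) ⟨
        ½ * ((sumℚ (lazyStep t x) + sumℚ π) + (- 1ℚ) * D)
          ≡⟨ cong (½ *_) (cong₂ _+_ (sumℚ-+ (lazyStep t x) π) (sumℚ-*ˡ (- 1ℚ) (λ z → ∣ lazyStep t x z - π z ∣))) ⟨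
        ½ * (sumℚ (λ z → lazyStep t x z + π z) + sumℚ (λ z → (- 1ℚ) * ∣ lazyStep t x z - π z ∣))
          ≡⟨ cong (½ *_) (sumℚ-+ (λ z → lazyStep t x z + π z) (λ z → (- 1ℚ) * ∣ lazyStep t x z - π z ∣)) ⟨
        ½ * sumℚ (λ z → (lazyStep t x z + π z) + (- 1ℚ) * ∣ lazyStep t x z - π z ∣)
          ≡⟨ sumℚ-*ˡ ½ (λ z → (lazyStep t x z + π z) + (- 1ℚ) * ∣ lazyStep t x z - π z ∣) ⟨
        sumℚ (λ z → ½ * ((lazyStep t x z + π z) + (- 1ℚ) * ∣ lazyStep t x z - π z ∣))
          ≡⟨ sumℚ-cong (λ z → cong (λ u → ½ * ((lazyStep t x z + π z) + u)) (minus-one ∣ lazyStep t x z - π z ∣)) ⟩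
        sumℚ (λ z → meet (lazyStep t x z) (π z)) ∎
        where
        D : ℚ
        D = sumℚ (λ z → ∣ lazyStep t x z - π z ∣)
        minus-one : ∀ d → (- 1ℚ) * d ≡ - d
        minus-one = solve 1 (λ d → (:- con 1ℚ) :* d := :- d) refl

      lazyStep-2t-lower : ∀ {t} → Mixed t → ∀ x v → ½ * π v ≤ lazyStep (t ℕ.+ t) x v
      lazyStep-2t-lower {t} mixed x v = begin
        ½ * π v ≡⟨ ℚₚ.*-comm ½ (π v) ⟩
        π v * (((½ + ½ * ½) + (½ + ½ * ½)) + (- 1ℚ))
          ≤⟨ ℚₚ.*-monoˡ-≤-nonNeg (π v) {{nonNegative (ℚₚ.<⇒≤ (0<π v))}}
               (ℚₚ.+-monoˡ-≤ (- 1ℚ) (ℚₚ.+-mono-≤ (meet-sum {t} mixed x) (meet-sum {t} mixed v))) ⟩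
        π v * ((sumℚ A + sumℚ B) + (- 1ℚ)) ≡⟨ cong (π v *_) total ⟨
        π v * sumℚ (λ z → (A z + B z) - π z) ≡⟨ sumℚ-*ˡ (π v) (λ z → (A z + B z) - π z) ⟨
        sumℚ (λ z → π v * ((A z + B z) - π z))
          ≤⟨ sumℚ-mono (λ z → return-term {lazyStep t x z} {lazyStep t v z} {π z} {lazyStep t z v} {π v}
               (lazyStep-nonneg t x z) (lazyStep-nonneg t v z) (0<π z) (ℚₚ.<⇒≤ (0<π v)) (lazyStep-reversible t z v)) ⟩
        sumℚ (λ z → lazyStep t x z * lazyStep t z v) ≡⟨ lazyStep-+ t t x v ⟨
        lazyStep (t ℕ.+ t) x v ∎
        where
        A B : Fin n → ℚ
        A z = meet (lazyStep t x z) (π z)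
        B z = meet (lazyStep t v z) (π z)
        total : sumℚ (λ z → (A z + B z) - π z) ≡ (sumℚ A + sumℚ B) + (- 1ℚ)
        total = trans (sumℚ-cong (λ z → cong ((A z + B z) +_) (negate (π z))))
          (trans (sumℚ-+ (λ z → A z + B z) (λ z → (- 1ℚ) * π z))
            (cong₂ _+_ (sumℚ-+ A B) (trans (sumℚ-*ˡ (- 1ℚ) π) (trans (cong ((- 1ℚ) *_) π-sum) refl))))
          where
          negate : ∀ d → - d ≡ (- 1ℚ) * d
          negate = solve 1 (λ d → :- d := (:- con 1ℚ) :* d) refl

    -- E[ρ^τ ; τ ≤ k] for the simple random walk from x, where τ is the hitting time of v.
    module Hitting (v : Fin n) (ρ : ℚ) where
      power : ℕ → ℚ
      power zero    = 1ℚ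
      power (suc k) = ρ * power k

      hit : ℕ → Fin n → ℚ
      hit zero    x = identity x v
      hit (suc k) x = if does (x Fin.≟ v) then 1ℚ else ρ * sumℚ (λ y → P x y * hit k y)

      module _ (0<ρ : 0ℚ < ρ) (ρ≤1 : ρ ≤ 1ℚ) where
        opaque
          average : (Fin n → ℚ) → Fin n → ℚ
          average f x = sumℚ (λ y → P x y * f y)

          average-def : ∀ f x → average f x ≡ sumℚ (λ y → P x y * f y)
          average-def f x = refl

          hit-≡ : ∀ k → hit k v ≡ 1ℚ
          hit-≡ zero = identity-≡ v
          hit-≡ (suc k) with v Fin.≟ v
          ... | yes _  = refl
          ... | no v≢v = ⊥-elim (v≢v refl)

          hit-≢ : ∀ k {x} → ¬ (x ≡ v) → hit (suc k) x ≡ ρ * average (hit k) x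
          hit-≢ k {x} x≢v with x Fin.≟ v
          ... | yes x≡v = ⊥-elim (x≢v x≡v)
          ... | no _    = refl

          average-mono : ∀ {f g} x → (∀ y → f y ≤ g y) → average f x ≤ average g x
          average-mono x f≤g = sumℚ-mono (λ y → ℚₚ.*-monoˡ-≤-nonNeg (P x y) {{nonNegative (P-nonneg x y)}} (f≤g y))

          average-nonneg : ∀ {f} x → (∀ y → 0ℚ ≤ f y) → 0ℚ ≤ average f x
          average-nonneg x 0≤f = sumℚ-nonneg (λ y → *-nonneg (P-nonneg x y) (0≤f y))

          average≤1 : ∀ {f} x → (∀ y → f y ≤ 1ℚ) → average f x ≤ 1ℚ
          average≤1 {f} x f≤1 = subst (average f x ≤_) (P-average-const x 1ℚ) (average-mono {f} {λ _ → 1ℚ} x f≤1)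

          0≤ρ : 0ℚ ≤ ρ
          0≤ρ = ℚₚ.<⇒≤ 0<ρ

          cases : ∀ {Z : Set} x → (x ≡ v → Z) → (¬ (x ≡ v) → Z) → Z
          cases {Z} x eq neq = split (x Fin.≟ v)
            where
            split : Dec (x ≡ v) → Z
            split (yes x≡v) = eq x≡v
            split (no x≢v)  = neq x≢v

          hit-nonneg : ∀ k x → 0ℚ ≤ hit k x
          hit-nonneg zero    x = identity-nonneg x v
          hit-nonneg (suc k) x = cases x
            (λ { refl → subst (0ℚ ≤_) (sym (hit-≡ (suc k))) 0≤1 })
            (λ x≢v → subst (0ℚ ≤_) (sym (hit-≢ k x≢v)) (*-nonneg 0≤ρ (average-nonneg x (hit-nonneg k))))

          hit≤1 : ∀ k x → hit k x ≤ 1ℚ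
          hit≤1 zero    x = cases x
            (λ { refl → ℚₚ.≤-reflexive (hit-≡ 0) })
            (λ x≢v → subst (_≤ 1ℚ) (sym (identity-≢ x≢v)) 0≤1)
          hit≤1 (suc k) x = cases x
            (λ { refl → ℚₚ.≤-reflexive (hit-≡ (suc k)) })
            (λ x≢v → subst (_≤ 1ℚ) (sym (hit-≢ k x≢v))
              (*-mono-≤ 0≤ρ ρ≤1 (average-nonneg x (hit-nonneg k)) (average≤1 x (hit≤1 k))))

          hit-mono : ∀ k x → hit k x ≤ hit (suc k) x
          hit-mono zero    x = cases x
            (λ { refl → ℚₚ.≤-reflexive (trans (hit-≡ 0) (sym (hit-≡ 1))) })
            (λ x≢v → subst (_≤ hit 1 x) (sym (identity-≢ x≢v)) (hit-nonneg 1 x))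
          hit-mono (suc k) x = cases x
            (λ { refl → ℚₚ.≤-reflexive (trans (hit-≡ (suc k)) (sym (hit-≡ (suc (suc k))))) })
            (λ x≢v → subst₂ _≤_ (sym (hit-≢ k x≢v)) (sym (hit-≢ (suc k) x≢v))
              (ℚₚ.*-monoˡ-≤-nonNeg ρ {{nonNegative 0≤ρ}} (average-mono x (hit-mono k))))

          -- With a finite horizon, the harmonic equation relates two different horizons.
          -- Monotonicity in the horizon turns it into an inequality for a single function, in the
          -- direction that the drift argument needs.
          hit-subharmonic : ∀ k {x} → ¬ (x ≡ v) → hit k x ≤ ρ * average (hit k) x
          hit-subharmonic k {x} x≢v = subst (hit k x ≤_) (hit-≢ k x≢v) (hit-mono k x)

          power≤1 : ∀ k → 0ℚ ≤ power k × power k ≤ 1ℚ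
          power≤1 zero    = 0≤1 , ℚₚ.≤-refl
          power≤1 (suc k) = *-nonneg 0≤ρ (proj₁ (power≤1 k)) , *-mono-≤ 0≤ρ ρ≤1 (proj₁ (power≤1 k))
              (proj₂ (power≤1 k))

          -- A lazy step is with probability ½ a step of the simple random walk; holding only costs time.
          lazy-average : ∀ k x → power (suc k) * lazyStep (suc k) x v
            ≡ ½ * (ρ * (power k * lazyStep k x v) + ρ * average (λ z → power k * lazyStep k z v) x)
          lazy-average k x = trans (cong (power (suc k) *_) (lazyP-apply x (λ z → lazyStep k z v)))
            (trans (rearrange ρ (power k) (lazyStep k x v) (sumℚ (λ z → P x z * lazyStep k z v)))
              (cong (λ u → ½ * (ρ * (power k * lazyStep k x v) + ρ * u))
                (trans (sym (sumℚ-*ˡ (power k) (λ z → P x z * lazyStep k z v)))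
                  (sumℚ-cong (λ z → swap (power k) (P x z) (lazyStep k z v))))))
            where
            rearrange : ∀ r p l s → (r * p) * (½ * (l + s)) ≡ ½ * (r * (p * l) + r * (p * s))
            rearrange r p l s = solve 5 (λ h r p l s → (r :* p) :* (h :* (l :+ s)) := h :*
                (r :* (p :* l) :+ r :* (p :* s))) refl ½ r p l s
            swap : ∀ a b c → a * (b * c) ≡ b * (a * c)
            swap = solve 3 (λ a b c → a :* (b :* c) := b :* (a :* c)) refl

          -- A lazy walk that is at v at time k has hit v after at most k genuine moves, and
          -- discounting by time costs at least as much as discounting by moves because ρ ≤ 1.
          hit-lower : ∀ k x → power k * lazyStep k x v ≤ hit k x
          hit-lower zero    x = ℚₚ.≤-reflexive (ℚₚ.*-identityˡ (identity x v))
          hit-lower (suc k) x = cases x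
            (λ { refl → subst (power (suc k) * lazyStep (suc k) v v ≤_) (sym (hit-≡ (suc k)))
              (*-mono-≤ (proj₁ (power≤1 (suc k))) (proj₂ (power≤1 (suc k))) (lazyStep-nonneg (suc k) v v)
                  (lazyStep≤1 (suc k) v v)) })
            λ x≢v → begin
              power (suc k) * lazyStep (suc k) x v ≡⟨ lazy-average k x ⟩
              ½ * (ρ * (power k * lazyStep k x v) + ρ * average (λ z → power k * lazyStep k z v) x)
                -- The holding half wastes a factor `ρ`, and the shorter horizon it leaves is made
                -- good by `hit-mono` in the next step.
                ≤⟨ ℚₚ.*-monoˡ-≤-nonNeg ½ (ℚₚ.+-mono-≤
                     (discount (power k * lazyStep k x v) (hit-lower k x) (hit-nonneg k x))
                     (ℚₚ.*-monoˡ-≤-nonNeg ρ {{nonNegative 0≤ρ}} (average-mono x (hit-lower k)))) ⟩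
              ½ * (hit k x + ρ * average (hit k) x)
                ≤⟨ ℚₚ.*-monoˡ-≤-nonNeg ½ (ℚₚ.+-mono-≤ (hit-mono k x) (ℚₚ.≤-reflexive (sym (hit-≢ k x≢v)))) ⟩
              ½ * (hit (suc k) x + hit (suc k) x) ≡⟨ ℚₚ.*-distribˡ-+ ½ (hit (suc k) x) (hit (suc k) x) ⟩
              ½ * hit (suc k) x + ½ * hit (suc k) x ≡⟨ half+half (hit (suc k) x) ⟩
              hit (suc k) x ∎
            where
            discount : ∀ a {b} → a ≤ b → 0ℚ ≤ b → ρ * a ≤ b
            discount a {b} a≤b 0≤b = begin
              ρ * a ≤⟨ ℚₚ.*-monoˡ-≤-nonNeg ρ {{nonNegative 0≤ρ}} a≤b ⟩
              ρ * b ≤⟨ ℚₚ.*-monoʳ-≤-nonNeg b {{nonNegative 0≤b}} ρ≤1 ⟩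
              1ℚ * b ≡⟨ ℚₚ.*-identityˡ b ⟩
              b ∎

          hit-2t-lower : ∀ {t} → Mixed t → ∀ x → power (t ℕ.+ t) * (½ * π v) ≤ hit (t ℕ.+ t) x
          hit-2t-lower {t} mixed x = ℚₚ.≤-trans
            (ℚₚ.*-monoˡ-≤-nonNeg (power (t ℕ.+ t)) {{nonNegative (proj₁ (power≤1 (t ℕ.+ t)))}}
                (lazyStep-2t-lower {t} mixed x v))
            (hit-lower (t ℕ.+ t) x)

-- Maximisation over a finite set

module Extremal where
  open ≡ using (refl; sym; trans; cong; cong₂; subst; subst₂)
  open Rat using (_≤_)

  opaque
    -- Rational values make an exact maximiser computable; for real values only an approximate one
    -- could be found. The predicate is adjacency in the application.
    maximizer : ∀ {n} {P : Fin n → Set} → (∀ i → Dec (P i)) → (f : Fin n → ℚ) → (∃ λ i → P i) →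
      ∃ λ i → P i × (∀ j → P j → f j ≤ f i)
    maximizer {zero} P? f (() , _)
    maximizer {suc n} {P} P? f (i₀ , p₀) = choose (P? zero) (Fin.any? (λ i → P? (suc i)))
      where
      later : (∃ λ i → P (suc i)) → ∃ λ i → P (suc i) × (∀ j → P (suc j) → f (suc j) ≤ f (suc i))
      later = maximizer {n} {λ i → P (suc i)} (λ i → P? (suc i)) (λ i → f (suc i))
      compare : P zero → (∃ λ i → P (suc i) × (∀ j → P (suc j) → f (suc j) ≤ f (suc i))) →
        ∃ λ i → P i × (∀ j → P j → f j ≤ f i)
      compare p (i , q , max) with ℚₚ.≤-total (f zero) (f (suc i))
      ... | inj₁ f0≤fi = suc i , q , λ { zero _ → f0≤fi ; (suc j) r → max j r }
      ... | inj₂ fi≤f0 = zero , p , λ { zero _ → ℚₚ.≤-refl ; (suc j) r → ℚₚ.≤-trans (max j r) fi≤f0 }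
      choose : Dec (P zero) → Dec (∃ λ i → P (suc i)) → ∃ λ i → P i × (∀ j → P j → f j ≤ f i)
      choose (yes p) (yes q) = compare p (later q)
      choose (yes p) (no ¬q) = zero , p , λ { zero _ → ℚₚ.≤-refl ; (suc j) r → ⊥-elim (¬q (j , r)) }
      choose (no ¬p) (yes q) with later q
      ... | i , r , max = suc i , r , λ { zero p → ⊥-elim (¬p p) ; (suc j) s → max j s }
      choose (no ¬p) (no ¬q) = ⊥-elim (impossible i₀ p₀)
        where
        impossible : ∀ i → P i → ⊥
        impossible zero    p = ¬p p
        impossible (suc i) q = ¬q (i , q)

-- Biased walk

module BiasedWalk (F : ArchimedeanField) (X : Exponential F) where
  open FieldProperties F
  open ExponentialProperties F X
  open StationaryDistributions F
  open ≤-Reasoning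

  opaque
    sum-fromℚ : ∀ {n} (f : Fin n → ℚ) → sum (λ i → fromℚ (f i)) ≈ fromℚ (sumℚ f)
    sum-fromℚ {zero}  f = sym fromℚ-0
    sum-fromℚ {suc n} f = trans (+-congˡ (sum-fromℚ (λ i → f (suc i))))
        (sym (fromℚ-+ (f zero) (sumℚ (λ i → f (suc i)))))

    sum-identityˡ : ∀ {n} x (f : Fin n → Carrier) → sum (λ y → fromℚ (identity x y) * f y) ≈ f x
    sum-identityˡ zero f = trans (+-cong (trans (*-congʳ fromℚ-1) (*-identityˡ (f zero)))
      (sum-zero (λ i → trans (*-congʳ fromℚ-0) (zeroˡ (f (suc i)))))) (+-identityʳ (f zero))
    sum-identityˡ (suc x) f = trans (+-cong (trans (*-congʳ fromℚ-0) (zeroˡ (f zero)))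
      (sum-identityˡ x (λ i → f (suc i)))) (+-identityˡ (f (suc x)))

    exp-multiple : ∀ {x r} → exp x ≈ fromℚ r → ∀ (power : ℕ → ℚ) → power 0 ≡ 1ℚ →
      (∀ k → power (suc k) ≡ r Rat.* power k) → ∀ k → exp (fromℚ (fromℕ k) * x) ≈ fromℚ (power k)
    exp-multiple {x} {r} expx power power-zero power-suc zero = trans
      (trans (exp-cong (trans (*-congʳ (trans (reflexive (≡.cong fromℚ ℚ-Lemmas.fromℕ-zero)) fromℚ-0))
          (zeroˡ x))) exp-0)
      (trans (sym fromℚ-1) (reflexive (≡.cong fromℚ (≡.sym power-zero))))
    exp-multiple {x} {r} expx power power-zero power-suc (suc k) = begin-equality
      exp (fromℚ (fromℕ (suc k)) * x)
        ≈⟨ exp-cong (trans (*-congʳ (trans (reflexive (≡.cong fromℚ (ℚ-Lemmas.fromℕ-suc k)))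
             (trans (fromℚ-+ 1ℚ (fromℕ k)) (+-congʳ fromℚ-1))))
             (solve 2 (λ k x → (con 1ℚ :+ k) :* x := x :+ k :* x) refl (fromℚ (fromℕ k)) x)) ⟩
      exp (x + fromℚ (fromℕ k) * x) ≈⟨ exp-+ x (fromℚ (fromℕ k) * x) ⟩
      exp x * exp (fromℚ (fromℕ k) * x) ≈⟨ *-cong expx (exp-multiple expx power power-zero power-suc k) ⟩
      fromℚ r * fromℚ (power k) ≈⟨ fromℚ-* r (power k) ⟨
      fromℚ (r Rat.* power k) ≈⟨ reflexive (≡.cong fromℚ (power-suc k)) ⟨
      fromℚ (power (suc k)) ∎

    invariant-line-at : ∀ {n} → Fin n → (Q : SquareMatrix n) → IsStochastic Q → Irreducible Q → InvariantLine Q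
    invariant-line-at {suc n} _ Q = invariant-line Q

  -- A Foster–Lyapunov bound: if Q raises g by κ G on average except at v, stationarity forces mass κ G at v.
  module Drift {n} {Q : SquareMatrix n} (line : InvariantLine Q) where
    open InvariantLine line

    opaque
      stationary-mean : ∀ (g : Fin n → Carrier) → sum (λ x → μ x * sum (λ y → Q x y * g y)) ≈ sum (λ y → μ y * g y)
      stationary-mean g = begin-equality
        sum (λ x → μ x * sum (λ y → Q x y * g y)) ≈⟨ sum-cong (λ x → trans (*-distribˡ-sum (μ x) (λ y → Q x y * g y))
          (sum-cong (λ y → sym (*-assoc (μ x) (Q x y) (g y))))) ⟩
        sum (λ x → sum (λ y → μ x * Q x y * g y)) ≈⟨ ∑-comm (λ x y → μ x * Q x y * g y) ⟩
        sum (λ y → sum (λ x → μ x * Q x y * g y)) ≈⟨ sum-cong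
            (λ y → trans (sum-*ʳ (λ x → μ x * Q x y) (g y)) (*-congʳ (invariant y))) ⟩
        sum (λ y → μ y * g y) ∎

      -- Average the hypothesis over μ: by stationarity the means of Q g and of g agree and cancel,
      -- while the indicator of v contributes μ(v).
      drift-bound : ∀ v (g : Fin n → Carrier) c →
        (∀ x → g x + c ≤ sum (λ y → Q x y * g y) + fromℚ (identity v x)) → c ≤ μ v
      drift-bound v g c drift = +-cancelʳ-≤ (sum (λ x → μ x * g x)) (begin
        c + sum (λ x → μ x * g x)
          ≈⟨ +-congʳ (trans (sum-*ʳ μ c) (trans (*-congʳ total) (*-identityˡ c))) ⟨
        sum (λ x → μ x * c) + sum (λ x → μ x * g x) ≈⟨ +-comm _ _ ⟩
        sum (λ x → μ x * g x) + sum (λ x → μ x * c) ≈⟨ sum-+ (λ x → μ x * g x) (λ x → μ x * c) ⟨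
        sum (λ x → μ x * g x + μ x * c) ≈⟨ sum-cong (λ x → sym (distribˡ (μ x) (g x) c)) ⟩
        sum (λ x → μ x * (g x + c)) ≤⟨ sum-mono (λ x → *-monoˡ-≤ (nonneg x) (drift x)) ⟩
        sum (λ x → μ x * (sum (λ y → Q x y * g y) + fromℚ (identity v x)))
          ≈⟨ sum-cong (λ x → trans (distribˡ (μ x) (sum (λ y → Q x y * g y)) (fromℚ (identity v x)))
               (+-congˡ (*-comm (μ x) (fromℚ (identity v x))))) ⟩
        sum (λ x → μ x * sum (λ y → Q x y * g y) + fromℚ (identity v x) * μ x)
          ≈⟨ sum-+ (λ x → μ x * sum (λ y → Q x y * g y)) (λ x → fromℚ (identity v x) * μ x) ⟩
        sum (λ x → μ x * sum (λ y → Q x y * g y)) + sum (λ x → fromℚ (identity v x) * μ x)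
          ≈⟨ +-cong (stationary-mean g) (sum-identityˡ v μ) ⟩
        sum (λ x → μ x * g x) + μ v ≈⟨ +-comm _ _ ⟩
        μ v + sum (λ x → μ x * g x) ∎)

  -- L = ln E with 2/5 ≤ θ L ≤ 1/2 (in the application θ = (1 - ε) t).
  record Rate (θ : Carrier) : Set where
    field
      E ρ   : ℚ
      L     : Carrier
      1≤E   : 1ℚ Rat.≤ E
      0<ρ   : 0ℚ Rat.< ρ
      ρ≤1   : ρ Rat.≤ 1ℚ
      E*ρ   : E Rat.* ρ ≡ 1ℚ
      exp-L : exp L ≈ fromℚ E
      0≤L   : 0# ≤ L
      lower : fromℚ (ℤ.+ 2 Rat./ 5) ≤ θ * L
      upper : θ * L ≤ fromℚ ½

  module _ (ln : ∀ q → 0ℚ Rat.< q → ∃ λ ℓ → exp ℓ ≈ fromℚ q) where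

    opaque
      scaled-inverse : ∀ p θ u → θ * u ≈ 1# → θ * (fromℚ p * u) ≈ fromℚ p
      scaled-inverse p θ u θu≈1 = trans (solve 3 (λ p θ u → θ :* (p :* u) := p :* (θ :* u)) refl (fromℚ p) θ u)
        (trans (*-congˡ θu≈1) (*-identityʳ (fromℚ p)))

      -- Here `u` is 1/θ. The logarithm is taken after `E` has been fixed, so e^L = E holds exactly,
      -- and bounds on `L` follow from bounds on `E` because exp reflects the order.
      rate-from : ∀ {θ u} → 0# ≤ θ → 0# < u → θ * u ≈ 1# → ∀ E ρ → 0ℚ Rat.< ρ → E Rat.* ρ ≡ 1ℚ → 1ℚ Rat.≤ E →
        exp (fromℚ (ℤ.+ 2 Rat./ 5) * u) ≤ fromℚ E → fromℚ E ≤ exp (fromℚ ½ * u) → Rate θ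
      rate-from {θ} {u} 0≤θ 0<u θu≈1 E ρ 0<ρ Eρ≡1 1≤E expL₁≤E E≤expL₂ = record
        { E = E ; ρ = ρ ; L = L ; 1≤E = 1≤E ; 0<ρ = 0<ρ
        ; ρ≤1 = ℚₚ.≤-trans (ℚₚ.≤-reflexive (≡.sym (ℚₚ.*-identityˡ ρ)))
            (ℚₚ.≤-trans (ℚₚ.*-monoʳ-≤-nonNeg ρ {{Rat.nonNegative (ℚₚ.<⇒≤ 0<ρ)}} 1≤E) (ℚₚ.≤-reflexive Eρ≡1))
        ; E*ρ = Eρ≡1 ; exp-L = expL≈E
        ; 0≤L = ≤-trans (*-nonneg (0≤fromℚ (ℚₚ.nonNegative⁻¹ (ℤ.+ 2 Rat./ 5))) (<⇒≤ 0<u)) L₁≤L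
        ; lower = ≤-trans (≤-reflexive (sym (scaled-inverse (ℤ.+ 2 Rat./ 5) θ u θu≈1))) (*-monoˡ-≤ 0≤θ L₁≤L)
        ; upper = ≤-trans (*-monoˡ-≤ 0≤θ L≤L₂) (≤-reflexive (scaled-inverse ½ θ u θu≈1)) }
        where
        L : Carrier
        L = proj₁ (ln E (ℚₚ.<-≤-trans ℚ-Lemmas.0<1 1≤E))
        expL≈E : exp L ≈ fromℚ E
        expL≈E = proj₂ (ln E (ℚₚ.<-≤-trans ℚ-Lemmas.0<1 1≤E))
        L₁≤L : fromℚ (ℤ.+ 2 Rat./ 5) * u ≤ L
        L₁≤L = exp-cancel-≤ (≤-trans expL₁≤E (≤-reflexive (sym expL≈E)))
        L≤L₂ : L ≤ fromℚ ½ * u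
        L≤L₂ = exp-cancel-≤ (≤-trans (≤-reflexive expL≈E) E≤expL₂)

      fromℚ-<-scale : ∀ {p q u} d → 0ℚ Rat.< d → p Rat.+ d ≡ q → 0# < u → fromℚ p * u < fromℚ q * u
      fromℚ-<-scale {p} {q} {u} d 0<d p+d≡q 0<u = +-pos-< (*-pos (fromℚ-pos 0<d) 0<u) (≤-reflexive
        (trans (sym (distribʳ u (fromℚ p) (fromℚ d)))
            (*-congʳ (trans (sym (fromℚ-+ p d)) (reflexive (≡.cong fromℚ p+d≡q))))))

      -- A rational `E` exists between e^(2u/5) and e^(u/2) with u = 1/θ; the constant 1/10 is the
      -- width 1/2 - 2/5 of the interval of exponents, and it provides the gap for density.
      rate : ∀ {θ} → 0# < θ → Rate θ
      rate {θ} 0<θ = choose (inverse-pos 0<θ)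
        where
        choose : (∃ λ u → 0# < u × θ * u ≈ 1#) → Rate θ
        choose (u , 0<u , θu≈1) = pick (<-dense (exp-mono-<
            (fromℚ-<-scale {ℤ.+ 2 Rat./ 5} {½} {u} (ℤ.+ 1 Rat./ 10) (ℚₚ.positive⁻¹ (ℤ.+ 1 Rat./ 10)) ≡.refl 0<u)))
          where
          pick : (∃ λ E → exp (fromℚ (ℤ.+ 2 Rat./ 5) * u) ≤ fromℚ E × fromℚ E ≤ exp (fromℚ ½ * u)) → Rate θ
          pick (E , lower , upper) = invert (ℚ-Lemmas.shrink {E} (ℚₚ.<-≤-trans ℚ-Lemmas.0<1 1≤E) {1ℚ} ℚ-Lemmas.0<1)
            where
            1≤E : 1ℚ Rat.≤ E
            1≤E = fromℚ-cancel (begin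
              fromℚ 1ℚ ≈⟨ fromℚ-1 ⟩
              1#       ≈⟨ exp-0 ⟨
              exp 0#   ≤⟨ exp-mono (*-nonneg (0≤fromℚ (ℚₚ.nonNegative⁻¹ (ℤ.+ 2 Rat./ 5))) (<⇒≤ 0<u)) ⟩
              exp (fromℚ (ℤ.+ 2 Rat./ 5) * u) ≤⟨ lower ⟩
              fromℚ E ∎)
            invert : (∃ λ ρ → 0ℚ Rat.< ρ × E Rat.* ρ ≡ 1ℚ) → Rate θ
            invert (ρ , 0<ρ , Eρ≡1) = rate-from (<⇒≤ 0<θ) 0<u θu≈1 E ρ 0<ρ Eρ≡1 1≤E lower upper

    module Strategy {n} (G : SimpleGraph n) (connected : SimpleGraph.Connected G)
      {ε : Carrier} (0<ε : 0# < ε) (ε<1 : ε < 1#)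
      (mix : ℚ → Carrier → Carrier) (mix≈ : ∀ q b → mix q b ≈ (1# - ε) * fromℚ q + ε * b)
      {t : ℕ} (mixed : RandomWalk.Mixed G t)
      {v : Fin n} {lnp : Carrier} (exp-lnp : exp lnp ≈ fromℚ (RandomWalk.π G v)) where
      open SimpleGraph G
      open RandomWalk G
      open WalkProperties G

      s τ : Carrier
      s = 1# - ε
      τ = fromℚ (fromℕ t)

      opaque
        0<s : 0# < s
        0<s = x<y⇒0<y-x ε<1

        s≤1 : s ≤ 1#
        s≤1 = ≤-by (<⇒≤ 0<ε) (solve 1 (λ e → (con 1ℚ :- e) :+ e := con 1ℚ) refl ε)

        1≤τ : 1# ≤ τ
        1≤τ = ≤-trans (≤-reflexive (sym fromℚ-1)) (fromℚ-mono
          (ℚₚ.≤-trans (ℚₚ.≤-reflexive (≡.sym NaturalFractions.fromℕ-1)) (ℚ-Lemmas.fromℕ-mono (proj₁ mixed))))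

        -- An exponential is positive, so the mere existence of ln π(v) excludes π(v) = 0. With
        -- connectedness this makes all degrees positive and rules out the graph with one vertex.
        0<πv : 0ℚ Rat.< π v
        0<πv = ℚₚ.≰⇒> λ πv≤0 → <⇒≱ (exp-pos lnp)
          (≤-trans (≤-reflexive exp-lnp) (≤-trans (fromℚ-mono πv≤0) (≤-reflexive fromℚ-0)))

        0<degree : ∀ x → 0 ℕ.< degree x
        0<degree = connected⇒degree-pos connected (π-pos⇒degree-pos 0<πv)

        0<degreeSum : 0 ℕ.< degreeSum
        0<degreeSum = π-pos⇒degreeSum-pos {v} 0<πv

        rateOf : Rate (s * τ)
        rateOf = rate (*-pos 0<s (<-≤-trans 0<1# 1≤τ))

      open Positive 0<degree 0<degreeSum
      open Rate rateOf
      open Hitting v ρ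

      K : ℕ
      K = t ℕ.+ t

      h : Fin n → ℚ
      h = hit K

      opaque
        h-lower : ∀ x → power K Rat.* (½ Rat.* π v) Rat.≤ h x
        h-lower = hit-2t-lower 0<ρ ρ≤1 {t} mixed

        0<power : ∀ k → 0ℚ Rat.< power k
        0<power zero    = ℚ-Lemmas.0<1
        0<power (suc k) = ℚ-Lemmas.*-pos 0<ρ (0<power k)

        0<h : ∀ x → 0ℚ Rat.< h x
        0<h x = ℚₚ.<-≤-trans (ℚ-Lemmas.*-pos (0<power K) (ℚ-Lemmas.*-pos ℚ-Lemmas.0<½ 0<πv)) (h-lower x)

        h-growth : ∀ {x} → ¬ (x ≡ v) → E Rat.* h x Rat.≤ sumℚ (λ y → P x y Rat.* h y)
        h-growth {x} x≢v = ≡.subst (E Rat.* h x Rat.≤_)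
            (≡.trans (cancel (average 0<ρ ρ≤1 h x)) (average-def 0<ρ ρ≤1 h x))
          (ℚₚ.*-monoˡ-≤-nonNeg E {{Rat.nonNegative (ℚₚ.≤-trans ℚ-Lemmas.0≤1 1≤E)}} (hit-subharmonic 0<ρ ρ≤1 K x≢v))
          where
          cancel : ∀ a → E Rat.* (ρ Rat.* a) ≡ a
          cancel a = ≡.trans (≡.sym (ℚₚ.*-assoc E ρ a)) (≡.trans (≡.cong (Rat._* a) E*ρ) (ℚₚ.*-identityˡ a))

        greedy : ∀ x → ∃ λ b → x ~ b × (∀ y → x ~ y → h y Rat.≤ h b)
        greedy x = Extremal.maximizer (x ~?_) h (neighbour (0<degree x))

      best : Fin n → Fin n
      best x = proj₁ (greedy x)

      B Q : SquareMatrix n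
      B x y = fromℚ (identity (best x) y)
      Q x y = mix (P x y) (B x y)

      opaque
        B-nonneg : ∀ x y → 0# ≤ B x y
        B-nonneg x y = 0≤fromℚ (RationalSums.identity-nonneg (best x) y)

        B-rowSum : ∀ x → sum (B x) ≈ 1#
        B-rowSum x = trans (sum-cong (λ y → sym (*-identityʳ (B x y)))) (sum-identityˡ (best x) (λ _ → 1#))

        B-supported : ∀ x y → ¬ (x ~ y) → B x y ≈ 0#
        B-supported x y x≁y = trans (reflexive (≡.cong fromℚ (RationalSums.identity-≢
          (λ b≡y → x≁y (≡.subst (x ~_) b≡y (proj₁ (proj₂ (greedy x)))))))) fromℚ-0

        Q-stochastic : IsStochastic Q
        Q-stochastic = record
          { nonneg = λ x y → ≤-trans (*-nonneg (<⇒≤ 0<s) (0≤fromℚ (P-nonneg x y)))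
              (≤-trans (≤-by (*-nonneg (<⇒≤ 0<ε) (B-nonneg x y)) refl) (≤-reflexive (sym (mix≈ (P x y) (B x y)))))
          ; rowSum = λ x → begin-equality
              sum (Q x) ≈⟨ sum-cong (λ y → mix≈ (P x y) (B x y)) ⟩
              sum (λ y → s * fromℚ (P x y) + ε * B x y) ≈⟨ sum-+ (λ y → s * fromℚ (P x y)) (λ y → ε * B x y) ⟩
              sum (λ y → s * fromℚ (P x y)) + sum (λ y → ε * B x y)
                ≈⟨ +-cong (sum-*ˡ s (λ y → fromℚ (P x y))) (sum-*ˡ ε (B x)) ⟩
              s * sum (λ y → fromℚ (P x y)) + ε * sum (B x)
                ≈⟨ +-cong (*-congˡ (trans (sum-fromℚ (P x)) (trans (reflexive (≡.cong fromℚ (P-rowSum x))) fromℚ-1)))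
                     (*-congˡ (B-rowSum x)) ⟩
              s * 1# + ε * 1# ≈⟨ solve 1 (λ e → (con 1ℚ :- e) :* con 1ℚ :+ e :* con 1ℚ := con 1ℚ) refl ε ⟩
              1# ∎ }

        Q-edge : ∀ {x y} → x ~ y → 0# < Q x y
        Q-edge {x} {y} x~y = <-≤-trans
          (+-pos-nonneg (*-pos 0<s (fromℚ-pos (P-~ x~y))) (*-nonneg (<⇒≤ 0<ε) (B-nonneg x y)))
          (≤-reflexive (sym (mix≈ (P x y) (B x y))))

        Q-irreducible : Irreducible Q
        Q-irreducible x y = Star.map Q-edge (connected x y)

        line : InvariantLine Q
        line = invariant-line-at v Q Q-stochastic Q-irreducible

      open InvariantLine line public using (μ)

      H g : Fin n → Carrier
      H x = proj₁ (ln (h x) (0<h x))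
      g x = exp (s * H x)

      -- Powers with real exponent are written through logarithms. `Hmin` is the logarithm of
      -- E^(-2t) π(v)/2, the uniform lower bound for h; `Gmin` is its s-th power, and `κ` is the
      -- logarithm of E^s.
      lnh Hmin Gmin κ : Carrier
      lnh  = proj₁ (ln ½ ℚ-Lemmas.0<½)
      Hmin = lnp + lnh + fromℚ (fromℕ K) * - L
      Gmin = exp (s * Hmin)
      κ    = s * L

      opaque
        exp-H : ∀ x → exp (H x) ≈ fromℚ (h x)
        exp-H x = proj₂ (ln (h x) (0<h x))

        exp-lnh : exp lnh ≈ fromℚ ½
        exp-lnh = proj₂ (ln ½ ℚ-Lemmas.0<½)

        exp--L : exp (- L) ≈ fromℚ ρ
        exp--L = begin-equality
          exp (- L) ≈⟨ *-identityʳ _ ⟨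
          exp (- L) * 1# ≈⟨ *-congˡ (trans (sym fromℚ-1)
              (trans (reflexive (≡.cong fromℚ (≡.sym E*ρ))) (fromℚ-* E ρ))) ⟩
          exp (- L) * (fromℚ E * fromℚ ρ) ≈⟨ *-congˡ (*-congʳ (sym exp-L)) ⟩
          exp (- L) * (exp L * fromℚ ρ)
            ≈⟨ solve 3 (λ a b c → a :* (b :* c) := (b :* a) :* c) refl (exp (- L)) (exp L) (fromℚ ρ) ⟩
          (exp L * exp (- L)) * fromℚ ρ ≈⟨ *-congʳ (exp-inverse L) ⟩
          1# * fromℚ ρ ≈⟨ *-identityˡ _ ⟩
          fromℚ ρ ∎

        exp-Hmin : exp Hmin ≈ fromℚ (power K Rat.* (½ Rat.* π v))
        exp-Hmin = begin-equality
          exp (lnp + lnh + fromℚ (fromℕ K) * - L) ≈⟨ exp-+ (lnp + lnh) (fromℚ (fromℕ K) * - L) ⟩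
          exp (lnp + lnh) * exp (fromℚ (fromℕ K) * - L)
            ≈⟨ *-cong (trans (exp-+ lnp lnh) (*-cong exp-lnp exp-lnh))
                 (exp-multiple exp--L power ≡.refl (λ _ → ≡.refl) K) ⟩
          fromℚ (π v) * fromℚ ½ * fromℚ (power K)
            ≈⟨ solve 3 (λ a b c → a :* b :* c := c :* (b :* a)) refl (fromℚ (π v)) (fromℚ ½) (fromℚ (power K)) ⟩
          fromℚ (power K) * (fromℚ ½ * fromℚ (π v)) ≈⟨ *-congˡ (fromℚ-* ½ (π v)) ⟨
          fromℚ (power K) * fromℚ (½ Rat.* π v) ≈⟨ fromℚ-* (power K) (½ Rat.* π v) ⟨
          fromℚ (power K Rat.* (½ Rat.* π v)) ∎

        Hmin≤H : ∀ x → Hmin ≤ H x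
        Hmin≤H x = exp-cancel-≤ (≤-trans (≤-reflexive exp-Hmin)
          (≤-trans (fromℚ-mono (h-lower x)) (≤-reflexive (sym (exp-H x)))))

        Gmin≤g : ∀ x → Gmin ≤ g x
        Gmin≤g x = exp-mono (*-monoˡ-≤ (<⇒≤ 0<s) (Hmin≤H x))

        exp≤1⇒≤0 : ∀ {x q} → exp x ≈ fromℚ q → q Rat.≤ 1ℚ → x ≤ 0#
        exp≤1⇒≤0 expx q≤1 = exp-cancel-≤ (≤-trans (≤-reflexive expx)
          (≤-trans (fromℚ-mono q≤1) (≤-reflexive (trans fromℚ-1 (sym exp-0)))))

        g≤1 : ∀ x → g x ≤ 1#
        g≤1 x = ≤-trans (exp-mono (≤-trans (*-monoˡ-≤ (<⇒≤ 0<s) (exp≤1⇒≤0 (exp-H x) (hit≤1 0<ρ ρ≤1 K x)))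
            (≤-reflexive (zeroʳ s)))) (≤-reflexive exp-0)

        0≤κ : 0# ≤ κ
        0≤κ = *-nonneg (<⇒≤ 0<s) 0≤L

        κ≤1 : κ ≤ 1#
        κ≤1 = begin
          s * L       ≈⟨ *-identityʳ (s * L) ⟨
          s * L * 1#  ≤⟨ *-monoˡ-≤ 0≤κ 1≤τ ⟩
          s * L * τ   ≈⟨ solve 3 (λ s L t → s :* L :* t := s :* t :* L) refl s L τ ⟩
          s * τ * L   ≤⟨ upper ⟩
          fromℚ ½     ≤⟨ fromℚ-mono (Rat.*≤* (ℤ.+≤+ (ℕ.s≤s ℕ.z≤n))) ⟩
          fromℚ 1ℚ    ≈⟨ fromℚ-1 ⟩
          1#          ∎

        H-monotone : ∀ {x y} → h x Rat.≤ h y → H x ≤ H y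
        H-monotone {x} {y} hx≤hy = exp-cancel-≤ (≤-trans (≤-reflexive (exp-H x))
          (≤-trans (fromℚ-mono hx≤hy) (≤-reflexive (sym (exp-H y)))))

        -- e^(s a) ≥ e^(s m - m) e^a for a ≤ m and s ≤ 1.
        exp-interpolate : ∀ {a m} → a ≤ m → exp (s * m - m) * exp a ≤ exp (s * a)
        exp-interpolate {a} {m} a≤m = ≤-trans (≤-reflexive (sym (exp-+ (s * m - m) a)))
          (exp-mono (≤-by (*-nonneg (x≤y⇒0≤y-x s≤1) (x≤y⇒0≤y-x a≤m))
            (solve 3 (λ s a m → ((s :* m :- m) :+ a) :+ (con 1ℚ :- s) :* (m :- a) := s :* a) refl s a m)))

        -- For a neighbour y, h(y) is at most the greedy maximum M, so h(y)^s ≥ M^(s-1) h(y). For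
        -- any other y both sides vanish with P(x,y), which is why M need only dominate the
        -- neighbours.
        P-term : ∀ x y → fromℚ (P x y) * (exp (s * H (best x) - H (best x)) * fromℚ (h y)) ≤ fromℚ (P x y) * g y
        P-term x y = decide (x ~? y)
          where
          decide : Dec (x ~ y) → fromℚ (P x y) * (exp (s * H (best x) - H (best x)) * fromℚ (h y)) ≤ fromℚ
              (P x y) * g y
          decide (yes x~y) = *-monoˡ-≤ (0≤fromℚ (P-nonneg x y))
              (≤-trans (*-monoˡ-≤ (exp-nonneg _) (≤-reflexive (sym (exp-H y))))
            (exp-interpolate (H-monotone (proj₂ (proj₂ (greedy x)) y x~y))))
          decide (no x≁y) = ≤-reflexive (trans (vanish _) (sym (vanish (g y))))
            where
            vanish : ∀ a → fromℚ (P x y) * a ≈ 0#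
            vanish a = trans (*-congʳ (trans (reflexive (≡.cong fromℚ (P-≁ x≁y))) fromℚ-0)) (zeroˡ a)

        -- With M the greedy maximum, P g ≥ M^(s-1) P h ≥ M^(s-1) E h(x). The left side is the
        -- logarithmic form of the last expression.
        P-average-lower : ∀ {x} → ¬ (x ≡ v) →
          exp (s * H (best x)) * exp (L + H x - H (best x)) ≤ sum (λ y → fromℚ (P x y) * g y)
        P-average-lower {x} x≢v = begin
          exp (s * m) * exp (L + H x - m) ≈⟨ exp-+ (s * m) (L + H x - m) ⟨
          exp (s * m + (L + H x - m))
            ≈⟨ exp-cong (solve 4 (λ s m L a → s :* m :+ (L :+ a :- m) := (s :* m :- m) :+ (L :+ a)) refl s m L
                (H x)) ⟩
          exp ((s * m - m) + (L + H x)) ≈⟨ exp-+ (s * m - m) (L + H x) ⟩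
          c * exp (L + H x) ≈⟨ *-congˡ (trans (exp-+ L (H x))
              (trans (*-cong exp-L (exp-H x)) (sym (fromℚ-* E (h x))))) ⟩
          c * fromℚ (E Rat.* h x) ≤⟨ *-monoˡ-≤ (exp-nonneg _) (fromℚ-mono (h-growth x≢v)) ⟩
          c * fromℚ (sumℚ (λ y → P x y Rat.* h y)) ≈⟨ *-congˡ (sum-fromℚ (λ y → P x y Rat.* h y)) ⟨
          c * sum (λ y → fromℚ (P x y Rat.* h y)) ≈⟨ sum-*ˡ c (λ y → fromℚ (P x y Rat.* h y)) ⟨
          sum (λ y → c * fromℚ (P x y Rat.* h y))
            ≈⟨ sum-cong (λ y → trans (*-congˡ (fromℚ-* (P x y) (h y)))
                 (solve 3 (λ c p h → c :* (p :* h) := p :* (c :* h)) refl c (fromℚ (P x y)) (fromℚ (h y)))) ⟩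
          sum (λ y → fromℚ (P x y) * (c * fromℚ (h y))) ≤⟨ sum-mono (P-term x) ⟩
          sum (λ y → fromℚ (P x y) * g y) ∎
          where
          m c : Carrier
          m = H (best x)
          c = exp (s * m - m)

        Q-average : ∀ x → sum (λ y → Q x y * g y) ≈ s * sum (λ y → fromℚ (P x y) * g y) + ε * g (best x)
        Q-average x = begin-equality
          sum (λ y → Q x y * g y)
            ≈⟨ sum-cong (λ y → trans (*-congʳ (mix≈ (P x y) (B x y)))
                 (solve 5 (λ s p e b g → (s :* p :+ e :* b) :* g := s :* (p :* g) :+ e :* (b :* g)) refl
                   s (fromℚ (P x y)) ε (B x y) (g y))) ⟩
          sum (λ y → s * (fromℚ (P x y) * g y) + ε * (B x y * g y))
            ≈⟨ sum-+ (λ y → s * (fromℚ (P x y) * g y)) (λ y → ε * (B x y * g y)) ⟩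
          sum (λ y → s * (fromℚ (P x y) * g y)) + sum (λ y → ε * (B x y * g y))
            ≈⟨ +-cong (sum-*ˡ s (λ y → fromℚ (P x y) * g y))
                 (trans (sum-*ˡ ε (λ y → B x y * g y)) (*-congˡ (sum-identityˡ (best x) g))) ⟩
          s * sum (λ y → fromℚ (P x y) * g y) + ε * g (best x) ∎

        -- With M the greedy maximum and e^d = E h(x)/M, the walk gives Q g ≥ M^s (s e^d + ε) ≥ M^s
        -- e^(s d) = (E h(x))^s = E^s g(x). The maximum M cancels, so nothing about the chosen
        -- neighbour survives in the bound.
        growth : ∀ {x} → ¬ (x ≡ v) → g x + κ * Gmin ≤ sum (λ y → Q x y * g y)
        growth {x} x≢v = begin
          g x + κ * Gmin ≤⟨ +-mono-≤ ≤-refl (*-monoˡ-≤ 0≤κ (Gmin≤g x)) ⟩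
          g x + κ * g x ≈⟨ solve 2 (λ g k → g :+ k :* g := (con 1ℚ :+ k) :* g) refl (g x) κ ⟩
          -- The multiplicative gain e^κ = E^s is weakened to an additive one, the form that the
          -- drift bound uses.
          (1# + κ) * g x ≤⟨ *-monoʳ-≤ (exp-nonneg _) (1+x≤exp κ) ⟩
          exp (s * L) * exp (s * H x) ≈⟨ exp-+ (s * L) (s * H x) ⟨
          exp (s * L + s * H x)
            ≈⟨ exp-cong (solve 4 (λ s m L a → s :* L :+ s :* a := s :* m :+ s :* (L :+ a :- m)) refl s m L (H x)) ⟩
          exp (s * m + s * d) ≈⟨ exp-+ (s * m) (s * d) ⟩
          -- Weighted AM-GM: weight s on the average of h, relative to its maximum, and weight ε on
          -- the maximum itself.
          exp (s * m) * exp (s * d) ≤⟨ *-monoˡ-≤ (exp-nonneg _) (exp-convex s d (<⇒≤ 0<s) s≤1) ⟩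
          exp (s * m) * (s * exp d + (1# - s))
            ≈⟨ solve 3 (λ e a b → a :* ((con 1ℚ :- e) :* b :+ (con 1ℚ :- (con 1ℚ :- e))) := (con 1ℚ :- e) :*
                (a :* b) :+ e :* a) refl
                 ε (exp (s * m)) (exp d) ⟩
          s * (exp (s * m) * exp d) + ε * exp (s * m)
            ≤⟨ +-mono-≤ (*-monoˡ-≤ (<⇒≤ 0<s) (P-average-lower x≢v)) ≤-refl ⟩
          s * sum (λ y → fromℚ (P x y) * g y) + ε * g (best x) ≈⟨ Q-average x ⟨
          sum (λ y → Q x y * g y) ∎
          where
          m d : Carrier
          m = H (best x)
          d = L + H x - m

        drift : ∀ x → g x + κ * Gmin ≤ sum (λ y → Q x y * g y) + fromℚ (identity v x)
        drift x = decide (v Fin.≟ x)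
          where
          decide : Dec (v ≡ x) → g x + κ * Gmin ≤ sum (λ y → Q x y * g y) + fromℚ (identity v x)
          decide (no v≢x) = ≤-trans (growth (λ x≡v → v≢x (≡.sym x≡v)))
            (≤-by (0≤fromℚ (RationalSums.identity-nonneg v x)) refl)
          -- No growth is available at v. The indicator pays 1 ≥ g(v), and Q g ≥ `Gmin` ≥ `κ * Gmin`
          -- because κ ≤ 1.
          decide (yes ≡.refl) = begin
            g v + κ * Gmin ≤⟨ +-mono-≤ (g≤1 v)
                (≤-trans (*-monoʳ-≤ (exp-nonneg _) κ≤1) (≤-reflexive (*-identityˡ Gmin))) ⟩
            1# + Gmin ≈⟨ +-comm 1# Gmin ⟩
            Gmin + 1# ≈⟨ +-cong (trans (*-congʳ (IsStochastic.rowSum Q-stochastic v)) (*-identityˡ Gmin))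
                                (trans (reflexive (≡.cong fromℚ (RationalSums.identity-≡ v))) fromℚ-1) ⟨
            sum (Q v) * Gmin + fromℚ (identity v v) ≈⟨ +-congʳ (sum-*ʳ (Q v) Gmin) ⟨
            sum (λ y → Q v y * Gmin) + fromℚ (identity v v)
              ≤⟨ +-mono-≤ (sum-mono (λ y → *-monoˡ-≤ (IsStochastic.nonneg Q-stochastic v y) (Gmin≤g y))) ≤-refl ⟩
            sum (λ y → Q v y * g y) + fromℚ (identity v v) ∎

        mass-lower : κ * Gmin ≤ μ v
        mass-lower = Drift.drift-bound line v g (κ * Gmin) drift

        -- `Gmin` factors as π(v)^s (1/2)^s e^(-2 s t L). The second factor is at least 1/2 since s
        -- ≤ 1, and the third at least e^(-1) since s t L ≤ 1/2.
        Gmin-lower : exp (s * lnp) * (fromℚ ½ * fromℚ (ℤ.+ 81 Rat./ 256)) ≤ Gmin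
        Gmin-lower = begin
          exp (s * lnp) * (fromℚ ½ * fromℚ (ℤ.+ 81 Rat./ 256))
            ≤⟨ *-monoˡ-≤ (exp-nonneg _) (*-mono-≤ (0≤fromℚ (ℚₚ.<⇒≤ ℚ-Lemmas.0<½)) half≤
                 (0≤fromℚ (ℚₚ.nonNegative⁻¹ (ℤ.+ 81 Rat./ 256))) e⁻¹≤) ⟩
          exp (s * lnp) * (exp (s * lnh) * exp (s * (fromℚ (fromℕ K) * - L)))
            ≈⟨ *-congˡ (exp-+ (s * lnh) (s * (fromℚ (fromℕ K) * - L))) ⟨
          exp (s * lnp) * exp (s * lnh + s * (fromℚ (fromℕ K) * - L)) ≈⟨ exp-+ (s * lnp) _ ⟨
          exp (s * lnp + (s * lnh + s * (fromℚ (fromℕ K) * - L)))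
            ≈⟨ exp-cong (solve 4 (λ s a b c → s :* a :+ (s :* b :+ s :* c) := s :* (a :+ b :+ c)) refl
                 s lnp lnh (fromℚ (fromℕ K) * - L)) ⟩
          Gmin ∎
          where
          half≤ : fromℚ ½ ≤ exp (s * lnh)
          half≤ = ≤-trans (≤-reflexive (sym exp-lnh)) (exp-mono (≤-by
            (*-nonneg (x≤y⇒0≤y-x s≤1) (x≤y⇒0≤y-x (exp≤1⇒≤0 exp-lnh (Rat.*≤* (ℤ.+≤+ (ℕ.s≤s ℕ.z≤n))))))
            (solve 2 (λ s l → l :+ (con 1ℚ :- s) :* (con 0ℚ :- l) := s :* l) refl s lnh)))
          e⁻¹≤ : fromℚ (ℤ.+ 81 Rat./ 256) ≤ exp (s * (fromℚ (fromℕ K) * - L))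
          e⁻¹≤ = ≤-trans exp-neg-1-lower (exp-mono (begin
            - 1# ≈⟨ solve 0 (:- con 1ℚ := :- (con ½ :+ con ½)) refl ⟩
            - (half + half) ≤⟨ neg-mono-≤ (+-mono-≤ upper upper) ⟩
            - (s * τ * L + s * τ * L)
              ≈⟨ solve 3 (λ s t L → :- (s :* t :* L :+ s :* t :* L) := s :* ((t :+ t) :* :- L)) refl s τ L ⟩
            s * ((τ + τ) * - L)
              ≈⟨ *-congˡ (*-congʳ (trans (reflexive (≡.cong fromℚ (NaturalFractions.fromℕ-+ t t)))
                  (fromℚ-+ (fromℕ t) (fromℕ t)))) ⟨
            s * (fromℚ (fromℕ K) * - L) ∎))

        -- 16 · 2/5 · 1/2 · (3/4)⁴ = 81/80.
        boost : exp (s * lnp) ≤ fromℚ (ℤ.+ 16 Rat./ 1) * τ * μ v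
        boost = begin
          exp (s * lnp) ≈⟨ *-identityʳ _ ⟨
          exp (s * lnp) * 1# ≤⟨ *-monoˡ-≤ (exp-nonneg _) (≤-trans (≤-reflexive (sym fromℚ-1)) (fromℚ-mono 1≤81/80)) ⟩
          exp (s * lnp) * fromℚ (ℤ.+ 81 Rat./ 80) ≈⟨ constants (exp (s * lnp)) ⟩
          fromℚ (ℤ.+ 16 Rat./ 1) * (fromℚ (ℤ.+ 2 Rat./ 5) * (exp (s * lnp) * (fromℚ ½ * fromℚ (ℤ.+ 81 Rat./ 256))))
            ≤⟨ *-monoˡ-≤ (0≤fromℚ (ℚₚ.nonNegative⁻¹ (ℤ.+ 16 Rat./ 1))) (*-mono-≤
                 (0≤fromℚ (ℚₚ.nonNegative⁻¹ (ℤ.+ 2 Rat./ 5))) lower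
                 (*-nonneg (exp-nonneg _) (*-nonneg (0≤fromℚ (ℚₚ.<⇒≤ ℚ-Lemmas.0<½))
                     (0≤fromℚ (ℚₚ.nonNegative⁻¹ (ℤ.+ 81 Rat./ 256)))))
                 Gmin-lower) ⟩
          fromℚ (ℤ.+ 16 Rat./ 1) * (s * τ * L * Gmin)
            ≈⟨ solve 5 (λ c s t L G → c :* (s :* t :* L :* G) := c :* t :* (s :* L :* G)) refl
                 (fromℚ (ℤ.+ 16 Rat./ 1)) s τ L Gmin ⟩
          fromℚ (ℤ.+ 16 Rat./ 1) * τ * (κ * Gmin)
            ≤⟨ *-monoˡ-≤ (*-nonneg (0≤fromℚ (ℚₚ.nonNegative⁻¹ (ℤ.+ 16 Rat./ 1))) (≤-trans 0≤1# 1≤τ)) mass-lower ⟩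
          fromℚ (ℤ.+ 16 Rat./ 1) * τ * μ v ∎
          where
          1≤81/80 : 1ℚ Rat.≤ ℤ.+ 81 Rat./ 80
          1≤81/80 = Rat.*≤* (ℤ.+≤+ (ℕₚ.m≤m+n 80 1))
          constants : ∀ a → a * fromℚ (ℤ.+ 81 Rat./ 80) ≈
            fromℚ (ℤ.+ 16 Rat./ 1) * (fromℚ (ℤ.+ 2 Rat./ 5) * (a * (fromℚ ½ * fromℚ (ℤ.+ 81 Rat./ 256))))
          constants = solve 1 (λ a → a :* con (ℤ.+ 81 Rat./ 80) :=
            con (ℤ.+ 16 Rat./ 1) :* (con (ℤ.+ 2 Rat./ 5) :* (a :* (con ½ :* con (ℤ.+ 81 Rat./ 256))))) refl

        lnp≤0 : lnp ≤ 0#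
        lnp≤0 = exp≤1⇒≤0 exp-lnp (≡.subst (π v Rat.≤_) π-sum (RationalSums.term≤sumℚ (λ x → ℚₚ.<⇒≤ (0<π x)) v))

        -- The choice of δ makes π(v)^δ equal to 1/(16 t), so multiplying by e^ℓ = 16 t removes δ
        -- from the exponent and leaves `boost`.
        boost-exponent : ∀ {ℓ δ} → exp ℓ ≈ fromℚ (ℤ.+ 16 Rat./ 1) * τ → δ * - lnp ≈ ℓ → exp ((s + δ) * lnp) ≤ μ v
        boost-exponent {ℓ} {δ} exp-ℓ δlnp≈ℓ = *-cancelˡ-≤ (exp-pos ℓ) (begin
          exp ℓ * exp ((s + δ) * lnp) ≈⟨ exp-+ ℓ ((s + δ) * lnp) ⟨
          exp (ℓ + (s + δ) * lnp)
            ≈⟨ exp-cong (trans (+-congʳ (sym δlnp≈ℓ))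
                 (solve 3 (λ s d l → d :* (:- l) :+ (s :+ d) :* l := s :* l) refl s δ lnp)) ⟩
          exp (s * lnp) ≤⟨ boost ⟩
          fromℚ (ℤ.+ 16 Rat./ 1) * τ * μ v ≈⟨ *-congʳ exp-ℓ ⟨
          exp ℓ * μ v ∎)

      Boosts : SquareMatrix n → Set
      Boosts B = (∀ x y → 0# ≤ B x y) × (∀ x → sum (B x) ≈ 1#) × (∀ x y → ¬ (x ~ y) → B x y ≈ 0#) ×
        ∃ λ (line : InvariantLine (λ x y → mix (RandomWalk.P G x y) (B x y))) →
          ∀ ℓ δ → exp ℓ ≈ fromℚ (ℤ.+ 16 Rat./ 1) * fromℚ (fromℕ t) → δ * - lnp ≈ ℓ →
            exp ((1# - ε + δ) * lnp) ≤ InvariantLine.μ line v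

      opaque
        boosting-strategy : ∃ Boosts
        boosting-strategy = B , B-nonneg , B-rowSum , B-supported , line , λ ℓ δ → boost-exponent {ℓ} {δ}

open import Defs

-- Real numbers

module ℝ-Properties where
  open ≡ using (refl; sym; trans; cong; cong₂; subst; subst₂)
  open ℚₚ.≤-Reasoning
  open +-*-Solver
  open ℚ-Lemmas

  opaque
    self-gap : ∀ q {e} → 0ℚ Rat.< e → Rat.∣ q Rat.- q ∣ Rat.≤ e
    self-gap q {e} 0<e = subst (Rat._≤ e) (sym (cong Rat.∣_∣ (ℚₚ.+-inverseʳ q))) (ℚₚ.<⇒≤ 0<e)

    pointwise : ∀ x y → (∀ n → seq x n ≡ seq y n) → x ≈ y
    pointwise x y eq {e} 0<e = 0 , λ {n} _ →
      subst (λ z → Rat.∣ seq x n Rat.- z ∣ Rat.≤ e) (eq n) (self-gap (seq x n) 0<e)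

    pointwise-from : ∀ x y N → (∀ n → N ℕ.≤ n → seq x n ≡ seq y n) → x ≈ y
    pointwise-from x y N eq {e} 0<e = N , λ {n} N≤n →
      subst (λ z → Rat.∣ seq x n Rat.- z ∣ Rat.≤ e) (eq n N≤n) (self-gap (seq x n) 0<e)

    ≈-refl : ∀ x → x ≈ x
    ≈-refl x = pointwise x x (λ _ → refl)

    ≈-sym : ∀ x y → x ≈ y → y ≈ x
    ≈-sym x y x≈y {e} 0<e with x≈y 0<e
    ... | N , close = N , λ {n} N≤n → subst (Rat._≤ e) (∣-∣-sym (seq x n) (seq y n)) (close N≤n)

    ≈-trans : ∀ x y z → x ≈ y → y ≈ z → x ≈ z
    ≈-trans x y z x≈y y≈z {e} 0<e with x≈y (half-pos 0<e) | y≈z (half-pos 0<e)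
    ... | M , closeˣ | N , closeʸ = M ℕ.⊔ N , λ {n} ≤n → begin
      Rat.∣ seq x n Rat.- seq z n ∣ ≤⟨ triangle (seq x n) (seq y n) (seq z n) ⟩
      Rat.∣ seq x n Rat.- seq y n ∣ Rat.+ Rat.∣ seq y n Rat.- seq z n ∣
        ≤⟨ ℚₚ.+-mono-≤ (closeˣ (ℕₚ.m⊔n≤o⇒m≤o M N ≤n)) (closeʸ (ℕₚ.m⊔n≤o⇒n≤o M N ≤n)) ⟩
      ½ Rat.* e Rat.+ ½ Rat.* e ≡⟨ half+half e ⟩
      e ∎

    +-gap : ∀ a b c d → Rat.∣ (a Rat.+ b) Rat.- (c Rat.+ d) ∣ Rat.≤ Rat.∣ a Rat.- c ∣ Rat.+ Rat.∣ b Rat.- d ∣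
    +-gap a b c d = subst (λ z → Rat.∣ z ∣ Rat.≤ Rat.∣ a Rat.- c ∣ Rat.+ Rat.∣ b Rat.- d ∣)
      (solve 4 (λ a b c d → (a :- c) :+ (b :- d) := (a :+ b) :- (c :+ d)) refl a b c d)
      (ℚₚ.∣p+q∣≤∣p∣+∣q∣ (a Rat.- c) (b Rat.- d))

    +-cong : ∀ x y u v → x ≈ y → u ≈ v → x + u ≈ y + v
    +-cong x y u v x≈y u≈v {e} 0<e with x≈y (half-pos 0<e) | u≈v (half-pos 0<e)
    ... | M , closeˣ | N , closeᵘ = M ℕ.⊔ N , λ {n} ≤n → begin
      Rat.∣ (seq x n Rat.+ seq u n) Rat.- (seq y n Rat.+ seq v n) ∣
        ≤⟨ +-gap (seq x n) (seq u n) (seq y n) (seq v n) ⟩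
      Rat.∣ seq x n Rat.- seq y n ∣ Rat.+ Rat.∣ seq u n Rat.- seq v n ∣
        ≤⟨ ℚₚ.+-mono-≤ (closeˣ (ℕₚ.m⊔n≤o⇒m≤o M N ≤n)) (closeᵘ (ℕₚ.m⊔n≤o⇒n≤o M N ≤n)) ⟩
      ½ Rat.* e Rat.+ ½ Rat.* e ≡⟨ half+half e ⟩
      e ∎

    neg-cong : ∀ x y → x ≈ y → - x ≈ - y
    neg-cong x y x≈y {e} 0<e with x≈y 0<e
    ... | N , close = N , λ {n} N≤n → subst (Rat._≤ e)
      (trans (∣-∣-sym (seq x n) (seq y n)) (cong Rat.∣_∣ (flip (seq x n) (seq y n)))) (close N≤n)
      where
      flip : ∀ a b → b Rat.- a ≡ (Rat.- a) Rat.- (Rat.- b)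
      flip = solve 2 (λ a b → b :- a := (:- a) :- (:- b)) refl

    *-gap : ∀ a b c d {A B} → Rat.∣ a ∣ Rat.≤ A → Rat.∣ d ∣ Rat.≤ B → ∀ {s t} →
      Rat.∣ b Rat.- d ∣ Rat.≤ s → Rat.∣ a Rat.- c ∣ Rat.≤ t →
      Rat.∣ a Rat.* b Rat.- c Rat.* d ∣ Rat.≤ A Rat.* s Rat.+ B Rat.* t
    *-gap a b c d {A} {B} a≤A d≤B {s} {t} ≤s ≤t = begin
      Rat.∣ a Rat.* b Rat.- c Rat.* d ∣
        ≡⟨ cong Rat.∣_∣ (solve 4 (λ a b c d → a :* b :- c :* d := a :* (b :- d) :+ d :* (a :- c)) refl a b c d) ⟩
      Rat.∣ a Rat.* (b Rat.- d) Rat.+ d Rat.* (a Rat.- c) ∣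
        ≤⟨ ℚₚ.∣p+q∣≤∣p∣+∣q∣ (a Rat.* (b Rat.- d)) (d Rat.* (a Rat.- c)) ⟩
      Rat.∣ a Rat.* (b Rat.- d) ∣ Rat.+ Rat.∣ d Rat.* (a Rat.- c) ∣
        ≡⟨ cong₂ Rat._+_ (ℚₚ.∣p*q∣≡∣p∣*∣q∣ a (b Rat.- d)) (ℚₚ.∣p*q∣≡∣p∣*∣q∣ d (a Rat.- c)) ⟩
      Rat.∣ a ∣ Rat.* Rat.∣ b Rat.- d ∣ Rat.+ Rat.∣ d ∣ Rat.* Rat.∣ a Rat.- c ∣
        ≤⟨ ℚₚ.+-mono-≤ (*-mono-≤ (ℚₚ.0≤∣p∣ a) a≤A (ℚₚ.0≤∣p∣ (b Rat.- d)) ≤s)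
                       (*-mono-≤ (ℚₚ.0≤∣p∣ d) d≤B (ℚₚ.0≤∣p∣ (a Rat.- c)) ≤t) ⟩
      A Rat.* s Rat.+ B Rat.* t ∎

    *-cong : ∀ x y u v → x ≈ y → u ≈ v → x * u ≈ y * v
    *-cong x y u v x≈y u≈v {e} 0<e with ℝ-Bounds.bounded x | ℝ-Bounds.bounded v
    ... | A , 0<A , x≤A | B , 0<B , v≤B with shrink 0<A (half-pos 0<e) | shrink 0<B (half-pos 0<e)
    ... | a , 0<a , Aa≡ | b , 0<b , Bb≡ with u≈v 0<a | x≈y 0<b
    ... | M , closeᵘ | N , closeˣ = M ℕ.⊔ N , λ {n} ≤n → ℚₚ.≤-trans
      (*-gap (seq x n) (seq u n) (seq y n) (seq v n) (x≤A n) (v≤B n)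
        (closeᵘ (ℕₚ.m⊔n≤o⇒m≤o M N ≤n)) (closeˣ (ℕₚ.m⊔n≤o⇒n≤o M N ≤n)))
      (ℚₚ.≤-reflexive (trans (cong₂ Rat._+_ Aa≡ Bb≡) (half+half e)))

    ≤-reflexive : ∀ x y → x ≈ y → x ≤ y
    ≤-reflexive x y x≈y {e} 0<e with x≈y 0<e
    ... | N , close = N , λ {n} N≤n → ℚₚ.≤-trans (split (seq x n) (seq y n))
      (ℚₚ.+-monoʳ-≤ (seq y n) (close N≤n))
      where
      split : ∀ a b → a Rat.≤ b Rat.+ Rat.∣ a Rat.- b ∣
      split a b = subst (Rat._≤ b Rat.+ Rat.∣ a Rat.- b ∣)
        (solve 2 (λ a b → b :+ (a :- b) := a) refl a b) (ℚₚ.+-monoʳ-≤ b (p≤∣p∣ (a Rat.- b)))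

    +-halves : ∀ a e → (a Rat.+ ½ Rat.* e) Rat.+ ½ Rat.* e ≡ a Rat.+ e
    +-halves a e = trans (ℚₚ.+-assoc a (½ Rat.* e) (½ Rat.* e)) (cong (a Rat.+_) (half+half e))

    ≤-trans : ∀ x y z → x ≤ y → y ≤ z → x ≤ z
    ≤-trans x y z x≤y y≤z {e} 0<e with x≤y (half-pos 0<e) | y≤z (half-pos 0<e)
    ... | M , leˣ | N , leʸ = M ℕ.⊔ N , λ {n} ≤n → ℚₚ.≤-trans (leˣ (ℕₚ.m⊔n≤o⇒m≤o M N ≤n))
      (ℚₚ.≤-trans (ℚₚ.+-monoˡ-≤ (½ Rat.* e) (leʸ (ℕₚ.m⊔n≤o⇒n≤o M N ≤n)))
        (ℚₚ.≤-reflexive (+-halves (seq z n) e)))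

    ≤-antisym : ∀ x y → x ≤ y → y ≤ x → x ≈ y
    ≤-antisym x y x≤y y≤x {e} 0<e with x≤y 0<e | y≤x 0<e
    ... | M , le | N , ge = M ℕ.⊔ N , λ {n} ≤n → ∣∣-≤
      (≤-move (le (ℕₚ.m⊔n≤o⇒m≤o M N ≤n)))
      (subst (Rat._≤ e) (flip (seq x n) (seq y n)) (≤-move (ge (ℕₚ.m⊔n≤o⇒n≤o M N ≤n))))
      where
      flip : ∀ a b → b Rat.- a ≡ Rat.- (a Rat.- b)
      flip = solve 2 (λ a b → b :- a := :- (a :- b)) refl

    +-mono-≤ : ∀ x y u v → x ≤ y → u ≤ v → x + u ≤ y + v
    +-mono-≤ x y u v x≤y u≤v {e} 0<e with x≤y (half-pos 0<e) | u≤v (half-pos 0<e)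
    ... | M , leˣ | N , leᵘ = M ℕ.⊔ N , λ {n} ≤n → ℚₚ.≤-trans
      (ℚₚ.+-mono-≤ (leˣ (ℕₚ.m⊔n≤o⇒m≤o M N ≤n)) (leᵘ (ℕₚ.m⊔n≤o⇒n≤o M N ≤n)))
      (ℚₚ.≤-reflexive (regroup (seq y n) (seq v n)))
      where
      regroup : ∀ a b → (a Rat.+ ½ Rat.* e) Rat.+ (b Rat.+ ½ Rat.* e) ≡ (a Rat.+ b) Rat.+ e
      regroup a b = trans
        (solve 3 (λ a b h → (a :+ h) :+ (b :+ h) := (a :+ b) :+ (h :+ h)) refl a b (½ Rat.* e))
        (cong ((a Rat.+ b) Rat.+_) (half+half e))

    -- Expand (a + s)(b + t) ≥ 0.
    *-lower : ∀ {a b A B s t} → 0ℚ Rat.≤ a Rat.+ s → 0ℚ Rat.≤ b Rat.+ t →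
      Rat.∣ a ∣ Rat.≤ A → Rat.∣ b ∣ Rat.≤ B → 0ℚ Rat.≤ s → 0ℚ Rat.≤ t → s Rat.≤ 1ℚ →
      0ℚ Rat.≤ a Rat.* b Rat.+ ((A Rat.+ 1ℚ) Rat.* t Rat.+ B Rat.* s)
    *-lower {a} {b} {A} {B} {s} {t} 0≤a+s 0≤b+t a≤A b≤B 0≤s 0≤t s≤1 = begin
      0ℚ ≤⟨ *-nonneg 0≤a+s 0≤b+t ⟩
      (a Rat.+ s) Rat.* (b Rat.+ t)
        ≡⟨ solve 4 (λ a b s t → (a :+ s) :* (b :+ t) := a :* b :+ ((a :+ s) :* t :+ b :* s)) refl a b s t ⟩
      a Rat.* b Rat.+ ((a Rat.+ s) Rat.* t Rat.+ b Rat.* s)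
        ≤⟨ ℚₚ.+-monoʳ-≤ (a Rat.* b) (ℚₚ.+-mono-≤
             (ℚₚ.*-monoʳ-≤-nonNeg t {{Rat.nonNegative 0≤t}} (ℚₚ.+-mono-≤ (ℚₚ.≤-trans (p≤∣p∣ a) a≤A) s≤1))
             (ℚₚ.*-monoʳ-≤-nonNeg s {{Rat.nonNegative 0≤s}} (ℚₚ.≤-trans (p≤∣p∣ b) b≤B))) ⟩
      a Rat.* b Rat.+ ((A Rat.+ 1ℚ) Rat.* t Rat.+ B Rat.* s) ∎

    ⊓-pos : ∀ {s} → 0ℚ Rat.< s → 0ℚ Rat.< s Rat.⊓ 1ℚ
    ⊓-pos {s} 0<s with ℚₚ.⊓-sel s 1ℚ
    ... | inj₁ eq = subst (0ℚ Rat.<_) (sym eq) 0<s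
    ... | inj₂ eq = subst (0ℚ Rat.<_) (sym eq) 0<1

    *-nonnegℝ : ∀ x y → 0ℝ ≤ x → 0ℝ ≤ y → 0ℝ ≤ x * y
    *-nonnegℝ x y 0≤x 0≤y {e} 0<e with ℝ-Bounds.bounded x | ℝ-Bounds.bounded y
    ... | A , 0<A , x≤A | B , 0<B , y≤B
      with shrink (ℚₚ.<-≤-trans 0<A (p≤p+q {A} {1ℚ} 0≤1)) (half-pos 0<e) | shrink 0<B (half-pos 0<e)
    ... | t , 0<t , At≡ | s , 0<s , Bs≡
      -- Capping the error for x at 1 bounds x plus its error by A + 1, so the product of the two
      -- errors is absorbed into a linear term.
      with 0≤y 0<t | 0≤x {s Rat.⊓ 1ℚ} (⊓-pos 0<s)
    ... | N , geʸ | M , geˣ = M ℕ.⊔ N , λ {n} ≤n →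
      ℚₚ.≤-trans (*-lower (geˣ (ℕₚ.m⊔n≤o⇒m≤o M N ≤n))
          (geʸ (ℕₚ.m⊔n≤o⇒n≤o M N ≤n)) (x≤A n) (y≤B n)
          (ℚₚ.⊓-glb (ℚₚ.<⇒≤ 0<s) 0≤1) (ℚₚ.<⇒≤ 0<t) (ℚₚ.p⊓q≤q s 1ℚ))
        (ℚₚ.+-monoʳ-≤ (seq x n Rat.* seq y n) (ℚₚ.≤-trans
          (ℚₚ.+-monoʳ-≤ ((A Rat.+ 1ℚ) Rat.* t)
              (ℚₚ.*-monoˡ-≤-nonNeg B {{Rat.nonNegative (ℚₚ.<⇒≤ 0<B)}} (ℚₚ.p⊓q≤p s 1ℚ)))
          (ℚₚ.≤-reflexive (trans (cong₂ Rat._+_ At≡ Bs≡) (half+half e)))))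

    fromℚ-monoℝ : ∀ p q → p Rat.≤ q → fromℚ p ≤ fromℚ q
    fromℚ-monoℝ p q p≤q {e} 0<e = 0 , λ _ → ℚₚ.≤-trans p≤q (p≤p+q (ℚₚ.<⇒≤ 0<e))

    fromℚ-cancelℝ : ∀ p q → fromℚ p ≤ fromℚ q → p Rat.≤ q
    fromℚ-cancelℝ p q le with p ℚₚ.≤? q
    ... | yes p≤q = p≤q
    ... | no p≰q = ⊥-elim (contra (le (half-pos 0<d)))
      where
      d : ℚ
      d = p Rat.- q
      0<d : 0ℚ Rat.< d
      0<d = subst (Rat._< d) (ℚₚ.+-inverseʳ q) (ℚₚ.+-monoˡ-< (Rat.- q) (ℚₚ.≰⇒> p≰q))
      contra : (∃ λ N → ∀ {n} → N ℕ.≤ n → p Rat.≤ q Rat.+ ½ Rat.* d) → ⊥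
      contra (N , h) = ℚₚ.<-irrefl refl (ℚₚ.<-≤-trans
        (subst₂ Rat._<_ (ℚₚ.+-identityʳ (½ Rat.* d)) (half+half d) (ℚₚ.+-monoʳ-< (½ Rat.* d) (half-pos 0<d)))
        (≤-move (h {N} ℕₚ.≤-refl)))

    ≤-limitℝ : ∀ x y → (∀ {e} → 0ℚ Rat.< e → x ≤ y + fromℚ e) → x ≤ y
    ≤-limitℝ x y h {e} 0<e with h (half-pos 0<e) (half-pos 0<e)
    ... | N , le = N , λ {n} N≤n → ℚₚ.≤-trans (le N≤n) (ℚₚ.≤-reflexive (+-halves (seq y n) e))

    within : ∀ {a b r} → Rat.∣ a Rat.- b ∣ Rat.≤ r → a Rat.≤ b Rat.+ r
    within {a} {b} {r} le = subst (Rat._≤ b Rat.+ r)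
      (solve 2 (λ a b → b :+ (a :- b) := a) refl a b)
      (ℚₚ.+-monoʳ-≤ b (ℚₚ.≤-trans (p≤∣p∣ (a Rat.- b)) le))

    approximateℝ : ∀ x {e} → 0ℚ Rat.< e → ∃ λ q → fromℚ q ≤ x × x ≤ fromℚ (q Rat.+ e)
    approximateℝ x {e} 0<e with cauchy x (half-pos 0<e)
    -- All later terms lie within e/2 of the N-th one, so an interval of length e centred there
    -- contains the real; its lower end is the witness.
    ... | N , close = seq x N Rat.- ½ Rat.* e ,
      (λ 0<d → N , λ {n} N≤n → ℚₚ.≤-trans (≤-move
        (subst (seq x N Rat.≤_) (ℚₚ.+-comm (seq x n) (½ Rat.* e)) (within (close ℕₚ.≤-refl N≤n))))
            (p≤p+q (ℚₚ.<⇒≤ 0<d))) ,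
      (λ 0<d → N , λ {n} N≤n → ℚₚ.≤-trans (within (close N≤n ℕₚ.≤-refl))
        (ℚₚ.≤-trans (ℚₚ.≤-reflexive (recentre (seq x N))) (p≤p+q (ℚₚ.<⇒≤ 0<d))))
      where
      recentre : ∀ a → a Rat.+ ½ Rat.* e ≡ (a Rat.- ½ Rat.* e) Rat.+ e
      recentre a = trans (solve 2 (λ a h → a :+ h := (a :- h) :+ (h :+ h)) refl a (½ Rat.* e))
        (cong ((a Rat.- ½ Rat.* e) Rat.+_) (half+half e))

  ℝ-commutativeRing : CommutativeRing 0ℓ 0ℓ
  ℝ-commutativeRing = record
    { Carrier = ℝ ; _≈_ = _≈_ ; _+_ = _+_ ; _*_ = _*_ ; -_ = -_ ; 0# = 0ℝ ; 1# = 1ℝ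
    ; isCommutativeRing = record
      { isRing = record
        { +-isAbelianGroup = record
          { isGroup = record
            { isMonoid = record
              { isSemigroup = record
                { isMagma = record
                  { isEquivalence = ≈-isEquivalence
                  ; ∙-cong = λ {x} {y} {u} {v} → +-cong x y u v }
                ; assoc = λ x y z → pointwise ((x + y) + z) (x + (y + z)) λ n → ℚₚ.+-assoc (seq x n) (seq y n)
                    (seq z n) }
              ; identity = (λ x → pointwise (0ℝ + x) x λ n → ℚₚ.+-identityˡ (seq x n))
                         , (λ x → pointwise (x + 0ℝ) x λ n → ℚₚ.+-identityʳ (seq x n)) }
            ; inverse = (λ x → pointwise (- x + x) 0ℝ λ n → ℚₚ.+-inverseˡ (seq x n))
                      , (λ x → pointwise (x + - x) 0ℝ λ n → ℚₚ.+-inverseʳ (seq x n))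
            ; ⁻¹-cong = λ {x} {y} → neg-cong x y }
          ; comm = λ x y → pointwise (x + y) (y + x) λ n → ℚₚ.+-comm (seq x n) (seq y n) }
        ; *-cong = λ {x} {y} {u} {v} → *-cong x y u v
        ; *-assoc = λ x y z → pointwise ((x * y) * z) (x * (y * z)) λ n → ℚₚ.*-assoc (seq x n) (seq y n) (seq z n)
        ; *-identity = (λ x → pointwise (1ℝ * x) x λ n → ℚₚ.*-identityˡ (seq x n))
                     , (λ x → pointwise (x * 1ℝ) x λ n → ℚₚ.*-identityʳ (seq x n))
        ; distrib = (λ x y z → pointwise (x * (y + z)) (x * y + x * z) λ n → ℚₚ.*-distribˡ-+ (seq x n)
            (seq y n) (seq z n))
                  , (λ x y z → pointwise ((y + z) * x) (y * x + z * x) λ n → ℚₚ.*-distribʳ-+ (seq x n)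
                      (seq y n) (seq z n)) }
      ; *-comm = λ x y → pointwise (x * y) (y * x) λ n → ℚₚ.*-comm (seq x n) (seq y n) } }
    where
    ≈-isEquivalence : IsEquivalence _≈_
    ≈-isEquivalence = record
      { refl = λ {x} → ≈-refl x
      ; sym = λ {x} {y} → ≈-sym x y
      ; trans = λ {x} {y} {z} → ≈-trans x y z }

  -- Truncating at m makes every term invertible, and affects only finitely many terms once x > m.
  module Reciprocal (x : ℝ) {m : ℚ} (0<m : 0ℚ Rat.< m) where
    truncated : ℕ → ℚ
    truncated n = seq x n Rat.⊔ m

    0<truncated : ∀ n → 0ℚ Rat.< truncated n
    0<truncated n = ℚₚ.<-≤-trans 0<m (ℚₚ.p≤q⊔p (seq x n) m)

    r : ℚ
    r = proj₁ (shrink 0<m 0<1)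

    reciprocal : ℕ → ℚ
    reciprocal n = proj₁ (shrink (0<truncated n) 0<1)

    opaque
      0<r : 0ℚ Rat.< r
      0<r = proj₁ (proj₂ (shrink 0<m 0<1))

      0<reciprocal : ∀ n → 0ℚ Rat.< reciprocal n
      0<reciprocal n = proj₁ (proj₂ (shrink (0<truncated n) 0<1))

      reciprocal-inverse : ∀ n → truncated n Rat.* reciprocal n ≡ 1ℚ
      reciprocal-inverse n = proj₂ (proj₂ (shrink (0<truncated n) 0<1))

      reciprocal-antimono : ∀ {a b c d} → 0ℚ Rat.< a → a Rat.≤ b → 0ℚ Rat.< d →
        a Rat.* c ≡ 1ℚ → b Rat.* d ≡ 1ℚ → 0ℚ Rat.< c → d Rat.≤ c
      reciprocal-antimono {a} {b} {c} {d} 0<a a≤b 0<d ac≡1 bd≡1 0<c = begin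
        d                 ≡⟨ ℚₚ.*-identityʳ d ⟨
        d Rat.* 1ℚ        ≡⟨ cong (d Rat.*_) ac≡1 ⟨
        d Rat.* (a Rat.* c) ≤⟨ ℚₚ.*-monoˡ-≤-nonNeg d {{Rat.nonNegative (ℚₚ.<⇒≤ 0<d)}}
          (ℚₚ.*-monoʳ-≤-nonNeg c {{Rat.nonNegative (ℚₚ.<⇒≤ 0<c)}} a≤b) ⟩
        d Rat.* (b Rat.* c) ≡⟨ solve 3 (λ d b c → d :* (b :* c) := (b :* d) :* c) refl d b c ⟩
        (b Rat.* d) Rat.* c ≡⟨ cong (Rat._* c) bd≡1 ⟩
        1ℚ Rat.* c        ≡⟨ ℚₚ.*-identityˡ c ⟩
        c                 ∎

      reciprocal≤r : ∀ n → reciprocal n Rat.≤ r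
      reciprocal≤r n = reciprocal-antimono 0<m (ℚₚ.p≤q⊔p (seq x n) m) (0<reciprocal n)
        (proj₂ (proj₂ (shrink 0<m 0<1))) (reciprocal-inverse n) 0<r

      reciprocal-gap : ∀ {a b c d e} → a Rat.* c ≡ 1ℚ → b Rat.* d ≡ 1ℚ →
        0ℚ Rat.< c → c Rat.≤ e → 0ℚ Rat.< d → d Rat.≤ e → Rat.∣ c Rat.- d ∣ Rat.≤ (e Rat.* e) Rat.* Rat.∣ b Rat.- a ∣
      reciprocal-gap {a} {b} {c} {d} {e} ac≡1 bd≡1 0<c c≤e 0<d d≤e = begin
        Rat.∣ c Rat.- d ∣ ≡⟨ cong₂ (λ u v → Rat.∣ u Rat.- v ∣)
            (trans (sym (ℚₚ.*-identityʳ c)) (cong (c Rat.*_) (sym bd≡1)))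
                                   (trans (sym (ℚₚ.*-identityʳ d)) (cong (d Rat.*_) (sym ac≡1))) ⟩
        Rat.∣ c Rat.* (b Rat.* d) Rat.- d Rat.* (a Rat.* c) ∣
          ≡⟨ cong Rat.∣_∣ (solve 4 (λ a b c d → c :* (b :* d) :- d :* (a :* c) := (c :* d) :*
              (b :- a)) refl a b c d) ⟩
        Rat.∣ (c Rat.* d) Rat.* (b Rat.- a) ∣ ≡⟨ ℚₚ.∣p*q∣≡∣p∣*∣q∣ (c Rat.* d) (b Rat.- a) ⟩
        Rat.∣ c Rat.* d ∣ Rat.* Rat.∣ b Rat.- a ∣
          ≡⟨ cong (Rat._* Rat.∣ b Rat.- a ∣) (ℚₚ.0≤p⇒∣p∣≡p (*-nonneg (ℚₚ.<⇒≤ 0<c) (ℚₚ.<⇒≤ 0<d))) ⟩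
        (c Rat.* d) Rat.* Rat.∣ b Rat.- a ∣
          ≤⟨ ℚₚ.*-monoʳ-≤-nonNeg Rat.∣ b Rat.- a ∣ {{Rat.nonNegative (ℚₚ.0≤∣p∣ (b Rat.- a))}}
               (*-mono-≤ (ℚₚ.<⇒≤ 0<c) c≤e (ℚₚ.<⇒≤ 0<d) d≤e) ⟩
        (e Rat.* e) Rat.* Rat.∣ b Rat.- a ∣ ∎

      ⊔-contract : ∀ a b c → Rat.∣ (a Rat.⊔ c) Rat.- (b Rat.⊔ c) ∣ Rat.≤ Rat.∣ a Rat.- b ∣
      ⊔-contract a b c = ∣∣-≤ (≤-move (half-way a b))
        (subst (Rat._≤ Rat.∣ a Rat.- b ∣) (solve 2 (λ p q → q :- p := :- (p :- q)) refl (a Rat.⊔ c) (b Rat.⊔ c))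
          (≤-move (subst (λ z → b Rat.⊔ c Rat.≤ a Rat.⊔ c Rat.+ z) (∣-∣-sym b a) (half-way b a))))
        where
        half-way : ∀ a b → a Rat.⊔ c Rat.≤ b Rat.⊔ c Rat.+ Rat.∣ a Rat.- b ∣
        half-way a b = ℚₚ.⊔-lub
          (ℚₚ.≤-trans (within {a} {b} ℚₚ.≤-refl) (ℚₚ.+-monoˡ-≤ Rat.∣ a Rat.- b ∣ (ℚₚ.p≤p⊔q b c)))
          (ℚₚ.≤-trans (ℚₚ.p≤q⊔p b c) (p≤p+q (ℚₚ.0≤∣p∣ (a Rat.- b))))

      reciprocal-cauchy : ∀ {e} → 0ℚ Rat.< e → ∃ λ N → ∀ {j k} → N ℕ.≤ j → N ℕ.≤ k →
        Rat.∣ reciprocal j Rat.- reciprocal k ∣ Rat.≤ e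
      reciprocal-cauchy {e} 0<e with shrink (*-pos 0<r 0<r) 0<e
      ... | d , 0<d , rrd≡e with cauchy x 0<d
      ... | N , close = N , λ {j} {k} N≤j N≤k → ℚₚ.≤-trans
        (reciprocal-gap {truncated j} {truncated k} {reciprocal j} {reciprocal k} {r}
          (reciprocal-inverse j) (reciprocal-inverse k) (0<reciprocal j) (reciprocal≤r j)
          (0<reciprocal k) (reciprocal≤r k))
        (ℚₚ.≤-trans (ℚₚ.*-monoˡ-≤-nonNeg (r Rat.* r) {{Rat.nonNegative (ℚₚ.<⇒≤ (*-pos 0<r 0<r))}}
            (ℚₚ.≤-trans (⊔-contract (seq x k) (seq x j) m) (close N≤k N≤j)))
          (ℚₚ.≤-reflexive rrd≡e))

    1/ℝ : ℝ
    1/ℝ = record { seq = reciprocal ; cauchy = reciprocal-cauchy }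

    opaque
      1/ℝ-inverse : (∃ λ N → ∀ {n} → N ℕ.≤ n → m Rat.≤ seq x n) → x * 1/ℝ ≈ 1ℝ
      1/ℝ-inverse (N , m≤x) = pointwise-from (x * 1/ℝ) 1ℝ N λ n N≤n →
        trans (cong (Rat._* reciprocal n) (sym (ℚₚ.p≥q⇒p⊔q≡p (m≤x N≤n)))) (reciprocal-inverse n)

  opaque
    inverseℝ : ∀ x q → 0ℚ Rat.< q → fromℚ q ≤ x → ∃ λ y → x * y ≈ 1ℝ
    inverseℝ x q 0<q q≤x = 1/ℝ , 1/ℝ-inverse (eventually (q≤x (half-pos 0<q)))
      where
      -- The hypothesis bounds the terms of the sequence below by q only up to an error, so the
      -- truncation level is q/2, which they eventually exceed or equal.
      open Reciprocal x (half-pos 0<q)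
      eventually : (∃ λ N → ∀ {n} → N ℕ.≤ n → q Rat.≤ seq x n Rat.+ ½ Rat.* q) →
        ∃ λ N → ∀ {n} → N ℕ.≤ n → ½ Rat.* q Rat.≤ seq x n
      eventually (N , le) = N , λ {n} N≤n → cancel (seq x n) (le N≤n)
        where
        cancel : ∀ a → q Rat.≤ a Rat.+ ½ Rat.* q → ½ Rat.* q Rat.≤ a
        cancel a le = subst (Rat._≤ a)
          (trans (cong (Rat._- ½ Rat.* q) (sym (half+half q))) (solve 1 (λ h → (h :+ h) :- h := h) refl (½ Rat.* q)))
          (≤-move (subst (q Rat.≤_) (ℚₚ.+-comm a (½ Rat.* q)) le))

  ℝ-field : ArchimedeanField
  ℝ-field = record
    { commutativeRing = ℝ-commutativeRing
    ; _≤_ = _≤_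
    ; ≤-reflexive = λ {x} {y} → ≤-reflexive x y
    ; ≤-trans = λ {x} {y} {z} → ≤-trans x y z
    ; ≤-antisym = λ {x} {y} → ≤-antisym x y
    ; +-mono-≤ = λ {x} {y} {u} {v} → +-mono-≤ x y u v
    ; *-nonneg = λ {x} {y} → *-nonnegℝ x y
    ; fromℚ = fromℚ
    ; fromℚ-+ = λ p q → pointwise (fromℚ (p Rat.+ q)) (fromℚ p + fromℚ q) λ _ → refl
    ; fromℚ-* = λ p q → pointwise (fromℚ (p Rat.* q)) (fromℚ p * fromℚ q) λ _ → refl
    ; fromℚ-neg = λ p → pointwise (fromℚ (Rat.- p)) (- fromℚ p) λ _ → refl
    ; fromℚ-0 = ≈-refl 0ℝ
    ; fromℚ-1 = ≈-refl 1ℝ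
    ; fromℚ-mono = λ {p} {q} → fromℚ-monoℝ p q
    ; fromℚ-cancel = λ {p} {q} → fromℚ-cancelℝ p q
    ; ≤-limit = λ {x} {y} → ≤-limitℝ x y
    ; approximate = λ x → approximateℝ x
    ; inverse = λ {x} {q} → inverseℝ x q
    }

  open ExpSumProperties

  opaque
    -- On a bounded interval the partial sums are Lipschitz with a constant `E` that does not depend
    -- on their length, which suits the diagonal definition of `exp`.
    exp-congℝ : ∀ x y → x ≈ y → exp x ≈ exp y
    exp-congℝ x y x≈y {e} 0<e with ℝ-Bounds.bounded x | ℝ-Bounds.bounded y
    ... | A , 0<A , x≤A | B , 0<B , y≤B = close (x≈y 0<d)
      where
      K : ℚ
      K = A Rat.+ B
      0<K : 0ℚ Rat.< K
      0<K = ℚₚ.<-≤-trans 0<A (p≤p+q (ℚₚ.<⇒≤ 0<B))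
      open ExpSeries using (expSum)
      E : ℚ
      E = ExpSeries.E 0<K
      0<E : 0ℚ Rat.< E
      0<E = ExpSeries.0<E 0<K
      d : ℚ
      d = proj₁ (shrink 0<E 0<e)
      0<d : 0ℚ Rat.< d
      0<d = proj₁ (proj₂ (shrink 0<E 0<e))
      Ed≡e : E Rat.* d ≡ e
      Ed≡e = proj₂ (proj₂ (shrink 0<E 0<e))
      close : (∃ λ N → ∀ {n} → N ℕ.≤ n → Rat.∣ seq x n Rat.- seq y n ∣ Rat.≤ d) →
        ∃ λ N → ∀ {n} → N ℕ.≤ n → Rat.∣ expSum (seq x n) n Rat.- expSum (seq y n) n ∣ Rat.≤ e
      close (N , h) = N , λ {n} N≤n → ℚₚ.≤-trans
        (ExpSeries.sum-lipschitz 0<K (ℚₚ.≤-trans (x≤A n) (p≤p+q (ℚₚ.<⇒≤ 0<B)))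
          (ℚₚ.≤-trans (y≤B n) (p≤q+p (ℚₚ.<⇒≤ 0<A))) n)
        (ℚₚ.≤-trans (*-mono-≤ (ℚₚ.0≤∣p∣ (seq x n Rat.- seq y n)) (h N≤n) (ExpSeries.0≤S 0<K n) (ExpSeries.S≤E 0<K n))
          (ℚₚ.≤-reflexive (trans (ℚₚ.*-comm d E) Ed≡e)))

    exp-+ℝ : ∀ x y → exp (x + y) ≈ exp x * exp y
    exp-+ℝ x y {e} 0<e with ℝ-Bounds.bounded x | ℝ-Bounds.bounded y
    ... | A , 0<A , x≤A | B , 0<B , y≤B = close (ExpSeries.tail-small 0<2K 0<e)
      where
      open ExpSeries using (expSum)
      K : ℚ
      K = A Rat.+ B
      0<K : 0ℚ Rat.< K
      0<K = ℚₚ.<-≤-trans 0<A (p≤p+q (ℚₚ.<⇒≤ 0<B))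
      0<2K : 0ℚ Rat.< K Rat.+ K
      0<2K = ℚₚ.<-≤-trans 0<K (p≤p+q (ℚₚ.<⇒≤ 0<K))
      close : (∃ λ N → ∀ {m n} → N ℕ.≤ m → m ℕ.≤ n → expSum (K Rat.+ K) n Rat.- expSum (K Rat.+ K) m Rat.≤ e) →
        ∃ λ N → ∀ {n} → N ℕ.≤ n →
          Rat.∣ expSum (seq x n Rat.+ seq y n) n Rat.- expSum (seq x n) n Rat.* expSum (seq y n) n ∣ Rat.≤ e
      close (N , tail) = N , λ {n} N≤n → ℚₚ.≤-trans
        (ℚₚ.≤-reflexive (∣-∣-sym (expSum (seq x n Rat.+ seq y n) n) (expSum (seq x n) n Rat.* expSum (seq y n) n)))
        (ℚₚ.≤-trans (expSum-product-gap 0<K (ℚₚ.≤-trans (x≤A n) (p≤p+q (ℚₚ.<⇒≤ 0<B)))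
            (ℚₚ.≤-trans (y≤B n) (p≤q+p (ℚₚ.<⇒≤ 0<A))) n)
          (tail N≤n (ℕₚ.m≤m+n n n)))

    1+x≤expℝ : ∀ x q → 0ℚ Rat.< q → - 1ℝ + fromℚ q ≤ x → 1ℝ + x ≤ exp x
    1+x≤expℝ x q 0<q -1+q≤x {e} 0<e with -1+q≤x 0<q
    -- The allowed error is the margin `q` itself, which leaves terms that are at least -1. From
    -- index 2 on the partial sum contains both summands of 1 + x.
    ... | N , le = N ℕ.⊔ 2 , λ {n} ≤n → bound n (ℕₚ.m⊔n≤o⇒n≤o N 2 ≤n)
        (cancel (seq x n) (le (ℕₚ.m⊔n≤o⇒m≤o N 2 ≤n)))
      where
      cancel : ∀ a → Rat.- 1ℚ Rat.+ q Rat.≤ a Rat.+ q → Rat.- 1ℚ Rat.≤ a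
      cancel a le = subst (Rat._≤ a) (solve 1 (λ q → (:- con 1ℚ :+ q) :- q := :- con 1ℚ) refl q)
        (≤-move (subst (Rat.- 1ℚ Rat.+ q Rat.≤_) (ℚₚ.+-comm a q) le))
      bound : ∀ n → 2 ℕ.≤ n → Rat.- 1ℚ Rat.≤ seq x n →
        1ℚ Rat.+ seq x n Rat.≤ ExpSeries.expSum (seq x n) n Rat.+ e
      bound (suc (suc n)) _ -1≤x = ℚₚ.≤-trans (expSum-lower -1≤x n) (p≤p+q (ℚₚ.<⇒≤ 0<e))
      bound (suc zero) (ℕ.s≤s ())

  ℝ-exponential : Exponential ℝ-field
  ℝ-exponential = record
    { exp      = exp
    ; exp-cong = λ {x} {y} → exp-congℝ x y
    ; exp-+    = exp-+ℝ
    ; 1+x≤exp₀ = λ {x} {q} → 1+x≤expℝ x q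
    }

  module R = FieldProperties ℝ-field
  module RExp = ExponentialProperties ℝ-field ℝ-exponential

-- Existence of logarithms of positive rationals

module Logarithm where
  open ≡ using (refl; sym; trans; cong; cong₂; subst; subst₂)
  open ℚ-Lemmas
  open ℝ-Properties
  open +-*-Solver

  module _ {q : ℚ} (0<q : 0ℚ Rat.< q) where
    Approximation : ℕ → Set
    Approximation k = ∃ λ r → exp (fromℚ r) ≤ fromℚ q × fromℚ q ≤ exp (fromℚ (r Rat.+ recip k))

    opaque
      approximation : ∀ k → Approximation k
      approximation k = RExp.log-approximation 0<q (0<recip k)

    r : ℕ → ℚ
    r k = proj₁ (approximation k)

    opaque
      lower : ∀ k → exp (fromℚ (r k)) ≤ fromℚ q
      lower k = proj₁ (proj₂ (approximation k))

      upper : ∀ k → fromℚ q ≤ exp (fromℚ (r k Rat.+ recip k))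
      upper k = proj₂ (proj₂ (approximation k))

      -- All brackets contain ln q, so the lower end of any one lies below the upper end of any
      -- other. This comparison of exponentials of rationals yields the Cauchy property before the
      -- limit is available.
      r-near : ∀ j k → r j Rat.≤ r k Rat.+ recip k
      r-near j k = fromℚ-cancelℝ (r j) (r k Rat.+ recip k)
        (RExp.exp-cancel-≤ {fromℚ (r j)} {fromℚ (r k Rat.+ recip k)}
          (≤-trans (exp (fromℚ (r j))) (fromℚ q) (exp (fromℚ (r k Rat.+ recip k))) (lower j) (upper k)))

      r-cauchy : ∀ {e} → 0ℚ Rat.< e → ∃ λ N → ∀ {j k} → N ℕ.≤ j → N ℕ.≤ k → Rat.∣ r j Rat.- r k ∣ Rat.≤ e
      r-cauchy {e} 0<e = proj₁ (recip-small 0<e) , λ {j} {k} N≤j N≤k → ∣∣-≤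
        (≤-move (near j k N≤k))
        (subst (Rat._≤ e) (flip (r j) (r k)) (≤-move (near k j N≤j)))
        where
        near : ∀ j k → proj₁ (recip-small 0<e) ℕ.≤ k → r j Rat.≤ r k Rat.+ e
        near j k N≤k = ℚₚ.≤-trans (r-near j k) (ℚₚ.+-monoʳ-≤ (r k) (proj₂ (recip-small 0<e) k N≤k))
        flip : ∀ a b → b Rat.- a ≡ Rat.- (a Rat.- b)
        flip = solve 2 (λ a b → b :- a := :- (a :- b)) refl

    ln : ℝ
    ln = record { seq = r ; cauchy = r-cauchy }

    opaque
      r≤ln : ∀ k → fromℚ (r k) ≤ ln
      r≤ln k 0<e = proj₁ (recip-small 0<e) , λ {n} N≤n →
        ℚₚ.≤-trans (r-near k n) (ℚₚ.+-monoʳ-≤ (r n) (proj₂ (recip-small 0<e) n N≤n))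

      ln≤r+recip : ∀ k → ln ≤ fromℚ (r k Rat.+ recip k)
      ln≤r+recip k 0<e = 0 , λ {n} _ → ℚₚ.≤-trans (r-near n k) (p≤p+q (ℚₚ.<⇒≤ 0<e))

      small-index : ∀ {η} → 0ℚ Rat.< η → ∃ λ k → recip k Rat.≤ η
      small-index 0<η = proj₁ (recip-small 0<η) , proj₂ (recip-small 0<η) _ ℕₚ.≤-refl

      widen : ∀ {η} k → recip k Rat.≤ η → ∀ x → x ≤ exp (fromℚ (r k Rat.+ recip k)) → x ≤ exp (fromℚ (r k Rat.+ η))
      widen {η} k le x x≤ = ≤-trans x (exp (fromℚ (r k Rat.+ recip k))) (exp (fromℚ (r k Rat.+ η))) x≤
        (RExp.exp-mono {fromℚ (r k Rat.+ recip k)} {fromℚ (r k Rat.+ η)}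
          (fromℚ-monoℝ (r k Rat.+ recip k) (r k Rat.+ η) (ℚₚ.+-monoʳ-≤ (r k) le)))

      exp-ln : exp ln ≈ fromℚ q
      exp-ln = ≤-antisym (exp ln) (fromℚ q)
        (RExp.exp-squeeze {exp ln} {fromℚ q} (RExp.exp-nonneg ln) below)
        (RExp.exp-squeeze {fromℚ q} {exp ln} (fromℚ-monoℝ 0ℚ q (ℚₚ.<⇒≤ 0<q)) above)
        where
        below : ∀ {η} → 0ℚ Rat.< η → ∃ λ r → exp (fromℚ r) ≤ fromℚ q × exp ln ≤ exp (fromℚ (r Rat.+ η))
        below {η} 0<η = r (proj₁ (small-index 0<η)) , lower (proj₁ (small-index 0<η)) ,
          widen (proj₁ (small-index 0<η)) (proj₂ (small-index 0<η)) (exp ln)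
            (RExp.exp-mono {ln} {fromℚ (r (proj₁ (small-index 0<η)) Rat.+ recip (proj₁ (small-index 0<η)))}
              (ln≤r+recip (proj₁ (small-index 0<η))))
        above : ∀ {η} → 0ℚ Rat.< η → ∃ λ r → exp (fromℚ r) ≤ exp ln × fromℚ q ≤ exp (fromℚ (r Rat.+ η))
        above {η} 0<η = r (proj₁ (small-index 0<η)) ,
          RExp.exp-mono {fromℚ (r (proj₁ (small-index 0<η)))} {ln} (r≤ln (proj₁ (small-index 0<η))) ,
          widen (proj₁ (small-index 0<η)) (proj₂ (small-index 0<η)) (fromℚ q) (upper (proj₁ (small-index 0<η)))

  opaque
    logarithm : ∀ q → 0ℚ Rat.< q → ∃ λ ℓ → exp ℓ ≈ fromℚ q
    logarithm q 0<q = ln 0<q , exp-ln 0<q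

    ∣x∣≈-x : ∀ x → x ≤ 0ℝ → ∣ x ∣ ≈ - x
    ∣x∣≈-x x x≤0 {e} 0<e with x≤0 (half-pos 0<e)
    ... | N , le = N , λ {n} N≤n → ∣∣-≤ (upper-bound (seq x n) (le N≤n)) (lower-bound (seq x n))
      where
      a≤-a+e : ∀ a → a Rat.≤ 0ℚ Rat.+ ½ Rat.* e → a Rat.≤ Rat.- a Rat.+ e
      a≤-a+e a a≤ = subst (Rat._≤ Rat.- a Rat.+ e) (solve 1 (λ a → :- a :+ (a :+ a) := a) refl a)
        (ℚₚ.+-monoʳ-≤ (Rat.- a) (ℚₚ.≤-trans (ℚₚ.+-mono-≤ a≤ a≤) (ℚₚ.≤-reflexive
          (trans (cong₂ Rat._+_ (ℚₚ.+-identityˡ (½ Rat.* e)) (ℚₚ.+-identityˡ (½ Rat.* e))) (half+half e)))))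
      upper-bound : ∀ a → a Rat.≤ 0ℚ Rat.+ ½ Rat.* e → Rat.∣ a ∣ Rat.- (Rat.- a) Rat.≤ e
      upper-bound a a≤ = ≤-move {Rat.∣ a ∣} {Rat.- a} {e}
          (∣∣-≤ {a} {Rat.- a Rat.+ e} (a≤-a+e a a≤) (p≤p+q (ℚₚ.<⇒≤ 0<e)))
      lower-bound : ∀ a → Rat.- (Rat.∣ a ∣ Rat.- (Rat.- a)) Rat.≤ e
      lower-bound a = subst (Rat._≤ e) (solve 2 (λ a b → :- a :- b := :- (b :- (:- a))) refl a Rat.∣ a ∣)
        (≤-move {Rat.- a} {Rat.∣ a ∣} {e} (ℚₚ.≤-trans
            (subst (Rat.- a Rat.≤_) (ℚₚ.∣-p∣≡∣p∣ a) (p≤∣p∣ (Rat.- a))) (p≤p+q (ℚₚ.<⇒≤ 0<e))))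

open import Data.Integer.Base using (+_)

-- Transfer of the walk argument to the Cauchy reals

module ℝ-BiasedWalk where
  open ℝ-Properties
  open Logarithm
  module SD = StationaryDistributions ℝ-field
  open BiasedWalk ℝ-field ℝ-exponential

  opaque
    <⇒R< : ∀ x y → x < y → x R.< y
    <⇒R< x y (q , 0<q , N , le) = q , 0<q , λ 0<e →
      N , λ {n} N≤n → ℚₚ.≤-trans (le N≤n) (ℚ-Lemmas.p≤p+q (ℚₚ.<⇒≤ 0<e))

    fromℕ-* : ∀ m n → fromℕ (m ℕ.* n) ≡ fromℕ m Rat.* fromℕ n
    fromℕ-* zero    n = ≡.trans ℚ-Lemmas.fromℕ-zero
        (≡.sym (≡.trans (≡.cong (λ z → z Rat.* fromℕ n) ℚ-Lemmas.fromℕ-zero) (ℚₚ.*-zeroˡ (fromℕ n))))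
    fromℕ-* (suc m) n = ≡.trans (NaturalFractions.fromℕ-+ n (m ℕ.* n))
        (≡.trans (≡.cong₂ Rat._+_ (≡.sym (ℚₚ.*-identityˡ (fromℕ n))) (fromℕ-* m n))
      (≡.trans (≡.sym (ℚₚ.*-distribʳ-+ (fromℕ n) 1ℚ (fromℕ m)))
          (≡.cong (λ z → z Rat.* fromℕ n) (≡.sym (ℚ-Lemmas.fromℕ-suc m)))))

    fromℚ-16* : ∀ t → fromℚ (+ (16 ℕ.* t) / 1) ≈ fromℚ (+ 16 / 1) * fromℚ (fromℕ t)
    fromℚ-16* t = pointwise (fromℚ (+ (16 ℕ.* t) / 1)) (fromℚ (+ 16 / 1) * fromℚ (fromℕ t)) λ _ →
      ≡.trans (NaturalFractions./1≡fromℕ (16 ℕ.* t)) (≡.trans (fromℕ-* 16 t)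
        (≡.cong (λ z → z Rat.* fromℕ t) (≡.sym (NaturalFractions./1≡fromℕ 16))))

    -- A stationary ν has total 1, so the scalar in the linear uniqueness statement is 1 and ν
    -- equals μ.
    invariant-line⇒stationary : ∀ {n} {Q : Matrix ℝ n} (line : SD.InvariantLine Q) →
      IsStationaryDistribution Q (SD.InvariantLine.μ line)
    invariant-line⇒stationary {Q = Q} line =
      record { nonneg = nonneg ; total = total ; balance = invariant } ,
      λ ν stationary x → ≈-trans (ν x) (sumℝ ν * μ x) (μ x)
        (unique ν (IsStationary.balance stationary) x)
        (≈-trans (sumℝ ν * μ x) (1ℝ * μ x) (μ x)
          (*-cong (sumℝ ν) 1ℝ (μ x) (μ x) (IsStationary.total stationary) (≈-refl (μ x)))
          (pointwise (1ℝ * μ x) (μ x) λ n → ℚₚ.*-identityˡ (seq (μ x) n)))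
      where open SD.InvariantLine line

  -- Stated for a variable q: comparing the two sides at an entry of P would unfold its rational arithmetic.
  mixture : ℝ → ℚ → ℝ → ℝ
  mixture ε q b = (1ℝ - ε) * fromℚ q + ε * b

  opaque
    mixture≈ : ∀ ε q b → mixture ε q b R.≈ (R.1# R.- ε) R.* R.fromℚ q R.+ ε R.* b
    mixture≈ ε q b = ≈-refl (mixture ε q b)

theorem4p3 : ∀ {n : ℕ} (G : SimpleGraph n) → SimpleGraph.Connected G →
    ∀ (ε : ℝ) → 0ℝ < ε → ε < 1ℝ →
    ∀ (tmix : ℕ) → RandomWalk.IsMixingTime G tmix →
    ∀ (v : Fin n) (lnp ln16t δ : ℝ) →
    IsLn (fromℚ (RandomWalk.π G v)) lnp →
    IsLn (fromℚ (+ (16 ℕ.* tmix) / 1)) ln16t →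
    δ * ∣ lnp ∣ ≈ ln16t →
    ∃ λ (B : Matrix ℝ n) → IsStrategy G B ×
    ∃ λ (μ : Fin n → ℝ) → IsStationaryDistribution (biasedWalk G ε B) μ ×
    exp ((1ℝ - ε + δ) * lnp) ≤ μ v
theorem4p3 {n} G connected ε 0<ε ε<1 tmix (mixed , _) v lnp ln16t δ exp-lnp exp-ln16t δ∣lnp∣≈ln16t =
  conclude S.boosting-strategy
  where
  open ℝ-Properties
  open Logarithm
  open ℝ-BiasedWalk
  module S = BiasedWalk.Strategy ℝ-field ℝ-exponential logarithm G connected
    {ε} (<⇒R< 0ℝ ε 0<ε) (<⇒R< ε 1ℝ ε<1) (mixture ε) (mixture≈ ε) {tmix} mixed {v} {lnp} exp-lnp
  lnp≤0 : lnp ≤ 0ℝ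
  lnp≤0 = S.lnp≤0
  conclude : (∃ λ B → S.Boosts B) →
    ∃ λ (B : Matrix ℝ n) → IsStrategy G B ×
    ∃ λ (μ : Fin n → ℝ) → IsStationaryDistribution (biasedWalk G ε B) μ ×
    exp ((1ℝ - ε + δ) * lnp) ≤ μ v
  conclude (B , nonneg , rowSum , supported , line , bound) =
    B , record { nonneg = nonneg ; rowSum = rowSum ; supported = supported } ,
    SD.InvariantLine.μ line , invariant-line⇒stationary line ,
    bound ln16t δ
      (≈-trans (exp ln16t) (fromℚ (+ (16 ℕ.* tmix) / 1)) (fromℚ (+ 16 / 1) * fromℚ (fromℕ tmix))
        exp-ln16t (fromℚ-16* tmix))
      -- Here π(v) ≤ 1 enters: ln π(v) ≤ 0 lets the absolute value in the definition of δ be read as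
      -- a negation.
      (≈-trans (δ * - lnp) (δ * ∣ lnp ∣) ln16t
        (*-cong δ δ (- lnp) ∣ lnp ∣ (≈-refl δ) (≈-sym ∣ lnp ∣ (- lnp) (∣x∣≈-x lnp lnp≤0)))
        δ∣lnp∣≈ln16t)
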